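{- Let $M$ be a regular matroid on a finite ground set $E$ and let $(\sigma,\sigma^*)$ be a triangulating circuit-cocircuit signature of $M$. Suppose that $\vec f$ is an arc (with support $\{f\}$) and $B_1,B_2\in\mathbf B(M)$ are bases such that \[[\vec f]\cdot \beta_{(M,\sigma,\sigma^*)}(B_1)=\beta_{(M,\sigma,\sigma^*)}(B_2).\] Then: (1) For any $e\in (E\setminus(B_1\cup B_2))\setminus\{f\}$ we have $[\vec f]\cdot \beta_{(M\setminus e,\sigma\setminus e,\sigma^*\setminus e)}(B_1)=\beta_{(M\setminus e,\sigma\setminus e,\sigma^*\setminus e)}(B_2)$. (2) For any $e\in (B_1\cap B_2)\setminus\{f\}$ we have $[\vec f]\cdot \beta_{(M/e,\sigma/e,\sigma^*/e)}(B_1\setminus e)=\beta_{(M/e,\sigma/e,\sigma^*/e)}(B_2\setminus e)$. (3) For any $e\in E$ lying in a different connected component of $M$ than $f$, we have $e\in B_1\iff e\in B_2$.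
   Context: $M=M(A)$ is represented by a real totally unimodular $r\times|E|$ matrix $A$ of full row rank with columns indexed by $E$; bases are the $r$-subsets of $E$ indexing nonsingular $r\times r$ submatrices; circuits are minimal subsets contained in no basis, cocircuits are minimal subsets meeting every basis. Elements of $\mathbb Z^E$ are 1-chains; $\vec P(x)$ is the coefficient of $x$, $P$ the support, $\vec P\setminus e$ the restriction to $E\setminus\{e\}$. A 1-chain is simple if its coefficients lie in $\{ -1,0,1\}$; an arc is a simple 1-chain with one-element support. A signed circuit (resp. signed cocircuit) is a simple 1-chain in $\ker A$ (resp. in the row space of $A$) whose support is a circuit (resp. cocircuit). An orientation is a map $\vec O:E\to\{+,-\}$; a 1-chain $\vec P$ is compatible with $\vec O$ ($\vec P\sim\vec O$) if for all $x\in P$ the sign of $\vec P(x)$ equals $\vec O(x)$. For $P\subseteq E$, $\mathrm{rev}_P(\vec O)$ switches the signs of $\vec O$ on $P$. Orientations are circuit-cocircuit equivalent if related by a sequence of moves $\vec O\mapsto\mathrm{rev}_C(\vec O)$ with $\vec C$ a signed circuit or signed cocircuit compatible with $\vec O$; $[\vec O]$ denotes the class. The sandpile group is $S(M)=\mathbb Z^E/(\Lambda+\Lambda^*)$ where $\Lambda,\Lambda^*$ are the lattices generated by signed circuits and signed cocircuits; $[\vec P]$ is the class of $\vec P$. The canonical action of $S(M)$ on equivalence classes is determined by: for an arc $\vec f$ and a class $G$, choose $\vec O\in G$ with $-\vec f\sim\vec O$ (one always exists) and set $[\vec f]\cdot G=[\mathrm{rev}_{\{f\}}(\vec O)]$;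 this is a well-defined simply transitive action. A circuit signature $\sigma$ chooses for each circuit $C$ one of its two signed circuits $\sigma(C)$; a cocircuit signature $\sigma^*$ likewise for cocircuits. A fourientation is a map $\vec F:E\to\{\emptyset,+,-,\pm\}$ (subsets of $\{+,-\}$); $-\vec F$ swaps $+$ and $-$, $\vec F^c(x)=\{+,-\}\setminus\vec F(x)$, intersections are pointwise; $\vec P\sim\vec F$ if for every $x\in P$ the sign of $\vec P(x)$ lies in $\vec F(x)$. For a basis $B$, $e\notin B$ has fundamental circuit $C_e\subseteq B\cup\{e\}$ and $e\in B$ has fundamental cocircuit $C^*_e\subseteq(E\setminus B)\cup\{e\}$. $\vec F(B,\sigma)$ is $\pm$ on $B$ and equals the sign of $\sigma(C_x)(x)$ at $x\notin B$; $\vec F(B,\sigma^*)$ is $\pm$ on $E\setminus B$ and equals the sign of $\sigma^*(C^*_x)(x)$ at $x\in B$. $\sigma$ is triangulating if for distinct bases $B_1,B_2$ no signed circuit is compatible with $\vec F(B_1,\sigma)\cap-\vec F(B_2,\sigma)$; $\sigma^*$ is triangulating if likewise no signed cocircuit is compatible with $\vec F(B_1,\sigma^*)\cap-\vec F(B_2,\sigma^*)$; $(\sigma,\sigma^*)$ is triangulating if both are. An orientation is $(\sigma,\sigma^*)$-compatible if every signed circuit compatible with it is in $\sigma$ and every signed cocircuit compatible with it is in $\sigma^*$; for triangulating $(\sigma,\sigma^*)$ each equivalence class contains exactly one such orientation, denoted $[\vec O]^\circ$, and for $s\in S(M)$ and $(\sigma,\sigma^*)$-compatible $\vec O$ one sets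 $s\cdot\vec O:=(s\cdot[\vec O])^\circ$. The BBY map is $\beta_{(M,\sigma,\sigma^*)}(B)=\vec F(B,\sigma)\cap\vec F(B,\sigma^*)$, a bijection from bases onto $(\sigma,\sigma^*)$-compatible orientations. Minors: for $e$ not a coloop, $M\setminus e$ has ground set $E\setminus\{e\}$, bases $\{B:e\notin B\}$ and is represented by $A$ with column $e$ deleted; for $e$ not a loop, $M/e$ has bases $\{B\setminus e:e\in B\}$. Signed circuits of $M\setminus e$ are $\vec C\setminus e$ for signed circuits $\vec C$ of $M$ with $\vec C(e)=0$; signed circuits of $M/e$ are the support-minimal nonzero 1-chains among $\{\vec C\setminus e\}$; dually, signed cocircuits of $M/e$ are $\vec C^*\setminus e$ with $\vec C^*(e)=0$, and those of $M\setminus e$ are the support-minimal nonzero ones among $\{\vec C^*\setminus e\}$. $\sigma\setminus e=\{\vec C\setminus e:\vec C\in\sigma\}\cap\{\text{signed circuits of }M\setminus e\}$, $\sigma/e$ analogously with $M/e$, and similarly for $\sigma^*$; these are triangulating signatures of the minors. Connected components of $M$ are the classes of the relation "there is a circuit containing both elements" (together with equality). -}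

module Defs where

open import Level using (0ℓ)
open import Data.Nat using (ℕ; zero; suc)
open import Data.Integer using (ℤ; +_; -_; _+_; _*_; _<_; -1ℤ; 0ℤ; 1ℤ)
open import Data.Integer.Properties using () renaming (_≟_ to _≟ℤ_)
import Data.Rational as Q
open import Data.Fin using (Fin; zero; suc; toℕ; punchIn)
open import Data.Fin.Subset using (Subset; _∈_; _∉_; _⊆_; _∪_; ∁; ⁅_⁆; _-_)
open import Data.Vec using (Vec; lookup; tabulate; map; _[_]≔_)
open import Data.Bool using (Bool; true; false; not; if_then_else_)
open import Data.Product using (Σ; ∃; ∃-syntax; _×_; _,_)
open import Data.Sum using (_⊎_)
open import Relation.Nullary using (¬_; does)
open import Relation.Binary.PropositionalEquality using (_≡_; _≢_)
open import Function.Bundles using (_⇔_)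

sumFin : ∀ {k} → (Fin k → ℤ) → ℤ
sumFin {zero} g = 0ℤ
sumFin {suc k} g = g zero + sumFin (λ i → g (suc i))

sumFinℚ : ∀ {k} → (Fin k → Q.ℚ) → Q.ℚ
sumFinℚ {zero} g = Q.0ℚ
sumFinℚ {suc k} g = g zero Q.+ sumFinℚ (λ i → g (suc i))

altSign : ∀ {k} → Fin k → ℤ
altSign zero = 1ℤ
altSign (suc j) = - altSign j

det : (k : ℕ) → (Fin k → Fin k → ℤ) → ℤ
det zero m = 1ℤ
det (suc k) m = sumFin (λ j → altSign j * (m zero j * det k (λ a b → m (suc a) (punchIn j b))))

Matrix : ℕ → ℕ → Set
Matrix r n = Vec (Vec ℤ n) r

entry : ∀ {r n} → Matrix r n → Fin r → Fin n → ℤ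
entry A i j = lookup (lookup A i) j

-- totally unimodular: every square submatrix has determinant in {-1,0,1}
-- (rows/columns chosen by arbitrary maps; repeated rows/columns give det 0)
TotallyUnimodular : ∀ {r n} → Matrix r n → Set
TotallyUnimodular {r} {n} A =
  ∀ (k : ℕ) (ρ : Fin k → Fin r) (κ : Fin k → Fin n) →
    let d = det k (λ a b → entry A (ρ a) (κ b)) in
    d ≡ -1ℤ ⊎ d ≡ 0ℤ ⊎ d ≡ 1ℤ

toℚ : ℤ → Q.ℚ
toℚ z = z Q./ 1

rowComb : ∀ {r n} → Matrix r n → (Fin r → Q.ℚ) → Fin n → Q.ℚ
rowComb A y j = sumFinℚ (λ i → y i Q.* toℚ (entry A i j))

FullRowRank : ∀ {r n} → Matrix r n → Set
FullRowRank A = ∀ y → (∀ j → rowComb A y j ≡ Q.0ℚ) → ∀ i → y i ≡ Q.0ℚ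

Chain : ℕ → Set
Chain n = Vec ℤ n

data Sign : Set where
  plus minus : Sign

flipS : Sign → Sign
flipS plus = minus
flipS minus = plus

Orientation : ℕ → Set
Orientation n = Vec Sign n

SignIs : ℤ → Sign → Set
SignIs z plus = 0ℤ < z
SignIs z minus = z < 0ℤ

negC : ∀ {n} → Chain n → Chain n
negC = map (λ z → - z)

isZero : ℤ → Bool
isZero z = does (z ≟ℤ 0ℤ)

supp : ∀ {n} → Chain n → Subset n
supp c = map (λ z → not (isZero z)) c

IsSimple : ∀ {n} → Chain n → Set
IsSimple {n} c = ∀ (x : Fin n) → lookup c x ≡ -1ℤ ⊎ lookup c x ≡ 0ℤ ⊎ lookup c x ≡ 1ℤ

NonZeroChain : ∀ {n} → Chain n → Set
NonZeroChain {n} c = ∃[ x ] lookup c x ≢ 0ℤ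

-- restriction to E ∖ {e}, represented as the chain with coefficient 0 at e
restr : ∀ {n} → Fin n → Chain n → Chain n
restr e c = c [ e ]≔ 0ℤ

Compat : ∀ {n} → Chain n → Orientation n → Set
Compat {n} c o = ∀ (x : Fin n) (s : Sign) → SignIs (lookup c x) s → lookup o x ≡ s

rev : ∀ {n} → Chain n → Orientation n → Orientation n
rev c o = tabulate (λ x → if isZero (lookup c x) then lookup o x else flipS (lookup o x))

rev1 : ∀ {n} → Fin n → Orientation n → Orientation n
rev1 f o = o [ f ]≔ flipS (lookup o f)

-- An (oriented) matroid-like structure on a subset of Fin n: ground set,
-- bases, signed circuits, signed cocircuits.  Minors keep the index type
-- Fin n; their ground set is E ∖ {e}, and their 1-chains vanish at e.

record SMat (n : ℕ) : Set₁ where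
  field
    Gr    : Fin n → Set
    Basis : Subset n → Set
    SC    : Chain n → Set
    SCo   : Chain n → Set
open SMat public

module _ {r n : ℕ} (A : Matrix r n) where

  IsBasisA : Subset n → Set
  IsBasisA B = Σ (Fin r → Fin n) λ κ →
      (∀ x → (x ∈ B) ⇔ (∃[ j ] κ j ≡ x))
    × (∀ j j' → κ j ≡ κ j' → j ≡ j')
    × det r (λ a b → entry A a (κ b)) ≢ 0ℤ

  InNoBasis : Subset n → Set
  InNoBasis C = ∀ B → IsBasisA B → ¬ (C ⊆ B)

  MeetsEveryBasis : Subset n → Set
  MeetsEveryBasis C = ∀ B → IsBasisA B → ∃[ x ] (x ∈ C × x ∈ B)

  IsCircuitA : Subset n → Set
  IsCircuitA C = InNoBasis C × (∀ D → D ⊆ C → InNoBasis D → C ⊆ D)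

  IsCocircuitA : Subset n → Set
  IsCocircuitA C = MeetsEveryBasis C × (∀ D → D ⊆ C → MeetsEveryBasis D → C ⊆ D)

  InKer : Chain n → Set
  InKer c = ∀ i → sumFin (λ j → entry A i j * lookup c j) ≡ 0ℤ

  -- row space over ℚ (equivalently ℝ, A and c being integral)
  InRowSpace : Chain n → Set
  InRowSpace c = ∃[ y ] (∀ j → rowComb A y j ≡ toℚ (lookup c j))

  MA : SMat n
  MA = record
    { Gr    = λ _ → Data.Unit.⊤
    ; Basis = IsBasisA
    ; SC    = λ c → IsSimple c × InKer c × IsCircuitA (supp c)
    ; SCo   = λ c → IsSimple c × InRowSpace c × IsCocircuitA (supp c)
    }
    where import Data.Unit

  SameComponent : Fin n → Fin n → Set
  SameComponent e f = e ≡ f ⊎ ∃[ C ] (IsCircuitA C × e ∈ C × f ∈ C)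

RestrOf : ∀ {n} → Fin n → (Chain n → Set) → Chain n → Set
RestrOf e P d = ∃[ c ] (P c × d ≡ restr e c)

RestrOfZero : ∀ {n} → Fin n → (Chain n → Set) → Chain n → Set
RestrOfZero e P d = ∃[ c ] (P c × lookup c e ≡ 0ℤ × d ≡ restr e c)

MinRestrOf : ∀ {n} → Fin n → (Chain n → Set) → Chain n → Set
MinRestrOf e P d = RestrOf e P d × NonZeroChain d
  × (∀ d' → RestrOf e P d' → NonZeroChain d' → supp d' ⊆ supp d → supp d ⊆ supp d')

deletion : ∀ {n} → SMat n → Fin n → SMat n
deletion M e = record
  { Gr    = λ x → x ≢ e
  ; Basis = λ B → Basis M B × e ∉ B
  ; SC    = RestrOfZero e (SC M)
  ; SCo   = MinRestrOf e (SCo M)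
  }

contraction : ∀ {n} → SMat n → Fin n → SMat n
contraction M e = record
  { Gr    = λ x → x ≢ e
  ; Basis = λ B' → ∃[ B ] (Basis M B × e ∈ B × B' ≡ B - e)
  ; SC    = MinRestrOf e (SC M)
  ; SCo   = RestrOfZero e (SCo M)
  }

minorSig : ∀ {n} → Fin n → (Chain n → Set) → (Chain n → Set) → Chain n → Set
minorSig e σ SCminor d = RestrOf e σ d × SCminor d

module _ {n : ℕ} (M : SMat n) where

  IsSignature : (Chain n → Set) → (Chain n → Set) → Set
  IsSignature S σ = (∀ c → σ c → S c) × (∀ c → S c → σ c ⊎ σ (negC c))
                  × (∀ c → σ c → ¬ σ (negC c))

  CircuitSignature : (Chain n → Set) → Set
  CircuitSignature = IsSignature (SC M)

  CocircuitSignature : (Chain n → Set) → Set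
  CocircuitSignature = IsSignature (SCo M)

  -- s ∈ F(B,σ)(x): x ∈ B, or the σ-signed fundamental circuit C_x has sign s at x
  InFσ : (Chain n → Set) → Subset n → Fin n → Sign → Set
  InFσ σ B x s = x ∈ B ⊎ (x ∉ B × ∃[ c ] (σ c × supp c ⊆ (B ∪ ⁅ x ⁆) × SignIs (lookup c x) s))

  -- s ∈ F(B,σ*)(x): x ∉ B, or the σ*-signed fundamental cocircuit C*_x has sign s at x
  InFσ* : (Chain n → Set) → Subset n → Fin n → Sign → Set
  InFσ* σ* B x s = x ∉ B ⊎ (x ∈ B × ∃[ c ] (σ* c × supp c ⊆ (∁ B ∪ ⁅ x ⁆) × SignIs (lookup c x) s))

  SameSubset : Subset n → Subset n → Set
  SameSubset B₁ B₂ = ∀ x → Gr M x → (x ∈ B₁) ⇔ (x ∈ B₂)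

  TriangulatingC : (Chain n → Set) → Set
  TriangulatingC σ = ∀ B₁ B₂ → Basis M B₁ → Basis M B₂ → ¬ SameSubset B₁ B₂ →
    ∀ c → SC M c → ¬ (∀ x s → SignIs (lookup c x) s → InFσ σ B₁ x s × InFσ σ B₂ x (flipS s))

  TriangulatingCo : (Chain n → Set) → Set
  TriangulatingCo σ* = ∀ B₁ B₂ → Basis M B₁ → Basis M B₂ → ¬ SameSubset B₁ B₂ →
    ∀ c → SCo M c → ¬ (∀ x s → SignIs (lookup c x) s → InFσ* σ* B₁ x s × InFσ* σ* B₂ x (flipS s))

  Triangulating : (Chain n → Set) → (Chain n → Set) → Set
  Triangulating σ σ* = TriangulatingC σ × TriangulatingCo σ*

  -- o is the orientation β_(M,σ,σ*)(B) = F(B,σ) ∩ F(B,σ*) (on the ground set)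
  IsBBY : (Chain n → Set) → (Chain n → Set) → Subset n → Orientation n → Set
  IsBBY σ σ* B o = ∀ x → Gr M x →
      (x ∈ B → ∃[ c ] (σ* c × supp c ⊆ (∁ B ∪ ⁅ x ⁆) × SignIs (lookup c x) (lookup o x)))
    × (x ∉ B → ∃[ c ] (σ c × supp c ⊆ (B ∪ ⁅ x ⁆) × SignIs (lookup c x) (lookup o x)))

  data Equiv : Orientation n → Orientation n → Set where
    agree : ∀ {o p} → (∀ x → Gr M x → lookup o x ≡ lookup p x) → Equiv o p
    move  : ∀ {o} c → SC M c ⊎ SCo M c → Compat c o → Equiv o (rev c o)
    symm  : ∀ {o p} → Equiv o p → Equiv p o
    trans : ∀ {o p q} → Equiv o p → Equiv p q → Equiv o q

  -- [f⃗]·[o] = [p] for the arc f⃗ with support {f} and sign s at f: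
  -- choose o' ∈ [o] with -f⃗ compatible with o', then [f⃗]·[o] = [rev_{f}(o')]
  ArcAct : Fin n → Sign → Orientation n → Orientation n → Set
  ArcAct f s o p = ∃[ o' ] (Equiv o' o × lookup o' f ≡ flipS s × Equiv (rev1 f o') p)

{-# OPTIONS --safe #-}
module Submission where

-- Let V be the integral kernel of A and W its row space.  Orientations (as 0/1-vectors) are
-- equivalent exactly when they differ by an element of V + W, so that [f]·[O₁] = [O₂] means
-- O₂ − O₁ = z + w + f with z ∈ V and w ∈ W, and in M∖e (M/e) the same holds for the
-- restrictions as soon as z(e) = 0 (w(e) = 0).  Since ⟨z,w⟩ = 0 while z(x)w(x) ≤ 0 for all
-- x ≠ f, the vectors z and w are conformal to O₂ − O₁ except at one element h at most.  If
-- B₁ ≠ B₂, the triangulating property says that no circuit fits F(B₁,σ) ∩ −F(B₂,σ) and no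
-- cocircuit fits F(B₁,σ*) ∩ −F(B₂,σ*).  Painting at h yields a circuit C or a cocircuit D;
-- −z − C fits the first fourientation, so C = −z and z vanishes off B₁ ∪ B₂ ∪ f, whereas D − w
-- would be a nonzero vector fitting the second one.  Everything is symmetric under exchanging
-- V and W and complementing the bases.  For (3), z and w are supported in the component of f,
-- so painting at e ∈ B₁ △ B₂ produces a cocircuit on which O₁ = O₂, and its negative fits the
-- second fourientation.

open import Defs hiding (trans)
open import Algebra.Bundles using (CommutativeRing)
open import Data.Bool using (Bool; true; false; not; T; if_then_else_; _∧_; _∨_)
open import Data.Bool.ListAction using (all)
import Data.Bool.Properties as 𝔹
open import Data.Empty using (⊥; ⊥-elim)
open import Data.Fin using (Fin; zero; suc; punchIn; _≟_)
open import Data.Fin.Properties using (suc-injective; any?; all?; injective⇒≤)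
open import Data.Fin.Subset using (Subset; _∈_; _∉_; _⊆_; _∪_; ∁; ⁅_⁆; _-_)
open import Data.Fin.Subset.Properties using (_∈?_; x∈p∪q⁻; x∈p∪q⁺; x∈⁅x⁆; x∈⁅y⁆⇒x≡y;
  x∈∁p⇒x∉p; x∉p⇒x∈∁p; x∈p∧x≢y⇒x∈p-y; p─q⊆p)
open import Data.Integer using (ℤ; +_; -[1+_]; +[1+_]; -_; _+_; _*_; _≤_; _<_; 0ℤ; 1ℤ; -1ℤ;
  +≤+; -<+; +<+; ∣_∣)
import Data.Integer.Properties as ℤP
open import Data.Integer.Tactic.RingSolver using (solve-∀)
open import Data.List using (List; []; _∷_; allFin; cartesianProduct)
open import Data.List.Membership.Propositional using () renaming (_∈_ to _∈ˡ_)
open import Data.List.Membership.Propositional.Properties using (∈-allFin; ∈-cartesianProduct⁺)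
open import Data.List.Relation.Unary.Any using (here; there)
open import Data.Nat as ℕ using (ℕ; zero; suc; z≤n; s≤s)
open import Data.Nat.Induction using (<-wellFounded)
import Data.Nat.Properties as ℕP
open import Data.Product using (∃; ∃-syntax; Σ-syntax; _×_; _,_; proj₁; proj₂)
import Data.Rational as Q
import Data.Rational.Properties as ℚP
import Data.Rational.Unnormalised as Qᵘ
import Data.Rational.Unnormalised.Properties as ℚᵘP
open import Data.Sum as Sum using (_⊎_; inj₁; inj₂; [_,_]′)
open import Data.Unit using (⊤; tt)
open import Data.Vec using (lookup; tabulate; _[_]≔_)
open import Data.Vec.Functional using () renaming (_∷_ to _◂_)
open import Data.Vec.Properties using (lookup∘tabulate; lookup∘update; lookup∘update′;
  tabulate∘lookup; tabulate-cong; []=⇒lookup; lookup⇒[]=; lookup-map)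
open import Function using (_∘_; id)
open import Function.Bundles using (_⇔_; mk⇔; Equivalence)
open import Induction.WellFounded using (Acc; acc)
open import Relation.Binary.PropositionalEquality
  using (_≡_; _≢_; refl; sym; trans; cong; cong₂; subst; subst₂; module ≡-Reasoning)
open import Relation.Nullary using (¬_; Dec; yes; no; does; contradiction)
open import Relation.Nullary.Decidable using (¬?; _×-dec_; dec-true; dec-false; decidable-stable)
open import Algebra.Properties.AbelianGroup ℤP.+-0-abelianGroup
  using () renaming (∙-cancelˡ to +-cancelˡ)
open import Algebra.Properties.Semiring.Sum (CommutativeRing.semiring ℚP.+-*-commutativeRing)
  using (sum; sum-cong-≗; ∑-comm; ∑-distrib-+; *-distribˡ-sum; sum-replicate-zero)

-- The abstract half sees the matroid only through `RegularPair`, an interface that is self-dual and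
-- closed under deletion, so `swap` turns circuits into cocircuits and deletion into contraction.
-- Bases appear there only as Boolean functions whose two colourings are `Free`. Painting also
-- settles what cannot be searched for, such as support-minimality in a group that need not be
-- finite: a negative answer comes with an orthogonal vector as certificate. The concrete half
-- derives the interface from determinants and identifies signed circuits and cocircuits with
-- `Elementary` vectors. The single exceptional element comes from counting: if z(f)w(f) is positive
-- it equals 1, the products sum to zero, and integrality leaves exactly one other element with a
-- nonzero product. At an ordinary element the compatibility claims involve only two memberships,
-- two signs and coefficients -1, 0, 1, so they are decided by evaluating all cases. Equal bases
-- need a separate argument, since the triangulating property says nothing about them.

1≢0 : 1ℤ ≢ 0ℤ
1≢0 ()

zero-right : ∀ a b → a * (b * 0ℤ) ≡ 0ℤ
zero-right = solve-∀

zero-or-not : ∀ {k} (g : Fin k → ℤ) → (∃[ i ] g i ≢ 0ℤ) ⊎ (∀ i → g i ≡ 0ℤ)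
zero-or-not g with any? (λ i → ¬? (g i ℤP.≟ 0ℤ))
... | yes p = inj₁ p
... | no none = inj₂ λ i → decidable-stable (g i ℤP.≟ 0ℤ) λ gi≢0 → none (i , gi≢0)

*-exchange : ∀ a b c → a * (b * c) ≡ b * (a * c)
*-exchange = solve-∀

-- Finite integer sums.

sum-cong : ∀ {k} {g h : Fin k → ℤ} → (∀ i → g i ≡ h i) → sumFin g ≡ sumFin h
sum-cong {zero} eq = refl
sum-cong {suc k} eq = cong₂ _+_ (eq zero) (sum-cong (eq ∘ suc))

sum-zero : ∀ {k} {g : Fin k → ℤ} → (∀ i → g i ≡ 0ℤ) → sumFin g ≡ 0ℤ
sum-zero {zero} eq = refl
sum-zero {suc k} eq = cong₂ _+_ (eq zero) (sum-zero (eq ∘ suc))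

sum-+ : ∀ {k} (g h : Fin k → ℤ) → sumFin (λ i → g i + h i) ≡ sumFin g + sumFin h
sum-+ {zero} g h = refl
sum-+ {suc k} g h = trans (cong (λ t → g zero + h zero + t) (sum-+ (g ∘ suc) (h ∘ suc))) (interchange (g zero) (h zero) (sumFin (g ∘ suc)) (sumFin (h ∘ suc)))
  where
  interchange : ∀ a b c d → a + b + (c + d) ≡ a + c + (b + d)
  interchange = solve-∀

sum-*ˡ : ∀ {k} c (g : Fin k → ℤ) → c * sumFin g ≡ sumFin (λ i → c * g i)
sum-*ˡ {zero} c g = ℤP.*-zeroʳ c
sum-*ˡ {suc k} c g = trans (ℤP.*-distribˡ-+ c (g zero) (sumFin (g ∘ suc))) (cong (λ t → c * g zero + t) (sum-*ˡ c (g ∘ suc)))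

sum-swap : ∀ {k l} (g : Fin k → Fin l → ℤ) →
  sumFin (λ i → sumFin (g i)) ≡ sumFin (λ j → sumFin (λ i → g i j))
sum-swap {zero} {l} g = sym (sum-zero {l} λ _ → refl)
sum-swap {suc k} g =
  trans (cong (λ t → sumFin (g zero) + t) (sum-swap (g ∘ suc)))
    (sym (sum-+ (g zero) (λ j → sumFin (λ i → g (suc i) j))))

-- Determinants: column expansion, transposition, alternation.

det-cong : ∀ k (m m′ : Fin k → Fin k → ℤ) → (∀ a b → m a b ≡ m′ a b) → det k m ≡ det k m′
det-cong zero m m′ eq = refl
det-cong (suc k) m m′ eq = sum-cong λ j →
  cong (altSign j *_) (cong₂ _*_ (eq zero j) (det-cong k (λ a b → m (suc a) (punchIn j b)) (λ a b → m′ (suc a) (punchIn j b))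
    λ a b → eq (suc a) (punchIn j b)))

-- Row and column expansion share the corner term. Expanding the other minors along their first
-- column turns the rest into one double sum over the later rows and columns, which does not change
-- when the two roles are exchanged.
det-expand-column : ∀ k (m : Fin (suc k) → Fin (suc k) → ℤ) →
  det (suc k) m ≡
  sumFin (λ i → altSign i * (m i zero * det k (λ a b → m (punchIn i a) (suc b))))
det-expand-column zero m = refl
det-expand-column (suc k) m = cong (λ t → 1ℤ * (m zero zero * det (suc k) (λ a b → m (suc a) (suc b))) + t) (begin
  sumFin (λ j → - altSign j * (m zero (suc j) * det (suc k) (λ a b → m (suc a) (punchIn (suc j) b))))
    ≡⟨ sum-cong (λ j → trans
         (cong (λ d → - altSign j * (m zero (suc j) * d))
           (det-expand-column k (λ a b → m (suc a) (punchIn (suc j) b))))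
         (push-in (- altSign j) (m zero (suc j)) (λ i → altSign i * (m (suc i) zero * D i j)))) ⟩
  sumFin (λ j → sumFin (λ i → - altSign j * (m zero (suc j) * (altSign i * (m (suc i) zero * D i j)))))
    ≡⟨ sum-swap (λ j i → - altSign j * (m zero (suc j) * (altSign i * (m (suc i) zero * D i j)))) ⟩
  sumFin (λ i → sumFin (λ j → - altSign j * (m zero (suc j) * (altSign i * (m (suc i) zero * D i j)))))
    ≡⟨ sum-cong (λ i → trans
         (sum-cong λ j → exchange (altSign j) (m zero (suc j)) (altSign i) (m (suc i) zero) (D i j))
         (sym (push-in (- altSign i) (m (suc i) zero) (λ j → altSign j * (m zero (suc j) * D i j))))) ⟩
  sumFin (λ i → - altSign i * (m (suc i) zero * det (suc k) (λ a b → m (punchIn (suc i) a) (suc b))))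
    ∎)
  where
  open ≡-Reasoning
  D : Fin (suc k) → Fin (suc k) → ℤ
  D i j = det k (λ a b → m (suc (punchIn i a)) (suc (punchIn j b)))
  push-in : ∀ {l} x y (g : Fin l → ℤ) → x * (y * sumFin g) ≡ sumFin (λ i → x * (y * g i))
  push-in x y g = trans (cong (x *_) (sum-*ˡ y g)) (sum-*ˡ x (λ i → y * g i))
  exchange : ∀ a b c d e → - a * (b * (c * (d * e))) ≡ - c * (d * (a * (b * e)))
  exchange = solve-∀

det-transpose : ∀ k (m : Fin k → Fin k → ℤ) → det k (λ a b → m b a) ≡ det k m
det-transpose zero m = refl
det-transpose (suc k) m = trans
  (sum-cong λ j → cong (λ d → altSign j * (m j zero * d))
    (det-transpose k (λ a b → m (punchIn j a) (suc b))))
  (sym (det-expand-column k m))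

-- Induction through the column expansion: for column zero the entries split, for a later column the
-- minors do.
det-add : ∀ k (c : Fin k) (m m₁ m₂ : Fin k → Fin k → ℤ) →
  (∀ a → m a c ≡ m₁ a c + m₂ a c) →
  (∀ a b → b ≢ c → m a b ≡ m₁ a b) → (∀ a b → b ≢ c → m a b ≡ m₂ a b) →
  det k m ≡ det k m₁ + det k m₂
det-add (suc k) c m m₁ m₂ add eq₁ eq₂ = begin
  det (suc k) m                  ≡⟨ det-expand-column k m ⟩
  sumFin (term m)                ≡⟨ sum-cong (split c add eq₁ eq₂) ⟩
  sumFin (λ i → term m₁ i + term m₂ i) ≡⟨ sum-+ (term m₁) (term m₂) ⟩
  sumFin (term m₁) + sumFin (term m₂)
    ≡⟨ cong₂ _+_ (det-expand-column k m₁) (det-expand-column k m₂) ⟨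
  det (suc k) m₁ + det (suc k) m₂ ∎
  where
  open ≡-Reasoning
  minor : (Fin (suc k) → Fin (suc k) → ℤ) → Fin (suc k) → ℤ
  minor x i = det k (λ a b → x (punchIn i a) (suc b))
  term : (Fin (suc k) → Fin (suc k) → ℤ) → Fin (suc k) → ℤ
  term x i = altSign i * (x i zero * minor x i)
  distrib₁ : ∀ s x y d → s * ((x + y) * d) ≡ s * (x * d) + s * (y * d)
  distrib₁ = solve-∀
  distrib₂ : ∀ s x d e → s * (x * (d + e)) ≡ s * (x * d) + s * (x * e)
  distrib₂ = solve-∀
  split : ∀ c → (∀ a → m a c ≡ m₁ a c + m₂ a c) →
    (∀ a b → b ≢ c → m a b ≡ m₁ a b) → (∀ a b → b ≢ c → m a b ≡ m₂ a b) →
    ∀ i → term m i ≡ term m₁ i + term m₂ i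
  split zero add eq₁ eq₂ i = begin
    altSign i * (m i zero * minor m i)
      ≡⟨ cong (λ x → altSign i * (x * minor m i)) (add i) ⟩
    altSign i * ((m₁ i zero + m₂ i zero) * minor m i)
      ≡⟨ distrib₁ (altSign i) (m₁ i zero) (m₂ i zero) (minor m i) ⟩
    altSign i * (m₁ i zero * minor m i) + altSign i * (m₂ i zero * minor m i)
      ≡⟨ cong₂ (λ d e → altSign i * (m₁ i zero * d) + altSign i * (m₂ i zero * e))
           (det-cong k (λ a b → m (punchIn i a) (suc b)) (λ a b → m₁ (punchIn i a) (suc b)) λ a b → eq₁ (punchIn i a) (suc b) λ ())
           (det-cong k (λ a b → m (punchIn i a) (suc b)) (λ a b → m₂ (punchIn i a) (suc b)) λ a b → eq₂ (punchIn i a) (suc b) λ ()) ⟩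
    term m₁ i + term m₂ i ∎
  split (suc c) add eq₁ eq₂ i = begin
    altSign i * (m i zero * minor m i)
      ≡⟨ cong (λ d → altSign i * (m i zero * d))
           (det-add k c (λ a b → m (punchIn i a) (suc b)) (λ a b → m₁ (punchIn i a) (suc b))
             (λ a b → m₂ (punchIn i a) (suc b)) (λ a → add (punchIn i a))
             (λ a b b≢c → eq₁ (punchIn i a) (suc b) (b≢c ∘ suc-injective))
             (λ a b b≢c → eq₂ (punchIn i a) (suc b) (b≢c ∘ suc-injective))) ⟩
    altSign i * (m i zero * (minor m₁ i + minor m₂ i))
      ≡⟨ distrib₂ (altSign i) (m i zero) (minor m₁ i) (minor m₂ i) ⟩
    altSign i * (m i zero * minor m₁ i) + altSign i * (m i zero * minor m₂ i)
      ≡⟨ cong₂ (λ x y → altSign i * (x * minor m₁ i) + altSign i * (y * minor m₂ i))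
           (eq₁ i zero λ ()) (eq₂ i zero λ ()) ⟩
    term m₁ i + term m₂ i ∎

Alternating : ℕ → Set
Alternating k = ∀ (m : Fin k → Fin k → ℤ) p q → p ≢ q → (∀ a → m a p ≡ m a q) → det k m ≡ 0ℤ

tail-columns : ∀ {k} → Alternating k → ∀ (m : Fin (suc k) → Fin (suc k) → ℤ) p q → p ≢ q →
  (∀ a → m a (suc p) ≡ m a (suc q)) → det (suc k) m ≡ 0ℤ
tail-columns {k} ih m p q p≢q eq = trans (det-expand-column k m) (sum-zero λ i →
  trans (cong (λ d → altSign i * (m i zero * d)) (ih (λ a b → m (punchIn i a) (suc b)) p q p≢q λ a → eq (punchIn i a)))
        (zero-right (altSign i) (m i zero)))

-- In the row expansion the first two terms carry equal minors with opposite signs; every further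
-- minor still contains both equal columns.
first-two-columns : ∀ {k} → Alternating (suc k) → (m : Fin (suc (suc k)) → Fin (suc (suc k)) → ℤ) →
  (∀ a → m a zero ≡ m a (suc zero)) → det (suc (suc k)) m ≡ 0ℤ
first-two-columns {k} ih m eq = begin
  1ℤ * (m zero zero * D₀) + (-1ℤ * (m zero (suc zero) * D₁) + rest)
    ≡⟨ cong₂ (λ x y → 1ℤ * (m zero zero * D₀) + (-1ℤ * (x * y) + rest)) (sym (eq zero)) (sym D₀≡D₁) ⟩
  1ℤ * (m zero zero * D₀) + (-1ℤ * (m zero zero * D₀) + rest)
    ≡⟨ cong (λ x → 1ℤ * (m zero zero * D₀) + (-1ℤ * (m zero zero * D₀) + x)) (rest≡0 k ih m eq) ⟩
  1ℤ * (m zero zero * D₀) + (-1ℤ * (m zero zero * D₀) + 0ℤ)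
    ≡⟨ cancel (m zero zero * D₀) ⟩
  0ℤ ∎
  where
  open ≡-Reasoning
  D₀ = det (suc k) (λ a b → m (suc a) (suc b))
  D₁ = det (suc k) (λ a b → m (suc a) (punchIn (suc zero) b))
  rest = sumFin (λ l → - - altSign l *
    (m zero (suc (suc l)) * det (suc k) (λ a b → m (suc a) (punchIn (suc (suc l)) b))))
  D₀≡D₁ : D₀ ≡ D₁
  D₀≡D₁ = det-cong (suc k) (λ a b → m (suc a) (suc b)) (λ a b → m (suc a) (punchIn (suc zero) b)) λ { a zero → sym (eq (suc a)) ; a (suc b) → refl }
  cancel : ∀ x → 1ℤ * x + (-1ℤ * x + 0ℤ) ≡ 0ℤ
  cancel = solve-∀
  rest≡0 : ∀ k → Alternating (suc k) → (m : Fin (suc (suc k)) → Fin (suc (suc k)) → ℤ) →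
    (∀ a → m a zero ≡ m a (suc zero)) →
    sumFin (λ l → - - altSign l *
      (m zero (suc (suc l)) * det (suc k) (λ a b → m (suc a) (punchIn (suc (suc l)) b)))) ≡ 0ℤ
  rest≡0 zero ih m eq = refl
  rest≡0 (suc k) ih m eq = sum-zero λ l → trans
    (cong (λ d → - - altSign l * (m zero (suc (suc l)) * d))
      (ih (λ a b → m (suc a) (punchIn (suc (suc l)) b)) zero (suc zero) (λ ()) (λ a → eq (suc a))))
    (zero-right (- - altSign l) (m zero (suc (suc l))))

-- With α the common column and β column 1, det(α,β,…,α) is one of the four terms in the
-- expansion of det(α,α+β,…,α+β) = 0; the other three have adjacent or later equal columns.
first-and-later-column : ∀ {k} → Alternating (suc k) →
  (m : Fin (suc (suc k)) → Fin (suc (suc k)) → ℤ) (j : Fin k) →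
  (∀ a → m a zero ≡ m a (suc (suc j))) → det (suc (suc k)) m ≡ 0ℤ
first-and-later-column {k} ih m j eq = begin
  det (suc (suc k)) m  ≡⟨ det-cong (suc (suc k)) m (N β α) m≡Nβα ⟩
  Δ (N β α)        ≡⟨ ℤP.+-identityˡ (Δ (N β α)) ⟨
  0ℤ + Δ (N β α)   ≡⟨ ℤP.+-identityʳ (0ℤ + Δ (N β α)) ⟨
  0ℤ + Δ (N β α) + 0ℤ
    ≡⟨ cong₂ (λ x y → x + Δ (N β α) + y) (sym (first-two-columns ih (N α γ) λ _ → refl)) (sym (later β)) ⟩
  Δ (N α γ) + Δ (N β α) + Δ (N β β) ≡⟨ ℤP.+-assoc (Δ (N α γ)) (Δ (N β α)) (Δ (N β β)) ⟩
  Δ (N α γ) + (Δ (N β α) + Δ (N β β)) ≡⟨ cong (λ t → Δ (N α γ) + t) split-j ⟨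
  Δ (N α γ) + Δ (N β γ) ≡⟨ split-1 ⟨
  Δ (N γ γ) ≡⟨ later γ ⟩
  0ℤ ∎
  where
  open ≡-Reasoning
  Δ = det (suc (suc k))
  Column = Fin (suc (suc k)) → ℤ
  α β γ : Column
  α a = m a zero
  β a = m a (suc zero)
  γ a = α a + β a
  N : Column → Column → Fin (suc (suc k)) → Fin (suc (suc k)) → ℤ
  N u v a zero = α a
  N u v a (suc zero) = u a
  N u v a (suc (suc c)) with c ≟ j
  ... | yes _ = v a
  ... | no  _ = m a (suc (suc c))
  N-j : ∀ u v a → N u v a (suc (suc j)) ≡ v a
  N-j u v a with j ≟ j
  ... | yes _ = refl
  ... | no j≢j = contradiction refl j≢j
  N-other : ∀ u v v′ a c → c ≢ j → N u v a (suc (suc c)) ≡ N u v′ a (suc (suc c))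
  N-other u v v′ a c c≢j with c ≟ j
  ... | yes c≡j = contradiction c≡j c≢j
  ... | no  _ = refl
  N-same : ∀ u u′ v a c → N u v a (suc (suc c)) ≡ N u′ v a (suc (suc c))
  N-same u u′ v a c with c ≟ j
  ... | yes _ = refl
  ... | no  _ = refl
  m≡Nβα : ∀ a b → m a b ≡ N β α a b
  m≡Nβα a zero = refl
  m≡Nβα a (suc zero) = refl
  m≡Nβα a (suc (suc c)) with c ≟ j
  ... | yes refl = sym (eq a)
  ... | no  _ = refl
  later : ∀ u → Δ (N u u) ≡ 0ℤ
  later u = tail-columns ih (N u u) zero (suc j) (λ ()) (λ a → sym (N-j u u a))
  split-1 : Δ (N γ γ) ≡ Δ (N α γ) + Δ (N β γ)
  split-1 = det-add (suc (suc k)) (suc zero) (N γ γ) (N α γ) (N β γ) (λ _ → refl) (off α) (off β)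
    where
    off : ∀ u a b → b ≢ suc zero → N γ γ a b ≡ N u γ a b
    off u a zero _ = refl
    off u a (suc zero) b≢ = contradiction refl b≢
    off u a (suc (suc c)) _ = N-same γ u γ a c
  split-j : Δ (N β γ) ≡ Δ (N β α) + Δ (N β β)
  split-j = det-add (suc (suc k)) (suc (suc j)) (N β γ) (N β α) (N β β)
    (λ a → trans (N-j β γ a) (cong₂ _+_ (sym (N-j β α a)) (sym (N-j β β a)))) (off α) (off β)
    where
    off : ∀ v a b → b ≢ suc (suc j) → N β γ a b ≡ N β v a b
    off v a zero _ = refl
    off v a (suc zero) _ = refl
    off v a (suc (suc c)) b≢ = N-other β γ v a c λ { refl → b≢ refl }

det-alternating : ∀ k → Alternating k
det-alternating (suc k) m zero zero p≢q eq = contradiction refl p≢q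
det-alternating (suc k) m (suc p) (suc q) p≢q eq =
  tail-columns (det-alternating k) m p q (p≢q ∘ cong suc) eq
det-alternating (suc (suc k)) m zero (suc zero) p≢q eq =
  first-two-columns (det-alternating (suc k)) m eq
det-alternating (suc (suc k)) m zero (suc (suc j)) p≢q eq =
  first-and-later-column (det-alternating (suc k)) m j eq
det-alternating (suc (suc k)) m (suc zero) zero p≢q eq =
  first-two-columns (det-alternating (suc k)) m (sym ∘ eq)
det-alternating (suc (suc k)) m (suc (suc j)) zero p≢q eq =
  first-and-later-column (det-alternating (suc k)) m j (sym ∘ eq)

det-equal-rows : ∀ k (m : Fin k → Fin k → ℤ) p q → p ≢ q → (∀ b → m p b ≡ m q b) → det k m ≡ 0ℤ
det-equal-rows k m p q p≢q eq =
  trans (sym (det-transpose k m)) (det-alternating k (λ a b → m b a) p q p≢q eq)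

-- Cofactors; singular matrices and integral kernel vectors.

i*j≡0⇒j≡0 : ∀ i j → i ≢ 0ℤ → i * j ≡ 0ℤ → j ≡ 0ℤ
i*j≡0⇒j≡0 i j i≢0 eq with ℤP.i*j≡0⇒i≡0∨j≡0 i eq
... | inj₁ i≡0 = contradiction i≡0 i≢0
... | inj₂ j≡0 = j≡0

cofactor-row : ∀ {k} → (Fin k → Fin (suc k) → ℤ) → Fin (suc k) → ℤ
cofactor-row {k} m l = altSign l * det k (λ a b → m a (punchIn l b))

det-first-row : ∀ {k} (x : Fin (suc k) → ℤ) (m : Fin k → Fin (suc k) → ℤ) →
  sumFin (λ l → x l * cofactor-row m l) ≡ det (suc k) (x ◂ m)
det-first-row {k} x m = sum-cong λ l → *-exchange (x l) (altSign l) (det k (λ a b → m a (punchIn l b)))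

cofactor-column : ∀ {k} → (Fin (suc k) → Fin k → ℤ) → Fin (suc k) → ℤ
cofactor-column {k} m i = altSign i * det k (λ a b → m (punchIn i a) b)

det-first-column : ∀ {k} (x : Fin (suc k) → ℤ) (m : Fin (suc k) → Fin k → ℤ) →
  sumFin (λ i → x i * cofactor-column m i) ≡ det (suc k) (λ a → x a ◂ m a)
det-first-column {k} x m = trans (sum-cong λ l → *-exchange (x l) (altSign l) (det k (λ a b → m (punchIn l a) b)))
  (sym (det-expand-column k (λ a → x a ◂ m a)))

◂-eta : ∀ {k} {A : Set} (x : Fin (suc k) → A) → ∀ i → (x zero ◂ (x ∘ suc)) i ≡ x i
◂-eta x zero = refl
◂-eta x (suc i) = refl

-- Cramer's rule without division: `v zero * det` is the sum over `b` of `v b` times the determinant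
-- with column zero replaced by column `b`, since alternation kills the terms with `b` nonzero.
-- Regrouped by rows, that sum is a cofactor combination of the entries of `m` applied to `v`, all
-- zero. If `v zero` is zero, the first column is dropped instead.
kernel⇒det≡0 : ∀ k (m : Fin k → Fin k → ℤ) (v : Fin k → ℤ) →
  (∀ a → sumFin (λ b → m a b * v b) ≡ 0ℤ) → ∀ j → v j ≢ 0ℤ → det k m ≡ 0ℤ
kernel⇒det≡0 (suc k) m v ker j vj≢0 with v zero ℤP.≟ 0ℤ
kernel⇒det≡0 (suc k) m v ker zero vj≢0 | yes v₀≡0 = contradiction v₀≡0 vj≢0
kernel⇒det≡0 (suc k) m v ker (suc j) vj≢0 | yes v₀≡0 =
  trans (det-expand-column k m) (sum-zero λ i → trans
    (cong (λ d → altSign i * (m i zero * d))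
      (kernel⇒det≡0 k (λ a b → m (punchIn i a) (suc b)) (v ∘ suc) (λ a → tail-kernel (punchIn i a)) j vj≢0))
    (zero-right (altSign i) (m i zero)))
  where
  drop : ∀ x y → x * 0ℤ + y ≡ y
  drop = solve-∀
  tail-kernel : ∀ a → sumFin (λ b → m a (suc b) * v (suc b)) ≡ 0ℤ
  tail-kernel a = let rest = sumFin (λ b → m a (suc b) * v (suc b)) in trans (sym (trans (cong (λ x → m a zero * x + rest) v₀≡0) (drop (m a zero) rest))) (ker a)
... | no v₀≢0 = i*j≡0⇒j≡0 (v zero) (det (suc k) m) v₀≢0 (begin
  v zero * det (suc k) m
    ≡⟨ ℤP.+-identityʳ _ ⟨
  v zero * det (suc k) m + 0ℤ
    ≡⟨ cong₂ _+_ (cong (v zero *_) (sym replaced-zero)) (sym other) ⟩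
  v zero * sumFin (λ i → m i zero * C i) + sumFin (λ b → v (suc b) * sumFin (λ i → m i (suc b) * C i))
    ≡⟨ sum-cong (λ b → sum-*ˡ (v b) (λ i → m i b * C i)) ⟩
  sumFin (λ b → sumFin (λ i → v b * (m i b * C i)))
    ≡⟨ sum-swap (λ b i → v b * (m i b * C i)) ⟩
  sumFin (λ i → sumFin (λ b → v b * (m i b * C i)))
    ≡⟨ sum-cong (λ i → trans (sum-cong λ b → rearrange (v b) (m i b) (C i)) (sym (sum-*ˡ (C i) (λ b → m i b * v b)))) ⟩
  sumFin (λ i → C i * sumFin (λ b → m i b * v b))
    ≡⟨ sum-zero (λ i → trans (cong (C i *_) (ker i)) (ℤP.*-zeroʳ (C i))) ⟩
  0ℤ ∎)
  where
  open ≡-Reasoning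
  C : Fin (suc k) → ℤ
  C = cofactor-column (λ a b → m a (suc b))
  rearrange : ∀ a b c → a * (b * c) ≡ c * (b * a)
  rearrange = solve-∀
  replaced : ∀ c → sumFin (λ i → m i c * C i) ≡ det (suc k) (λ a → m a c ◂ (m a ∘ suc))
  replaced zero = det-first-column (λ a → m a zero) (λ a b → m a (suc b))
  replaced (suc c) = det-first-column (λ a → m a (suc c)) (λ a b → m a (suc b))
  replaced-zero : sumFin (λ i → m i zero * C i) ≡ det (suc k) m
  replaced-zero = trans (replaced zero) (det-cong (suc k) (λ a → m a zero ◂ (m a ∘ suc)) m λ a → ◂-eta (m a))
  other : sumFin (λ b → v (suc b) * sumFin (λ i → m i (suc b) * C i)) ≡ 0ℤ
  other = sum-zero λ b → trans
    (cong (v (suc b) *_) (trans (replaced (suc b))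
      (det-alternating (suc k) (λ a → m a (suc b) ◂ (m a ∘ suc)) zero (suc b) (λ ()) λ _ → refl)))
    (ℤP.*-zeroʳ (v (suc b)))

altSign-unit : ∀ {k} (j : Fin k) → altSign j ≡ 1ℤ ⊎ altSign j ≡ -1ℤ
altSign-unit zero = inj₁ refl
altSign-unit (suc j) with altSign j | altSign-unit j
... | _ | inj₁ refl = inj₂ refl
... | _ | inj₂ refl = inj₁ refl

altSign-cancel : ∀ {k} (j : Fin k) x → altSign j * x ≡ 0ℤ → x ≡ 0ℤ
altSign-cancel j x = i*j≡0⇒j≡0 (altSign j) x λ eq → [ (λ e → 1≢0 (trans (sym e) eq)) , (λ e → -1≢0 (trans (sym e) eq)) ]′ (altSign-unit j)
  where
  -1≢0 : -1ℤ ≢ 0ℤ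
  -1≢0 ()

HasKernel : ∀ {k l} → (Fin k → Fin l → ℤ) → Set
HasKernel {k} {l} m = Σ[ v ∈ (Fin l → ℤ) ] (∀ a → sumFin (λ b → m a b * v b) ≡ 0ℤ) × ∃[ j ] v j ≢ 0ℤ

insertZero : ∀ {k} → Fin (suc k) → (Fin k → ℤ) → Fin (suc k) → ℤ
insertZero zero v = 0ℤ ◂ v
insertZero {suc k} (suc l) v = v zero ◂ insertZero l (v ∘ suc)

insertZero-at : ∀ {k} l (v : Fin k → ℤ) → insertZero l v l ≡ 0ℤ
insertZero-at zero v = refl
insertZero-at {suc k} (suc l) v = insertZero-at l (v ∘ suc)

insertZero-punchIn : ∀ {k} l (v : Fin k → ℤ) b → insertZero l v (punchIn l b) ≡ v b
insertZero-punchIn zero v b = refl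
insertZero-punchIn (suc l) v zero = refl
insertZero-punchIn (suc l) v (suc b) = insertZero-punchIn l (v ∘ suc) b

sum-insertZero : ∀ {k} l (x : Fin (suc k) → ℤ) (v : Fin k → ℤ) →
  sumFin (λ b → x b * insertZero l v b) ≡ sumFin (λ b → x (punchIn l b) * v b)
sum-insertZero zero x v = trans (cong (_+ sumFin (λ b → x (suc b) * v b)) (ℤP.*-zeroʳ (x zero)))
  (ℤP.+-identityˡ (sumFin (λ b → x (suc b) * v b)))
sum-insertZero {suc k} (suc l) x v = cong (λ t → x zero * v zero + t) (sum-insertZero l (x ∘ suc) (v ∘ suc))

-- If some first-row cofactor is nonzero, these cofactors form a kernel vector. If all vanish, each
-- minor of the lower rows is singular and supplies a vector that kills those rows and has a
-- prescribed zero coordinate; two such vectors combine to kill the first row as well.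
det≡0⇒kernel : ∀ k (m : Fin k → Fin k → ℤ) → det k m ≡ 0ℤ → HasKernel m
det≡0⇒kernel (suc k) m det≡0 with any? (λ l → ¬? (cofactor-row (m ∘ suc) l ℤP.≟ 0ℤ))
... | yes (l , cof≢0) = cofactor-row (m ∘ suc) , ker , l , cof≢0
  where
  ker : ∀ a → sumFin (λ b → m a b * cofactor-row (m ∘ suc) b) ≡ 0ℤ
  ker zero = trans (det-first-row (m zero) (m ∘ suc))
    (trans (det-cong (suc k) (m zero ◂ (m ∘ suc)) m λ { zero b → refl ; (suc a) b → refl }) det≡0)
  ker (suc a) = trans (det-first-row (m (suc a)) (m ∘ suc))
    (det-equal-rows (suc k) (m (suc a) ◂ (m ∘ suc)) zero (suc a) (λ ()) λ _ → refl)
... | no none = combine (minor-kernel zero)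
  where
  rows : Fin k → Fin (suc k) → ℤ
  rows = m ∘ suc
  minor-kernel : ∀ l → Σ[ v ∈ (Fin (suc k) → ℤ) ] (∀ a → sumFin (λ b → rows a b * v b) ≡ 0ℤ) × v l ≡ 0ℤ × ∃[ j ] v j ≢ 0ℤ
  minor-kernel l with cofactor-row rows l ℤP.≟ 0ℤ
  ... | no cof≢0 = contradiction (l , cof≢0) none
  ... | yes cof≡0 with det≡0⇒kernel k (λ a b → rows a (punchIn l b)) (altSign-cancel l (det k (λ a b → rows a (punchIn l b))) cof≡0)
  ...   | v , ker , j , vj≢0 = insertZero l v
    , (λ a → trans (sum-insertZero l (rows a) v) (ker a))
    , insertZero-at l v
    , punchIn l j , vj≢0 ∘ trans (sym (insertZero-punchIn l v j))
  dot : (Fin (suc k) → ℤ) → Fin (suc k) → ℤ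
  dot v a = sumFin (λ b → m a b * v b)
  linear : ∀ p q (u v : Fin (suc k) → ℤ) a →
    dot (λ b → p * u b + q * v b) a ≡ p * dot u a + q * dot v a
  linear p q u v a = trans
    (sum-cong λ b → expand (m a b) p q (u b) (v b))
    (trans (sum-+ (λ b → p * (m a b * u b)) (λ b → q * (m a b * v b)))
           (sym (cong₂ _+_ (sum-*ˡ p (λ b → m a b * u b)) (sum-*ˡ q (λ b → m a b * v b)))))
    where
    expand : ∀ x p q y z → x * (p * y + q * z) ≡ p * (x * y) + q * (x * z)
    expand = solve-∀
  combine : (Σ[ v ∈ (Fin (suc k) → ℤ) ] (∀ a → sumFin (λ b → rows a b * v b) ≡ 0ℤ) × v zero ≡ 0ℤ × ∃[ j ] v j ≢ 0ℤ) →
    HasKernel m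
  -- The second vector is taken to vanish at a coordinate `j` where `u` does not, so the combination
  -- stays nonzero at `j`.
  combine (u , ker-u , _ , j , uj≢0) with minor-kernel j
  ... | v , ker-v , vj≡0 , i , vi≢0 with dot v zero ℤP.≟ 0ℤ
  ... | yes v₀≡0 = v , (λ { zero → v₀≡0 ; (suc a) → ker-v a }) , i , vi≢0
  ... | no v₀≢0 = (λ b → dot v zero * u b + - dot u zero * v b)
    , (λ { zero → trans (linear (dot v zero) (- dot u zero) u v zero) (cancel (dot v zero) (dot u zero))
         ; (suc a) → trans (linear (dot v zero) (- dot u zero) u v (suc a))
             (trans (cong₂ (λ x y → dot v zero * x + - dot u zero * y) (ker-u a) (ker-v a))
                    (zeros (dot v zero) (dot u zero))) })
    , j , λ eq → uj≢0 (i*j≡0⇒j≡0 (dot v zero) (u j) v₀≢0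
        (trans (trans (drop (dot v zero * u j) (dot u zero))
          (cong (λ x → dot v zero * u j + - dot u zero * x) (sym vj≡0))) eq))
    where
    cancel : ∀ x y → x * y + - y * x ≡ 0ℤ
    cancel = solve-∀
    zeros : ∀ x y → x * 0ℤ + - y * 0ℤ ≡ 0ℤ
    zeros = solve-∀
    drop : ∀ x y → x ≡ x + - y * 0ℤ
    drop = solve-∀

sum-nonneg : ∀ {k} (g : Fin k → ℤ) → (∀ i → 0ℤ ≤ g i) → 0ℤ ≤ sumFin g
sum-nonneg {zero} g pos = ℤP.≤-refl
sum-nonneg {suc k} g pos = ℤP.+-mono-≤ (pos zero) (sum-nonneg (g ∘ suc) (pos ∘ suc))

nonneg-sum≡0 : ∀ x y → 0ℤ ≤ x → 0ℤ ≤ y → x + y ≡ 0ℤ → x ≡ 0ℤ × y ≡ 0ℤ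
nonneg-sum≡0 (+ zero) y _ _ eq = refl , trans (sym (ℤP.+-identityˡ y)) eq
nonneg-sum≡0 +[1+ _ ] (+ _) _ _ ()

sum≡0⇒all≡0 : ∀ {k} (g : Fin k → ℤ) → (∀ i → 0ℤ ≤ g i) → sumFin g ≡ 0ℤ → ∀ i → g i ≡ 0ℤ
sum≡0⇒all≡0 {suc k} g pos eq i
  with nonneg-sum≡0 (g zero) (sumFin (g ∘ suc)) (pos zero) (sum-nonneg (g ∘ suc) (pos ∘ suc)) eq
sum≡0⇒all≡0 {suc k} g pos eq zero | g₀≡0 , _ = g₀≡0
sum≡0⇒all≡0 {suc k} g pos eq (suc i) | _ , rest≡0 = sum≡0⇒all≡0 (g ∘ suc) (pos ∘ suc) rest≡0 i

-- Sign sets and orthogonal pairs of vector groups.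

Vect : ℕ → Set
Vect n = Fin n → ℤ

IsTrit : ℤ → Set
IsTrit z = z ≡ -1ℤ ⊎ z ≡ 0ℤ ⊎ z ≡ 1ℤ

Simple : ∀ {n} → Vect n → Set
Simple v = ∀ x → IsTrit (v x)

trit-neg : ∀ {z} → IsTrit z → IsTrit (- z)
trit-neg (inj₁ refl) = inj₂ (inj₂ refl)
trit-neg (inj₂ (inj₁ refl)) = inj₂ (inj₁ refl)
trit-neg (inj₂ (inj₂ refl)) = inj₁ refl

sgn : Sign → ℤ
sgn plus = 1ℤ
sgn minus = -1ℤ

infix 4 _∈ᵇ_ _∈ˢ_ _∈ˢ?_
-- Zero lies in every sign set, so `v x ∈ˢ F x` for all `x` says that the chain `v` is compatible
-- with the fourientation `F`.
_∈ᵇ_ : ℤ → (Sign → Bool) → Bool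
+ zero ∈ᵇ F = true
+[1+ _ ] ∈ᵇ F = F plus
-[1+ _ ] ∈ᵇ F = F minus

_∈ˢ_ : ℤ → (Sign → Bool) → Set
z ∈ˢ F = T (z ∈ᵇ F)

_∈ˢ?_ : ∀ z F → Dec (z ∈ˢ F)
z ∈ˢ? F = 𝔹.T? (z ∈ᵇ F)

∈ˢ-mono : ∀ z {F G : Sign → Bool} → (∀ s → T (F s) → T (G s)) → z ∈ˢ F → z ∈ˢ G
∈ˢ-mono (+ zero) le _ = tt
∈ˢ-mono +[1+ _ ] le = le plus
∈ˢ-mono -[1+ _ ] le = le minus

signsOf : ℤ → Sign → Bool
signsOf (+ zero) _ = false
signsOf +[1+ _ ] plus = true
signsOf +[1+ _ ] minus = false
signsOf -[1+ _ ] plus = false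
signsOf -[1+ _ ] minus = true

∈-signsOf : ∀ z → z ∈ˢ signsOf z
∈-signsOf (+ zero) = tt
∈-signsOf +[1+ _ ] = tt
∈-signsOf -[1+ _ ] = tt

∈-signsOf-trans : ∀ a b {F} → a ∈ˢ signsOf b → b ∈ˢ F → a ∈ˢ F
∈-signsOf-trans (+ zero) b _ _ = tt
∈-signsOf-trans +[1+ _ ] +[1+ _ ] _ q = q
∈-signsOf-trans +[1+ _ ] (+ zero) ()
∈-signsOf-trans +[1+ _ ] -[1+ _ ] ()
∈-signsOf-trans -[1+ _ ] -[1+ _ ] _ q = q
∈-signsOf-trans -[1+ _ ] (+ zero) ()
∈-signsOf-trans -[1+ _ ] +[1+ _ ] ()

∈-signsOf-zero : ∀ a {b} → a ∈ˢ signsOf b → b ≡ 0ℤ → a ≡ 0ℤ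
∈-signsOf-zero (+ zero) _ refl = refl

-- The colouring complementary to F in the painting lemma: elements allowed both signs and
-- elements allowed none are exchanged, the others keep their sign.
dual : (Sign → Bool) → Sign → Bool
dual F s = not (F (flipS s))

T-not-contra : ∀ {b} → T b → T (not b) → ⊥
T-not-contra {true} _ ()

-- Opposite signs are impossible: `dual F` contains a sign only if `F` lacks the opposite one.
dual-product : ∀ a b {F} → a ∈ˢ F → b ∈ˢ dual F → 0ℤ ≤ a * b
dual-product (+ zero) b _ _ = ℤP.≤-refl
dual-product +[1+ m ] (+ zero) _ _ = ℤP.≤-reflexive (sym (ℤP.*-zeroʳ +[1+ m ]))
dual-product -[1+ m ] (+ zero) _ _ = ℤP.≤-reflexive (sym (ℤP.*-zeroʳ -[1+ m ]))
dual-product +[1+ _ ] +[1+ _ ] _ _ = +≤+ z≤n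
dual-product -[1+ _ ] -[1+ _ ] _ _ = +≤+ z≤n
dual-product +[1+ _ ] -[1+ _ ] p q = contradiction q (T-not-contra p)
dual-product -[1+ _ ] +[1+ _ ] p q = contradiction q (T-not-contra p)

T-not : ∀ {b} → ¬ T b → T (not b)
T-not {false} _ = tt
T-not {true} ¬t = ¬t tt

-- Opposite signs are impossible here too: if `b` is not in `dual F`, the sign opposite to `b` lies
-- in `F`, so it is not the sign of `a`.
non-dual-product : ∀ a b {F} → ¬ a ∈ˢ F → ¬ b ∈ˢ dual F → 0ℤ ≤ a * b
non-dual-product (+ zero) b ¬p _ = contradiction tt ¬p
non-dual-product +[1+ m ] (+ zero) _ ¬q = contradiction tt ¬q
non-dual-product -[1+ m ] (+ zero) _ ¬q = contradiction tt ¬q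
non-dual-product +[1+ _ ] +[1+ _ ] _ _ = +≤+ z≤n
non-dual-product -[1+ _ ] -[1+ _ ] _ _ = +≤+ z≤n
non-dual-product +[1+ _ ] -[1+ _ ] ¬p ¬q = contradiction (T-not ¬p) ¬q
non-dual-product -[1+ _ ] +[1+ _ ] ¬p ¬q = contradiction (T-not ¬p) ¬q

Solution : ∀ {n} → (Vect n → Set) → Fin n → (Fin n → Set) → Set
Solution {n} U g Z = Σ[ v ∈ Vect n ] U v × Simple v × v g ≡ 1ℤ × (∀ x → x ≢ g → Z x → v x ≡ 0ℤ)

-- V and W play the roles of the integral kernel and row space of a totally unimodular matrix;
-- "colour" is Minty's lemma for colourings in which every element allows both signs or none.
record RegularPair {n} (V W : Vect n → Set) : Set where
  field
    V-0   : V (λ _ → 0ℤ)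
    V-ext : ∀ {u v} → (∀ x → u x ≡ v x) → V u → V v
    V-+   : ∀ {u v} → V u → V v → V (λ x → u x + v x)
    V-neg : ∀ {v} → V v → V (λ x → - v x)
    W-0   : W (λ _ → 0ℤ)
    W-ext : ∀ {u v} → (∀ x → u x ≡ v x) → W u → W v
    W-+   : ∀ {u v} → W u → W v → W (λ x → u x + v x)
    W-neg : ∀ {v} → W v → W (λ x → - v x)
    orth  : ∀ {v w} → V v → W w → sumFin (λ x → v x * w x) ≡ 0ℤ
    colour : ∀ (S : Fin n → Bool) g →
      Solution V g (λ x → T (not (S x))) ⊎
      Solution W g (λ x → T (S x))

swap : ∀ {n} {V W : Vect n → Set} → RegularPair V W → RegularPair W V
swap R = record
  { V-0 = W-0 ; V-ext = W-ext ; V-+ = W-+ ; V-neg = W-neg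
  ; W-0 = V-0 ; W-ext = V-ext ; W-+ = V-+ ; W-neg = V-neg
  ; orth = λ {v} {w} Wv Vw → trans (sum-cong λ x → ℤP.*-comm (v x) (w x)) (orth Vw Wv)
  ; colour = λ S g → Sum.swap (Sum.map
      (λ (v , p , q , r , z) → v , p , q , r , λ x x≢g t → z x x≢g (subst T (sym (𝔹.not-involutive (S x))) t))
      (λ (v , p , q , r , z) → v , p , q , r , z)
      (colour (not ∘ S) g))
  }
  where open RegularPair R

-- Painting with arbitrary sign sets; elementary vectors.

recolour : ∀ {n} → (Fin n → Sign → Bool) → Fin n → Bool → Fin n → Sign → Bool
recolour F y b x with x ≟ y
... | yes _ = λ _ → b
... | no  _ = F x

recolour-same : ∀ {n} (F : Fin n → Sign → Bool) y b s → recolour F y b y s ≡ b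
recolour-same F y b s with y ≟ y
... | yes _ = refl
... | no y≢y = contradiction refl y≢y

recolour-other : ∀ {n} (F : Fin n → Sign → Bool) y b x → x ≢ y → recolour F y b x ≡ F x
recolour-other F y b x x≢y with x ≟ y
... | yes x≡y = contradiction x≡y x≢y
... | no _ = refl

sgn-square : ∀ s → sgn s * sgn s ≡ 1ℤ
sgn-square plus = refl
sgn-square minus = refl

-- Signed circuits for `V`, signed cocircuits for `W`. Containment of supports is phrased by
-- vanishing, and `minimal` ranges over all vectors of `U`, not only the simple ones.
record Elementary {n} (U : Vect n → Set) (c : Vect n) : Set where
  field
    member  : U c
    simple  : Simple c
    nonzero : ∃[ x ] c x ≢ 0ℤ
    minimal : ∀ {v} → U v → (∃[ x ] v x ≢ 0ℤ) → (∀ x → c x ≡ 0ℤ → v x ≡ 0ℤ) →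
              ∀ x → v x ≡ 0ℤ → c x ≡ 0ℤ

Conformal : ∀ {n} → Vect n → Vect n → Set
Conformal c z = ∀ x → c x ∈ˢ signsOf (z x)

Conformal-trans : ∀ {n} {a b c : Vect n} → Conformal a b → Conformal b c → Conformal a c
Conformal-trans {a = a} {b} p q x = ∈-signsOf-trans (a x) (b x) (p x) (q x)

bit : ℤ → ℕ
bit (+ zero) = 0
bit +[1+ _ ] = 1
bit -[1+ _ ] = 1

size : ∀ {n} → Vect n → ℕ
size {zero} v = 0
size {suc n} v = bit (v zero) ℕ.+ size (v ∘ suc)

bit-mono : ∀ a b → (b ≡ 0ℤ → a ≡ 0ℤ) → bit a ℕ.≤ bit b
bit-mono (+ zero) b sub = z≤n
bit-mono +[1+ _ ] (+ zero) sub with () ← sub refl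
bit-mono +[1+ _ ] +[1+ _ ] sub = s≤s z≤n
bit-mono +[1+ _ ] -[1+ _ ] sub = s≤s z≤n
bit-mono -[1+ _ ] (+ zero) sub with () ← sub refl
bit-mono -[1+ _ ] +[1+ _ ] sub = s≤s z≤n
bit-mono -[1+ _ ] -[1+ _ ] sub = s≤s z≤n

bit-strict : ∀ a b → a ≡ 0ℤ → b ≢ 0ℤ → bit a ℕ.< bit b
bit-strict _ (+ zero) refl b≢0 = contradiction refl b≢0
bit-strict _ +[1+ _ ] refl b≢0 = s≤s z≤n
bit-strict _ -[1+ _ ] refl b≢0 = s≤s z≤n

size-mono : ∀ {n} (u v : Vect n) → (∀ x → v x ≡ 0ℤ → u x ≡ 0ℤ) → size u ℕ.≤ size v
size-mono {zero} u v sub = z≤n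
size-mono {suc n} u v sub =
  ℕP.+-mono-≤ (bit-mono (u zero) (v zero) (sub zero)) (size-mono (u ∘ suc) (v ∘ suc) (sub ∘ suc))

size-strict : ∀ {n} (u v : Vect n) → (∀ x → v x ≡ 0ℤ → u x ≡ 0ℤ) →
  ∀ h → u h ≡ 0ℤ → v h ≢ 0ℤ → size u ℕ.< size v
size-strict u v sub zero uh vh =
  ℕP.+-mono-<-≤ (bit-strict (u zero) (v zero) uh vh) (size-mono (u ∘ suc) (v ∘ suc) (sub ∘ suc))
size-strict u v sub (suc h) uh vh =
  ℕP.+-mono-≤-< (bit-mono (u zero) (v zero) (sub zero)) (size-strict (u ∘ suc) (v ∘ suc) (sub ∘ suc) h uh vh)

sum-single : ∀ {k} (g : Fin k → ℤ) i → (∀ x → x ≢ i → g x ≡ 0ℤ) → sumFin g ≡ g i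
sum-single g zero zeros =
  trans (cong (λ a → g zero + a) (sum-zero λ x → zeros (suc x) λ ())) (ℤP.+-identityʳ (g zero))
sum-single g (suc i) zeros = trans
  (cong₂ _+_ (zeros zero λ ()) (sum-single (g ∘ suc) i λ x x≢i → zeros (suc x) λ { refl → x≢i refl }))
  (ℤP.+-identityˡ (g (suc i)))

search : ∀ {n} {A B : Fin n → Set} → (∀ i → A i ⊎ B i) → ∃ A ⊎ (∀ i → B i)
search {zero} f = inj₂ λ ()
search {suc n} f with f zero | search (f ∘ suc)
... | inj₁ a | _ = inj₁ (zero , a)
... | inj₂ _ | inj₁ (i , a) = inj₁ (suc i , a)
... | inj₂ b | inj₂ bs = inj₂ λ { zero → b ; (suc i) → bs i }

search₂ : ∀ {m n} {A B : Fin m → Fin n → Set} → (∀ i j → A i j ⊎ B i j) →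
  (∃[ i ] ∃[ j ] A i j) ⊎ (∀ i j → B i j)
search₂ f = search λ i → search (f i)

pick-sign : ∀ z → z ≢ 0ℤ → ∃[ s ] T (signsOf z s)
pick-sign (+ zero) z≢0 = contradiction refl z≢0
pick-sign +[1+ _ ] _ = plus , tt
pick-sign -[1+ _ ] _ = minus , tt

sgn-∈ : ∀ s {F} → T (F s) → sgn s ∈ˢ F
sgn-∈ plus t = t
sgn-∈ minus t = t

sgn≢0 : ∀ s → sgn s ≢ 0ℤ
sgn≢0 plus ()
sgn≢0 minus ()

sign-product : ∀ z s → T (signsOf z s) → 0ℤ < z * sgn s
sign-product +[1+ m ] plus _ = subst (0ℤ <_) (sym (ℤP.*-identityʳ +[1+ m ])) (+<+ (s≤s z≤n))
sign-product -[1+ m ] minus _ = +<+ (s≤s z≤n)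

trit-same-or-opposite : ∀ {a b} → IsTrit a → IsTrit b → a ≢ 0ℤ → b ≢ 0ℤ → a ≡ b ⊎ - a ≡ b
trit-same-or-opposite (inj₁ refl) (inj₁ refl) _ _ = inj₁ refl
trit-same-or-opposite (inj₁ refl) (inj₂ (inj₂ refl)) _ _ = inj₂ refl
trit-same-or-opposite (inj₂ (inj₂ refl)) (inj₁ refl) _ _ = inj₂ refl
trit-same-or-opposite (inj₂ (inj₂ refl)) (inj₂ (inj₂ refl)) _ _ = inj₁ refl
trit-same-or-opposite (inj₂ (inj₁ refl)) _ a≢0 _ = contradiction refl a≢0
trit-same-or-opposite _ (inj₂ (inj₁ refl)) _ b≢0 = contradiction refl b≢0

trit-sub : ∀ {c v} → IsTrit c → IsTrit v → (c ≡ 0ℤ → v ≡ 0ℤ) → c + - v ∈ˢ signsOf c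
trit-sub (inj₂ (inj₁ refl)) _ sub with refl ← sub refl = tt
trit-sub (inj₁ refl) (inj₁ refl) _ = tt
trit-sub (inj₁ refl) (inj₂ (inj₁ refl)) _ = tt
trit-sub (inj₁ refl) (inj₂ (inj₂ refl)) _ = tt
trit-sub (inj₂ (inj₂ refl)) (inj₁ refl) _ = tt
trit-sub (inj₂ (inj₂ refl)) (inj₂ (inj₁ refl)) _ = tt
trit-sub (inj₂ (inj₂ refl)) (inj₂ (inj₂ refl)) _ = tt

trit-conformal : ∀ {c v} → IsTrit c → IsTrit v → (c ≡ 0ℤ → v ≡ 0ℤ) → ¬ (v ≢ 0ℤ × v ≡ - c) →
  v ∈ˢ signsOf c
trit-conformal (inj₂ (inj₁ refl)) _ sub _ with refl ← sub refl = tt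
trit-conformal (inj₁ refl) (inj₁ refl) _ _ = tt
trit-conformal (inj₁ refl) (inj₂ (inj₁ refl)) _ _ = tt
trit-conformal (inj₁ refl) (inj₂ (inj₂ refl)) _ ¬opp = contradiction ((λ ()) , refl) ¬opp
trit-conformal (inj₂ (inj₂ refl)) (inj₁ refl) _ ¬opp = contradiction ((λ ()) , refl) ¬opp
trit-conformal (inj₂ (inj₂ refl)) (inj₂ (inj₁ refl)) _ _ = tt
trit-conformal (inj₂ (inj₂ refl)) (inj₂ (inj₂ refl)) _ _ = tt

double≢0 : ∀ {z} → z ≢ 0ℤ → z + z ≢ 0ℤ
double≢0 {+ zero} z≢0 _ = z≢0 refl
double≢0 {+[1+ _ ]} _ ()
double≢0 { -[1+ _ ]} _ ()

module _ {n} {V W : Vect n → Set} (R : RegularPair V W) where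
  open RegularPair R

  nonneg-orth : ∀ {v w} → V v → W w → (∀ x → 0ℤ ≤ v x * w x) → ∀ x → v x * w x ≡ 0ℤ
  nonneg-orth {v} {w} Vv Ww pos = sum≡0⇒all≡0 (λ x → v x * w x) pos (orth Vv Ww)

  Painted : (Vect n → Set) → (Fin n → Sign → Bool) → Fin n → Sign → Set
  Painted U F g s = Σ[ u ∈ Vect n ] U u × Simple u × u g ≡ sgn s × (∀ x → x ≢ g → u x ∈ˢ F x)

  private
    Painting : (Fin n → Sign → Bool) → Fin n → Sign → Set
    Painting F g s = Painted V F g s ⊎ Painted W (dual ∘ F) g s

    weaken : ∀ {U F G g s} → (∀ x → x ≢ g → ∀ s → T (F x s) → T (G x s)) →
      Painted U F g s → Painted U G g s
    weaken le (u , Uu , simple , ug , ok) =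
      u , Uu , simple , ug , λ x x≢g → ∈ˢ-mono (u x) (le x x≢g) (ok x x≢g)

    signed : ∀ {U : Vect n → Set} → (∀ {u} → U u → U (λ x → - u x)) → ∀ g s {Z : Fin n → Set} →
      Solution U g Z →
      (Σ[ u ∈ Vect n ] U u × Simple u × u g ≡ sgn s × (∀ x → x ≢ g → Z x → u x ≡ 0ℤ))
    signed neg g plus c = c
    signed neg g minus (u , Uu , simple , ug , z) =
      (λ x → - u x) , neg Uu , (λ x → trit-neg (simple x)) , cong -_ ug , λ x x≢g Zx → cong -_ (z x x≢g Zx)

    balanced : ∀ F g s → (∀ x → F x plus ≡ F x minus) → Painting F g s
    balanced F g s bal = Sum.map
      (λ (u , Uu , simple , ug , z) → u , Uu , simple , ug , λ x x≢g → fits (F x) (bal x) (u x) (z x x≢g))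
      (λ (u , Uu , simple , ug , z) → u , Uu , simple , ug , λ x x≢g → dual-fits (F x) (bal x) (u x) (z x x≢g))
      (Sum.map (signed V-neg g s) (signed W-neg g s) (colour (λ x → F x plus) g))
      where
      fits : ∀ G → G plus ≡ G minus → ∀ z → (T (not (G plus)) → z ≡ 0ℤ) → z ∈ˢ G
      fits G eq (+ zero) _ = tt
      fits G eq +[1+ _ ] van with 𝔹.T? (G plus)
      ... | yes t = t
      ... | no ¬t with () ← van (T-not ¬t)
      fits G eq -[1+ _ ] van with 𝔹.T? (G plus)
      ... | yes t = subst T eq t
      ... | no ¬t with () ← van (T-not ¬t)
      dual-fits : ∀ G → G plus ≡ G minus → ∀ z → (T (G plus) → z ≡ 0ℤ) → z ∈ˢ dual G
      dual-fits G eq (+ zero) _ = tt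
      dual-fits G eq +[1+ _ ] van with 𝔹.T? (G plus)
      ... | no ¬t = subst (T ∘ not) eq (T-not ¬t)
      ... | yes t with () ← van t
      dual-fits G eq -[1+ _ ] van with 𝔹.T? (G plus)
      ... | no ¬t = T-not ¬t
      ... | yes t with () ← van t

    product-at : ∀ {a b} s → a ≡ sgn s → b ≡ sgn s → a * b ≡ 1ℤ
    product-at s refl refl = sgn-square s


    uncoloured : ∀ F y g s → Painting (recolour F y false) g s → Painting (recolour F y true) g s →
      Painting F g s
    uncoloured F y g s (inj₁ p) _ = inj₁ (weaken (λ x _ → le x) p)
      where
      le : ∀ x t → T (recolour F y false x t) → T (F x t)
      le x t with x ≟ y
      ... | yes _ = λ ()
      ... | no _ = id
    uncoloured F y g s (inj₂ _) (inj₂ p) = inj₂ (weaken (λ x _ → le x) p)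
      where
      le : ∀ x t → T (dual (recolour F y true x) t) → T (dual (F x) t)
      le x t with x ≟ y
      ... | yes _ = λ ()
      ... | no _ = id
    uncoloured F y g s (inj₂ (w , Ww , sw , wg , okw)) (inj₁ (v , Vv , sv , vg , okv))
      with y ≟ g | v y ∈ˢ? F y | w y ∈ˢ? dual (F y)
    ... | yes refl | _ | _ = inj₁ (v , Vv , sv , vg ,
            λ x x≢y → subst (v x ∈ˢ_) (recolour-other F y true x x≢y) (okv x x≢y))
    ... | no _ | yes v∈ | _ = inj₁ (v , Vv , sv , vg , fits)
      where
      fits : ∀ x → x ≢ g → v x ∈ˢ F x
      fits x x≢g with x ≟ y
      ... | yes refl = v∈
      ... | no x≢y = subst (v x ∈ˢ_) (recolour-other F y true x x≢y) (okv x x≢g)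
    ... | no _ | no _ | yes w∈ = inj₂ (w , Ww , sw , wg , fits)
      where
      fits : ∀ x → x ≢ g → w x ∈ˢ dual (F x)
      fits x x≢g with x ≟ y
      ... | yes refl = w∈
      ... | no x≢y = subst (λ G → w x ∈ˢ dual G) (recolour-other F y false x x≢y) (okw x x≢g)
    ... | no _ | no v∉ | no w∉ =
      contradiction (trans (sym (product-at s vg wg)) (nonneg-orth Vv Ww pos g)) 1≢0
      where
      pos : ∀ x → 0ℤ ≤ v x * w x
      pos x with x ≟ g | x ≟ y
      ... | yes refl | _ = subst (0ℤ ≤_) (sym (product-at s vg wg)) (+≤+ z≤n)
      ... | no _ | yes refl = non-dual-product (v x) (w x) v∉ w∉
      ... | no x≢g | no x≢y = dual-product (v x) (w x)
        (subst (v x ∈ˢ_) (recolour-other F y true x x≢y) (okv x x≢g))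
        (subst (λ G → w x ∈ˢ dual G) (recolour-other F y false x x≢y) (okw x x≢g))

    paint-list : ∀ (L : List (Fin n)) F g s → (∀ x → F x plus ≡ F x minus ⊎ x ∈ˡ L) → Painting F g s
    paint-list [] F g s bal = balanced F g s λ x → [ id , (λ ()) ]′ (bal x)
    paint-list (y ∷ L) F g s bal =
      uncoloured F y g s (paint-list L _ g s (bal′ false)) (paint-list L _ g s (bal′ true))
      where
      bal′ : ∀ b x → recolour F y b x plus ≡ recolour F y b x minus ⊎ x ∈ˡ L
      bal′ b x with x ≟ y
      ... | yes _ = inj₁ refl
      ... | no x≢y with bal x
      ...   | inj₁ eq = inj₁ eq
      ...   | inj₂ (here x≡y) = contradiction x≡y x≢y
      ...   | inj₂ (there x∈L) = inj₂ x∈L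

  -- Every element with a single allowed sign is recoloured to "none" and to "both"; if neither
  -- solution fits, the two vectors have product positive at g and nonnegative elsewhere.
  paint : ∀ F g s → Painted V F g s ⊎ Painted W (dual ∘ F) g s
  paint F g s = paint-list (allFin n) F g s λ x → inj₂ (∈-allFin x)

  -- Painting with the signs of `z` gives such a vector, or else a `w` whose products with `z` are
  -- nonnegative and positive at `g`, against orthogonality.
  simple-through : ∀ {z g} → V z → z g ≢ 0ℤ →
    Σ[ c ∈ Vect n ] V c × Simple c × c g ≢ 0ℤ × Conformal c z
  simple-through {z} {g} Vz zg≢0 with pick-sign (z g) zg≢0
  ... | s , t with paint (signsOf ∘ z) g s
  ...   | inj₁ (c , Vc , sc , cg , ok) = c , Vc , sc , sgn≢0 s ∘ trans (sym cg) , conf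
    where
    conf : Conformal c z
    conf x with x ≟ g
    ... | yes refl = subst (_∈ˢ signsOf (z g)) (sym cg) (sgn-∈ s {signsOf (z g)} t)
    ... | no x≢g = ok x x≢g
  ...   | inj₂ (w , Ww , sw , wg , ok) =
    contradiction (sym (nonneg-orth Vz Ww pos g)) (ℤP.<⇒≢ positive)
    where
    positive : 0ℤ < z g * w g
    positive = subst (λ a → 0ℤ < z g * a) (sym wg) (sign-product (z g) s t)
    pos : ∀ x → 0ℤ ≤ z x * w x
    pos x with x ≟ g
    ... | yes refl = ℤP.<⇒≤ positive
    ... | no x≢g = dual-product (z x) (w x) (∈-signsOf (z x)) (ok x x≢g)

  private
    -- `Proper` exhibits a strictly smaller support; `Blocked` is an orthogonal certificate that no
    -- vector of `V` runs through `g` inside the support of `c` without `h`. One painting decides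
    -- between them, which makes minimality decidable.
    Proper : Vect n → Fin n → Fin n → Set
    Proper c h g = Σ[ v ∈ Vect n ] V v × Simple v × v g ≢ 0ℤ × (∀ x → c x ≡ 0ℤ → v x ≡ 0ℤ) ×
      v h ≡ 0ℤ × c h ≢ 0ℤ

    Blocked : Vect n → Fin n → Fin n → Set
    Blocked c h g = c h ≢ 0ℤ → c g ≢ 0ℤ → g ≢ h →
      Σ[ w ∈ Vect n ] W w × w g ≡ 1ℤ × (∀ x → c x ≢ 0ℤ → x ≢ h → x ≢ g → w x ≡ 0ℤ)

    proper-or-blocked : ∀ c h g → Proper c h g ⊎ Blocked c h g
    proper-or-blocked c h g with c h ℤP.≟ 0ℤ | c g ℤP.≟ 0ℤ | g ≟ h
    ... | yes ch≡0 | _ | _ = inj₂ λ ch≢0 → contradiction ch≡0 ch≢0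
    ... | no _ | yes cg≡0 | _ = inj₂ λ _ cg≢0 → contradiction cg≡0 cg≢0
    ... | no _ | no _ | yes g≡h = inj₂ λ _ _ g≢h → contradiction g≡h g≢h
    ... | no ch≢0 | no cg≢0 | no g≢h = Sum.map
        (λ (v , Vv , sv , vg , z) → v , Vv , sv , (λ eq → 1≢0 (trans (sym vg) eq))
          , (λ x cx → z x (λ { refl → cg≢0 cx }) (outside x (inj₁ cx)))
          , z h (g≢h ∘ sym) (outside h (inj₂ refl)) , ch≢0)
        (λ (w , Ww , sw , wg , z) _ _ _ → w , Ww , wg , λ x cx x≢h x≢g → z x x≢g (inside x cx x≢h))
        (colour S g)
      where
      S : Fin n → Bool
      S x = does (¬? (c x ℤP.≟ 0ℤ) ×-dec ¬? (x ≟ h))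
      outside : ∀ x → c x ≡ 0ℤ ⊎ x ≡ h → T (not (S x))
      outside x p with c x ℤP.≟ 0ℤ | x ≟ h
      ... | yes _ | _ = tt
      ... | no _ | yes _ = tt
      ... | no a | no b = [ a , b ]′ p
      inside : ∀ x → c x ≢ 0ℤ → x ≢ h → T (S x)
      inside x a b with c x ℤP.≟ 0ℤ | x ≟ h
      ... | yes e | _ = contradiction e a
      ... | no _ | yes e = contradiction e b
      ... | no _ | no _ = tt

    -- A vector `v` inside the support of `c` that misses `h` meets the certificate for `h` and `y`
    -- only at `y`, so the inner product would be the nonzero number `v y`.
    blocked⇒elementary : ∀ {c g} → V c → Simple c → c g ≢ 0ℤ → (∀ h g → Blocked c h g) → Elementary V c
    blocked⇒elementary {c} {g} Vc sc cg≢0 blocked = record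
      { member = Vc ; simple = sc ; nonzero = g , cg≢0 ; minimal = minimal }
      where
      minimal : ∀ {v} → V v → (∃[ x ] v x ≢ 0ℤ) → (∀ x → c x ≡ 0ℤ → v x ≡ 0ℤ) →
        ∀ x → v x ≡ 0ℤ → c x ≡ 0ℤ
      minimal {v} Vv (y , vy≢0) sub h vh≡0 with c h ℤP.≟ 0ℤ
      ... | yes ch≡0 = ch≡0
      ... | no ch≢0 with blocked h y ch≢0 (vy≢0 ∘ sub y) (λ { refl → vy≢0 vh≡0 })
      ...   | w , Ww , wy , wz = contradiction
        (trans (sym (ℤP.*-identityʳ (v y))) (trans (cong (v y *_) (sym wy))
          (trans (sym (sum-single (λ x → v x * w x) y zeros)) (orth Vv Ww)))) vy≢0
        where
        zeros : ∀ x → x ≢ y → v x * w x ≡ 0ℤ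
        zeros x x≢y with v x ℤP.≟ 0ℤ
        ... | yes vx≡0 = cong (_* w x) vx≡0
        ... | no vx≢0 = trans
          (cong (v x *_) (wz x (vx≢0 ∘ sub x) (λ { refl → vx≢0 vh≡0 }) x≢y)) (ℤP.*-zeroʳ (v x))

    align : ∀ {c v g} → V v → Simple c → Simple v → c g ≢ 0ℤ → v g ≢ 0ℤ →
      Σ[ u ∈ Vect n ] V u × Simple u × u g ≡ c g × (∀ x → v x ≡ 0ℤ → u x ≡ 0ℤ)
    align {c} {v} {g} Vv sc sv cg≢0 vg≢0 with trit-same-or-opposite (sv g) (sc g) vg≢0 cg≢0
    ... | inj₁ eq = v , Vv , sv , eq , λ _ → id
    ... | inj₂ eq = (λ x → - v x) , V-neg Vv , (λ x → trit-neg (sv x)) , eq , λ x vx≡0 → cong -_ vx≡0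

    -- Three ways to lose support while keeping `g` and the signs of `c`: if `v` misses `g`, cancel
    -- an entry by `c - u`; if the aligned `u` opposes `c` somewhere, `c + u` cancels there and
    -- doubles at `g`; otherwise `u` itself is conformal to `c` and misses `h`.
    shrink : ∀ {c g h y} → V c → Simple c → c g ≢ 0ℤ → Proper c h y →
      Σ[ u ∈ Vect n ] V u × u g ≢ 0ℤ × Conformal u c × ∃[ x ] (u x ≡ 0ℤ × c x ≢ 0ℤ)
    shrink {c} {g} {h} {y} Vc sc cg≢0 (v , Vv , sv , vy≢0 , sub , vh≡0 , ch≢0) with v g ℤP.≟ 0ℤ
    ... | yes vg≡0 with align {c} Vv sc sv (vy≢0 ∘ sub y) vy≢0
    ...   | u , Vu , su , uy≡cy , uz =
      (λ x → c x + - u x) , V-+ Vc (V-neg Vu)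
      , (λ eq → cg≢0 (trans (sym (ℤP.+-identityʳ (c g))) (trans (cong (λ a → c g + - a) (sym (uz g vg≡0))) eq)))
      , (λ x → trit-sub (sc x) (su x) (uz x ∘ sub x))
      , y , trans (cong (λ a → c y + - a) uy≡cy) (ℤP.+-inverseʳ (c y)) , vy≢0 ∘ sub y
    shrink {c} {g} {h} {y} Vc sc cg≢0 (v , Vv , sv , vy≢0 , sub , vh≡0 , ch≢0) | no vg≢0
      with align {c} Vv sc sv cg≢0 vg≢0
    ...   | u , Vu , su , ug≡cg , uz with any? (λ x → ¬? (u x ℤP.≟ 0ℤ) ×-dec (u x ℤP.≟ - c x))
    ...     | yes (x , ux≢0 , ux≡-cx) =
      (λ x → c x + - - u x) , V-+ Vc (V-neg (V-neg Vu))
      , (λ eq → double≢0 cg≢0 (trans (cong (λ a → c g + a) (trans (sym ug≡cg) (sym (ℤP.neg-involutive (u g))))) eq))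
      , (λ x → trit-sub (sc x) (trit-neg (su x)) (cong -_ ∘ uz x ∘ sub x))
      , x , trans (cong (λ a → c x + - - a) ux≡-cx) (trans (cong (λ a → c x + a) (ℤP.neg-involutive (- c x))) (ℤP.+-inverseʳ (c x)))
      , λ cx≡0 → ux≢0 (uz x (sub x cx≡0))
    ...     | no none = u , Vu , (λ eq → cg≢0 (trans (sym ug≡cg) eq))
      , (λ x → trit-conformal (sc x) (su x) (uz x ∘ sub x) λ p → none (x , p))
      , h , uz h vh≡0 , ch≢0

    elementary-simple : ∀ {c g} → Acc ℕ._<_ (size c) → V c → Simple c → c g ≢ 0ℤ →
      Σ[ e ∈ Vect n ] Elementary V e × e g ≢ 0ℤ × Conformal e c
    elementary-simple {c} {g} (acc rec) Vc sc cg≢0 with search₂ (proper-or-blocked c)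
    ... | inj₂ blocked = c , blocked⇒elementary Vc sc cg≢0 blocked , cg≢0 , λ x → ∈-signsOf (c x)
    ... | inj₁ (h , y , proper) with shrink Vc sc cg≢0 proper
    -- `u` may have entries of absolute value two, so a simple vector conformal to it is extracted
    -- before recursing.
    ...   | u , Vu , ug≢0 , conf-u , k , uk≡0 , ck≢0 with simple-through Vu ug≢0
    ...     | d , Vd , sd , dg≢0 , conf-d = continue
      (elementary-simple (rec (size-strict d c
          (λ x → ∈-signsOf-zero (d x) (Conformal-trans {a = d} {u} {c} conf-d conf-u x))
          k (∈-signsOf-zero (d k) (conf-d k) uk≡0) ck≢0)) Vd sd dg≢0)
      where
      continue : (Σ[ e ∈ Vect n ] Elementary V e × e g ≢ 0ℤ × Conformal e d) →
        Σ[ e ∈ Vect n ] Elementary V e × e g ≢ 0ℤ × Conformal e c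
      continue (e , el , eg≢0 , conf) = e , el , eg≢0 ,
        Conformal-trans {a = e} {d} {c} conf (Conformal-trans {a = d} {u} {c} conf-d conf-u)

  elementary-through : ∀ {z g} → V z → z g ≢ 0ℤ →
    Σ[ e ∈ Vect n ] Elementary V e × e g ≢ 0ℤ × Conformal e z
  elementary-through {z} Vz zg≢0 with simple-through Vz zg≢0
  ... | c , Vc , sc , cg≢0 , conf with elementary-simple (<-wellFounded (size c)) Vc sc cg≢0
  ...   | e , el , eg≢0 , conf′ = e , el , eg≢0 , Conformal-trans {a = e} {c} {z} conf′ conf

-- Orientations as 0/1-vectors; local sign conditions checked by evaluation.

_==_ : Sign → Sign → Bool
plus == plus = true
minus == minus = true
_ == _ = false

==-refl : ∀ o → T (o == o)
==-refl plus = tt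
==-refl minus = tt

χ : Sign → ℤ
χ plus = 1ℤ
χ minus = 0ℤ

δ : Sign → Sign → ℤ
δ o₁ o₂ = χ o₂ + - χ o₁

δ-trit : ∀ o₁ o₂ → IsTrit (δ o₁ o₂)
δ-trit plus plus = inj₂ (inj₁ refl)
δ-trit plus minus = inj₁ refl
δ-trit minus plus = inj₂ (inj₂ refl)
δ-trit minus minus = inj₂ (inj₁ refl)

-- F(B₁,σ) ∩ −F(B₂,σ) at an element, in terms of membership in the two bases and of the signs
-- of β(B₁) and β(B₂); the cocircuit version arises by complementing the bases.
opposed : Bool → Bool → Sign → Sign → Sign → Bool
opposed b₁ b₂ o₁ o₂ s = (b₁ ∨ (o₁ == s)) ∧ (b₂ ∨ (o₂ == flipS s))

data Trit : Set where
  neg nul pos : Trit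

⟦_⟧ : Trit → ℤ
⟦ neg ⟧ = -1ℤ
⟦ nul ⟧ = 0ℤ
⟦ pos ⟧ = 1ℤ

toTrit : ∀ {z} → IsTrit z → ∃[ t ] z ≡ ⟦ t ⟧
toTrit (inj₁ eq) = neg , eq
toTrit (inj₂ (inj₁ eq)) = nul , eq
toTrit (inj₂ (inj₂ eq)) = pos , eq

-- Which of the two vectors accounts for the difference of the two orientations at an element.
data Class : Set where
  inV inW both : Class

zOf wOf : Class → Sign → Sign → ℤ
zOf inV o₁ o₂ = δ o₁ o₂
zOf inW o₁ o₂ = 0ℤ
zOf both o₁ o₂ = δ o₁ o₂
wOf inV o₁ o₂ = 0ℤ
wOf inW o₁ o₂ = δ o₁ o₂
wOf both o₁ o₂ = δ o₁ o₂

-- Both vectors may carry the full difference only at `f`, and only if the orientations differ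
-- there; the arc is then the negative of that difference.
valid : Class → Bool → Sign → Sign → Bool
valid inV _ _ _ = true
valid inW _ _ _ = true
valid both isf o₁ o₂ = isf ∧ not (o₁ == o₂)

Point : Set
Point = Class × Bool × Bool × Bool × Sign × Sign × Trit

points : List Point
points = cartesianProduct (inV ∷ inW ∷ both ∷ []) (cartesianProduct bools (cartesianProduct bools
  (cartesianProduct bools (cartesianProduct signs (cartesianProduct signs (neg ∷ nul ∷ pos ∷ []))))))
  where
  bools = true ∷ false ∷ []
  signs = plus ∷ minus ∷ []

point∈points : ∀ p → p ∈ˡ points
point∈points (k , isf , b₁ , b₂ , o₁ , o₂ , c) =
  ∈-cartesianProduct⁺ (class k) (∈-cartesianProduct⁺ (bool isf) (∈-cartesianProduct⁺ (bool b₁)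
    (∈-cartesianProduct⁺ (bool b₂) (∈-cartesianProduct⁺ (sign o₁) (∈-cartesianProduct⁺ (sign o₂) (trit c))))))
  where
  class : ∀ k → k ∈ˡ inV ∷ inW ∷ both ∷ []
  class inV = here refl
  class inW = there (here refl)
  class both = there (there (here refl))
  bool : ∀ b → b ∈ˡ true ∷ false ∷ []
  bool true = here refl
  bool false = there (here refl)
  sign : ∀ o → o ∈ˡ plus ∷ minus ∷ []
  sign plus = here refl
  sign minus = there (here refl)
  trit : ∀ t → t ∈ˡ neg ∷ nul ∷ pos ∷ []
  trit neg = here refl
  trit nul = there (here refl)
  trit pos = there (there (here refl))

infixr 3 _⇒_
_⇒_ : Bool → Bool → Bool
a ⇒ b = if a then b else true

⇒-elim : ∀ {a b} → T (a ⇒ b) → T a → T b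
⇒-elim {true} t _ = t

T-∧ˡ : ∀ {a b} → T (a ∧ b) → T a
T-∧ˡ {true} _ = tt

T-∧ʳ : ∀ {a b} → T (a ∧ b) → T b
T-∧ʳ {true} t = t

-- Proof by reflection: the type checker evaluates `check` on every local configuration, and each
-- instance is then a lookup in the list.
by-cases : ∀ (check : Point → Bool) → T (all check points) → ∀ p → T (check p)
by-cases check ok p = sound points ok (point∈points p)
  where
  sound : ∀ L → T (all check L) → ∀ {p} → p ∈ˡ L → T (check p)
  sound (q ∷ L) t (here refl) = T-∧ˡ t
  sound (q ∷ L) t (there p∈L) = sound L (T-∧ʳ {check q} t) p∈L

nonzero? : ℤ → Bool
nonzero? (+ zero) = false
nonzero? _ = true

-- The colouring that is painted in the main argument: a circuit C through h obeying it makes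
-- −z − C compatible with F(B₁,σ) ∩ −F(B₂,σ), and a cocircuit D obeying its dual makes D − w
-- compatible with F(B₁,σ*) ∩ −F(B₂,σ*).
hull : Bool → Bool → Bool → Sign → Sign → ℤ → Sign → Bool
hull isf b₁ b₂ o₁ o₂ z s =
  -- If `z` is the nonzero difference of the orientations, `o₁` is the sign of `- z`. Allowing no
  -- sign off both bases makes the painted circuit vanish there; `f` is exempt, which will keep a
  -- painted cocircuit different from `w` at `f`.
  if nonzero? z then (b₁ ∨ b₂ ∨ isf) ∧ (o₁ == s)
  -- Where `z` vanishes it is `- C` that has to fit, hence the flipped sign.
  else (b₁ ∨ b₂) ∧ opposed b₁ b₂ o₁ o₂ (flipS s)

neg-z-check neg-w-check circuit-check cocircuit-check complement-check : Point → Bool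
neg-z-check (k , isf , b₁ , b₂ , o₁ , o₂ , _) =
  valid k isf o₁ o₂ ⇒ (- zOf k o₁ o₂ ∈ᵇ opposed b₁ b₂ o₁ o₂)
neg-w-check (k , isf , b₁ , b₂ , o₁ , o₂ , _) =
  valid k isf o₁ o₂ ⇒ (- wOf k o₁ o₂ ∈ᵇ opposed (not b₁) (not b₂) o₁ o₂)
circuit-check (k , isf , b₁ , b₂ , o₁ , o₂ , c) =
  valid k isf o₁ o₂ ⇒ (⟦ c ⟧ ∈ᵇ hull isf b₁ b₂ o₁ o₂ (zOf k o₁ o₂)) ⇒
  (- zOf k o₁ o₂ + - ⟦ c ⟧ ∈ᵇ opposed b₁ b₂ o₁ o₂)
cocircuit-check (k , isf , b₁ , b₂ , o₁ , o₂ , d) =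
  valid k isf o₁ o₂ ⇒ (⟦ d ⟧ ∈ᵇ dual (hull isf b₁ b₂ o₁ o₂ (zOf k o₁ o₂))) ⇒
  (⟦ d ⟧ + - wOf k o₁ o₂ ∈ᵇ opposed (not b₁) (not b₂) o₁ o₂)
-- Where the orientations agree, a coefficient rejected by the first fourientation is accepted by
-- the second; this is used for `- z` at the exceptional element.
complement-check (_ , _ , b₁ , b₂ , o , _ , t) =
  not (⟦ t ⟧ ∈ᵇ opposed b₁ b₂ o o) ⇒ (⟦ t ⟧ ∈ᵇ opposed (not b₁) (not b₂) o o)

neg-z-fact : ∀ p → T (neg-z-check p)
neg-z-fact = by-cases neg-z-check tt
neg-w-fact : ∀ p → T (neg-w-check p)
neg-w-fact = by-cases neg-w-check tt
circuit-fact : ∀ p → T (circuit-check p)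
circuit-fact = by-cases circuit-check tt
cocircuit-fact : ∀ p → T (cocircuit-check p)
cocircuit-fact = by-cases cocircuit-check tt
complement-fact : ∀ p → T (complement-check p)
complement-fact = by-cases complement-check tt

-- Vectors that explain the difference except at one element.

Free : ∀ {n} → (Vect n → Set) → (Fin n → Sign → Bool) → Set
Free {n} U F = ∀ (u : Vect n) → U u → (∀ x → u x ∈ˢ F x) → ∀ x → u x ≡ 0ℤ

Explained : Bool → Sign → Sign → ℤ → ℤ → Set
Explained isf o₁ o₂ z w = Σ[ k ∈ Class ] z ≡ zOf k o₁ o₂ × w ≡ wOf k o₁ o₂ × T (valid k isf o₁ o₂)

explained-z-trit : ∀ {isf o₁ o₂ z w} → Explained isf o₁ o₂ z w → IsTrit z
explained-z-trit {o₁ = o₁} {o₂} (inV , refl , _) = δ-trit o₁ o₂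
explained-z-trit {o₁ = o₁} {o₂} (inW , refl , _) = inj₂ (inj₁ refl)
explained-z-trit {o₁ = o₁} {o₂} (both , refl , _) = δ-trit o₁ o₂

explained-neg-z : ∀ {isf o₁ o₂ z w} b₁ b₂ → Explained isf o₁ o₂ z w → - z ∈ˢ opposed b₁ b₂ o₁ o₂
explained-neg-z b₁ b₂ (k , refl , _ , v) = ⇒-elim (neg-z-fact (k , _ , b₁ , b₂ , _ , _ , nul)) v

explained-neg-w : ∀ {isf o₁ o₂ z w} b₁ b₂ → Explained isf o₁ o₂ z w →
  - w ∈ˢ opposed (not b₁) (not b₂) o₁ o₂
explained-neg-w b₁ b₂ (k , _ , refl , v) = ⇒-elim (neg-w-fact (k , _ , b₁ , b₂ , _ , _ , nul)) v

zero-∈ˢ : ∀ {z} F → z ≡ 0ℤ → z ∈ˢ F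
zero-∈ˢ F refl = tt

sgn-trit : ∀ s → IsTrit (sgn s)
sgn-trit plus = inj₂ (inj₂ refl)
sgn-trit minus = inj₁ refl

trit-sgn : ∀ {z} → IsTrit z → z ≢ 0ℤ → ∃[ s ] z ≡ sgn s
trit-sgn (inj₁ refl) _ = minus , refl
trit-sgn (inj₂ (inj₁ refl)) z≢0 = contradiction refl z≢0
trit-sgn (inj₂ (inj₂ refl)) _ = plus , refl

neg≡0 : ∀ {z} → - z ≡ 0ℤ → z ≡ 0ℤ
neg≡0 {z} eq = trans (sym (ℤP.neg-involutive z)) (cong -_ eq)

trit-conformal-≡ : ∀ {a b} → IsTrit a → IsTrit b → b ≢ 0ℤ → b ∈ˢ signsOf a → b ≡ a
trit-conformal-≡ _ (inj₂ (inj₁ refl)) b≢0 _ = contradiction refl b≢0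
trit-conformal-≡ (inj₁ refl) (inj₁ refl) _ _ = refl
trit-conformal-≡ (inj₂ (inj₂ refl)) (inj₂ (inj₂ refl)) _ _ = refl
trit-conformal-≡ (inj₁ refl) (inj₂ (inj₂ refl)) _ ()
trit-conformal-≡ (inj₂ (inj₁ refl)) (inj₁ refl) _ ()
trit-conformal-≡ (inj₂ (inj₁ refl)) (inj₂ (inj₂ refl)) _ ()
trit-conformal-≡ (inj₂ (inj₂ refl)) (inj₁ refl) _ ()

elementary-ext : ∀ {n} {V W : Vect n → Set} (R : RegularPair V W) {u v} → (∀ x → u x ≡ v x) →
  Elementary V u → Elementary V v
elementary-ext R {u} {v} eq E = record
  { member = V-ext eq member
  ; simple = λ x → subst IsTrit (eq x) (simple x)
  ; nonzero = proj₁ nonzero , λ e → proj₂ nonzero (trans (eq _) e)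
  ; minimal = λ Uv nz sub x vx → trans (sym (eq x)) (minimal Uv nz (λ y uy → sub y (trans (sym (eq y)) uy)) x vx)
  }
  where
  open RegularPair R
  open Elementary E

module Exceptional {n} {V W : Vect n → Set} (R : RegularPair V W)
  (b₁ b₂ : Fin n → Bool) (O₁ O₂ : Fin n → Sign) where
  open RegularPair R

  F G : Fin n → Sign → Bool
  F x = opposed (b₁ x) (b₂ x) (O₁ x) (O₂ x)
  G x = opposed (not (b₁ x)) (not (b₂ x)) (O₁ x) (O₂ x)

  -- Only at `h` may `z` and `w` fail to explain the difference. In the first mode `h` is `f` and
  -- `w` is zero; in the second, `z` and `w` cancel at `h` different from `f`, and the last
  -- condition keeps a painted cocircuit apart from `w` at `f`.
  module _ (freeV : Free V F) (freeW : Free W G)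
    {z w : Vect n} (Vz : V z) (Ww : W w) (f h : Fin n)
    (explained : ∀ x → x ≢ h → Explained (does (x ≟ f)) (O₁ x) (O₂ x) (z x) (w x))
    (O₁h≡O₂h : O₁ h ≡ O₂ h) (z-trit : IsTrit (z h)) (zh≢0 : z h ≢ 0ℤ)
    (mode : (h ≡ f × (∀ x → w x ≡ 0ℤ)) ⊎
            (w h ≡ - z h × h ≢ f × w f ≢ 0ℤ × (∀ t → t ∈ˢ dual (hull true (b₁ f) (b₂ f) (O₁ f) (O₂ f) (z f)) → t + - w f ≢ 0ℤ)))
    where

    neg-z-fits : ∀ x → x ≢ h → - z x ∈ˢ F x
    neg-z-fits x x≢h = explained-neg-z (b₁ x) (b₂ x) (explained x x≢h)

    neg-w-fits : ∀ x → x ≢ h → - w x ∈ˢ G x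
    neg-w-fits x x≢h = explained-neg-w (b₁ x) (b₂ x) (explained x x≢h)

    neg-z-unfit : ¬ - z h ∈ˢ F h
    neg-z-unfit fit = zh≢0 (neg≡0 (freeV (λ x → - z x) (V-neg Vz) fits h))
      where
      fits : ∀ x → - z x ∈ˢ F x
      fits x with x ≟ h
      ... | yes refl = fit
      ... | no x≢h = neg-z-fits x x≢h

    z-simple : Simple z
    z-simple x with x ≟ h
    ... | yes refl = z-trit
    ... | no x≢h = explained-z-trit (explained x x≢h)

    -- A circuit `c` through `h` conformal to `z` agrees with `z` at `h`. So `z - c` vanishes there,
    -- and elsewhere its negative inherits the fit of `- z`; freeness gives `z = c`.
    elementary : Elementary V z
    elementary with elementary-through R Vz zh≢0
    ... | c , El , ch≢0 , conf = elementary-ext R (λ x → sym (z≡c x)) El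
      where
      at-h : z h ≡ c h
      at-h = sym (trit-conformal-≡ z-trit (Elementary.simple El h) ch≢0 (conf h))
      sub-conf : ∀ {a b} → IsTrit a → IsTrit b → b ∈ˢ signsOf a → - (a + - b) ∈ˢ signsOf (- a)
      sub-conf (inj₁ refl) (inj₁ refl) _ = tt
      sub-conf (inj₁ refl) (inj₂ (inj₂ refl)) ()
      sub-conf (inj₂ (inj₁ refl)) (inj₁ refl) ()
      sub-conf (inj₂ (inj₁ refl)) (inj₂ (inj₂ refl)) ()
      sub-conf (inj₂ (inj₂ refl)) (inj₁ refl) ()
      sub-conf (inj₁ refl) (inj₂ (inj₁ refl)) _ = tt
      sub-conf (inj₂ (inj₁ refl)) (inj₂ (inj₁ refl)) _ = tt
      sub-conf (inj₂ (inj₂ refl)) (inj₂ (inj₁ refl)) _ = tt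
      sub-conf (inj₂ (inj₂ refl)) (inj₂ (inj₂ refl)) _ = tt
      fits : ∀ x → - (z x + - c x) ∈ˢ F x
      fits x with x ≟ h
      ... | yes refl = zero-∈ˢ (F h) (cong -_ (trans (cong (λ a → a + - c h) at-h) (ℤP.+-inverseʳ (c h))))
      ... | no x≢h = ∈-signsOf-trans (- (z x + - c x)) (- z x) {F x}
        (sub-conf (z-simple x) (Elementary.simple El x) (conf x)) (neg-z-fits x x≢h)
      z≡c : ∀ x → z x ≡ c x
      z≡c x = ℤP.i-j≡0⇒i≡j (z x) (c x) (neg≡0 (freeV (λ x → - (z x + - c x))
        (V-neg (V-+ Vz (V-neg (Elementary.member El)))) fits x))

    private
      H : Fin n → Sign → Bool
      H x = hull (does (x ≟ f)) (b₁ x) (b₂ x) (O₁ x) (O₂ x) (z x)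

      neg-z-cofit : - z h ∈ˢ G h
      neg-z-cofit with toTrit (trit-neg z-trit)
      ... | t , et = subst₂ (λ a o → a ∈ˢ opposed (not (b₁ h)) (not (b₂ h)) (O₁ h) o) (sym et) O₁h≡O₂h
        (⇒-elim (complement-fact (inV , true , b₁ h , b₂ h , O₁ h , plus , t))
          (T-not λ fit → neg-z-unfit (subst₂ (λ a o → a ∈ˢ opposed (b₁ h) (b₂ h) (O₁ h) o) (sym et) O₁h≡O₂h fit)))

      circuit⇒opposite : ∀ {s} → sgn s ≡ - z h → (P : Painted R V H h s) →
        ∀ x → - z x + - proj₁ P x ≡ 0ℤ
      circuit⇒opposite es (C , VC , sC , Ch , ok) = freeV (λ x → - z x + - C x)
        (V-+ (V-neg Vz) (V-neg VC)) fits
        where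
        fits : ∀ x → - z x + - C x ∈ˢ F x
        fits x with x ≟ h
        ... | yes refl = zero-∈ˢ (F h) (trans (cong (λ a → - z h + - a) (trans Ch es)) (ℤP.+-inverseʳ (- z h)))
        ... | no x≢h with explained x x≢h | toTrit (sC x)
        ...   | k , ez , _ , v | c , ec = subst₂ (λ a b → - a + - b ∈ˢ F x) (sym ez) (sym ec)
          (⇒-elim (⇒-elim (circuit-fact (k , does (x ≟ f) , b₁ x , b₂ x , O₁ x , O₂ x , c)) v)
            (subst₂ (λ a b → b ∈ˢ hull (does (x ≟ f)) (b₁ x) (b₂ x) (O₁ x) (O₂ x) a) ez ec (ok x x≢h)))

      -- `D - w` fits `G` as soon as it does so at `h`. In the first mode its value there is
      -- `- z h`, accepted but nonzero; in the second it vanishes at `h` but cannot vanish at `f`.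
      no-cocircuit : ∀ {s} → sgn s ≡ - z h → ¬ Painted R W (dual ∘ H) h s
      no-cocircuit {s} es (D , WD , sD , Dh , ok) = [ modeA , modeB ]′ mode
        where
        fits : (- z h + - w h ∈ˢ G h) → ∀ x → D x + - w x ∈ˢ G x
        fits fit-h x with x ≟ h
        ... | yes refl = subst (λ a → a + - w h ∈ˢ G h) (sym (trans Dh es)) fit-h
        ... | no x≢h with explained x x≢h | toTrit (sD x)
        ...   | k , ez , ew , v | d , ed = subst₂ (λ a b → a + - b ∈ˢ G x) (sym ed) (sym ew)
          (⇒-elim (⇒-elim (cocircuit-fact (k , does (x ≟ f) , b₁ x , b₂ x , O₁ x , O₂ x , d)) v)
            (subst₂ (λ a b → b ∈ˢ dual (hull (does (x ≟ f)) (b₁ x) (b₂ x) (O₁ x) (O₂ x) a)) ez ed (ok x x≢h)))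
        vanishes : (- z h + - w h ∈ˢ G h) → ∀ x → D x + - w x ≡ 0ℤ
        vanishes fit-h = freeW (λ x → D x + - w x) (W-+ WD (W-neg Ww)) (fits fit-h)
        modeA : h ≡ f × (∀ x → w x ≡ 0ℤ) → ⊥
        modeA (_ , w≡0) = sgn≢0 s (trans (sym Dh) (trans (sym (ℤP.+-identityʳ (D h)))
          (trans (cong (λ a → D h + - a) (sym (w≡0 h)))
          (vanishes (subst (_∈ˢ G h) (sym (trans (cong (λ a → - z h + - a) (w≡0 h)) (ℤP.+-identityʳ (- z h)))) neg-z-cofit) h))))
        modeB : (w h ≡ - z h × h ≢ f × w f ≢ 0ℤ × (∀ t → t ∈ˢ dual (hull true (b₁ f) (b₂ f) (O₁ f) (O₂ f) (z f)) → t + - w f ≢ 0ℤ)) → ⊥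
        modeB (wh , h≢f , _ , apart) = apart (D f)
          (subst (λ b → D f ∈ˢ dual (hull b (b₁ f) (b₂ f) (O₁ f) (O₂ f) (z f))) (dec-true (f ≟ f) refl) (ok f (h≢f ∘ sym)))
          (vanishes (zero-∈ˢ (G h) (trans (cong (λ a → - z h + - a) wh) (ℤP.+-inverseʳ (- z h)))) f)

      outside-zero : ∀ {z c o₁ o₂} → c ∈ˢ hull false false false o₁ o₂ z → c ≡ 0ℤ
      outside-zero {c = + zero} _ = refl
      outside-zero {+ zero} {+[1+ _ ]} ()
      outside-zero {+[1+ _ ]} {+[1+ _ ]} ()
      outside-zero { -[1+ _ ]} {+[1+ _ ]} ()
      outside-zero {+ zero} { -[1+ _ ]} ()
      outside-zero {+[1+ _ ]} { -[1+ _ ]} ()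
      outside-zero { -[1+ _ ]} { -[1+ _ ]} ()

    vanish-outside : ∀ e → b₁ e ≡ false → b₂ e ≡ false → e ≢ f → z e ≡ 0ℤ
    vanish-outside e b₁e b₂e e≢f with e ≟ h
    -- If `h` lay outside both bases, `G` would impose nothing there, so `- w` would fit everywhere
    -- and vanish, although `w f` is nonzero in the second mode.
    vanish-outside e b₁e b₂e e≢f | yes refl = contradiction mode
      [ (λ (h≡f , _) → e≢f h≡f)
      , (λ (_ , _ , wf≢0 , _) → wf≢0 (neg≡0 (freeW (λ x → - w x) (W-neg Ww) fits f))) ]′
      where
      any-sign : ∀ {c₁ c₂ o₁ o₂} z → c₁ ≡ false → c₂ ≡ false → z ∈ˢ opposed (not c₁) (not c₂) o₁ o₂
      any-sign (+ zero) refl refl = tt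
      any-sign +[1+ _ ] refl refl = tt
      any-sign -[1+ _ ] refl refl = tt
      fits : ∀ x → - w x ∈ˢ G x
      fits x with x ≟ h
      ... | yes refl = any-sign (- w h) b₁e b₂e
      ... | no x≢h = neg-w-fits x x≢h
    vanish-outside e b₁e b₂e e≢f | no e≢h with trit-sgn (trit-neg z-trit) (zh≢0 ∘ neg≡0)
    ... | s , es with paint R H h s
    ...   | inj₂ D = contradiction D (no-cocircuit (sym es))
    ...   | inj₁ P@(C , _ , _ , _ , ok) = neg≡0 (trans (sym (ℤP.+-identityʳ (- z e)))
      (trans (cong (λ a → - z e + - a) (sym Ce≡0)) (circuit⇒opposite (sym es) P e)))
      where
      reduce : ∀ {isf c₁ c₂ o₁ o₂} {a t : ℤ} → isf ≡ false → c₁ ≡ false → c₂ ≡ false →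
        t ∈ˢ hull isf c₁ c₂ o₁ o₂ a → t ∈ˢ hull false false false o₁ o₂ a
      reduce refl refl refl p = p
      Ce≡0 : C e ≡ 0ℤ
      Ce≡0 = outside-zero {z e} {C e} {O₁ e} {O₂ e}
        (reduce {o₁ = O₁ e} {O₂ e} {z e} {C e} (dec-false (e ≟ f) e≢f) b₁e b₂e (ok e e≢h))

-- Locating the exceptional element from the products of `z` and `w`.

+-zeroʳ : ∀ a {b} → b ≡ 0ℤ → a ≡ a + b
+-zeroʳ a refl = sym (ℤP.+-identityʳ a)

arc : ∀ {n} → Fin n → Sign → Vect n
arc f s x = if does (x ≟ f) then sgn s else 0ℤ

arc-at : ∀ {n} (f : Fin n) s → arc f s f ≡ sgn s
arc-at f s rewrite dec-true (f ≟ f) refl = refl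

arc-off : ∀ {n} (f : Fin n) s x → x ≢ f → arc f s x ≡ 0ℤ
arc-off f s x x≢f rewrite dec-false (x ≟ f) x≢f = refl

sum-arc : ∀ {n} (f : Fin n) s → sumFin (arc f s) ≡ sgn s
sum-arc f s = trans (sum-single (arc f s) f (arc-off f s)) (arc-at f s)

subtract : ∀ {a b c} → a + b ≡ c → - b ≡ a + - c
subtract {a} {b} refl = identity a b
  where
  identity : ∀ a b → - b ≡ a + - (a + b)
  identity = solve-∀

-- `dual (signsOf z)` excludes at most the sign opposite to `z`, and subtracting a number of
-- absolute value at most one cannot carry a nonzero integer past zero.
near : ∀ {d} z → IsTrit d → z + - d ∈ˢ dual (signsOf z)
near (+ zero) (inj₁ refl) = tt
near (+ zero) (inj₂ (inj₁ refl)) = tt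
near (+ zero) (inj₂ (inj₂ refl)) = tt
near +[1+ _ ] (inj₁ refl) = tt
near +[1+ _ ] (inj₂ (inj₁ refl)) = tt
near +[1+ zero ] (inj₂ (inj₂ refl)) = tt
near +[1+ suc _ ] (inj₂ (inj₂ refl)) = tt
near -[1+ zero ] (inj₁ refl) = tt
near -[1+ suc _ ] (inj₁ refl) = tt
near -[1+ _ ] (inj₂ (inj₁ refl)) = tt
near -[1+ _ ] (inj₂ (inj₂ refl)) = tt

product-near : ∀ {d} z w → IsTrit d → z + w ≡ d → 0ℤ ≤ z * - w
product-near {d} z w td eq = dual-product z (- w) {signsOf z} (∈-signsOf z)
  (subst (_∈ˢ dual (signsOf z)) (sym (subtract {z} {w} eq)) (near z td))

-- The sum `z + w` leaves the range from -1 to 1 only if the orientation turns at `f` from `s` to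
-- the opposite sign. It is then `-2` times `sgn s`, and two integers of positive product with that
-- sum are both `- sgn s`.
product-near-arc : ∀ o₁ o₂ s z w → z + w ≡ δ o₁ o₂ + - sgn s →
  0ℤ ≤ z * - w ⊎ (z ≡ - sgn s × w ≡ - sgn s × o₁ ≡ s × o₂ ≡ flipS s)
product-near-arc plus plus plus z w eq = inj₁ (product-near z w (inj₁ refl) eq)
product-near-arc plus plus minus z w eq = inj₁ (product-near z w (inj₂ (inj₂ refl)) eq)
product-near-arc minus minus plus z w eq = inj₁ (product-near z w (inj₁ refl) eq)
product-near-arc minus minus minus z w eq = inj₁ (product-near z w (inj₂ (inj₂ refl)) eq)
product-near-arc plus minus minus z w eq = inj₁ (product-near z w (inj₂ (inj₁ refl)) eq)
product-near-arc minus plus plus z w eq = inj₁ (product-near z w (inj₂ (inj₁ refl)) eq)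
product-near-arc plus minus plus z w eq with z ℤP.≟ -1ℤ
... | yes refl = inj₂ (refl , +-cancelˡ -1ℤ w -1ℤ eq , refl , refl)
... | no z≢-1 = inj₁ (dual-product z (- w) {signsOf z} (∈-signsOf z)
        (subst (_∈ˢ dual (signsOf z)) (sym (subtract {z} {w} eq)) (fits z z≢-1)))
  where
  fits : ∀ z → z ≢ -1ℤ → z + + 2 ∈ˢ dual (signsOf z)
  fits (+ zero) _ = tt
  fits +[1+ _ ] _ = tt
  fits -[1+ zero ] z≢-1 = contradiction refl z≢-1
  fits -[1+ suc zero ] _ = tt
  fits -[1+ suc (suc _) ] _ = tt
product-near-arc minus plus minus z w eq with z ℤP.≟ 1ℤ
... | yes refl = inj₂ (refl , +-cancelˡ 1ℤ w 1ℤ eq , refl , refl)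
... | no z≢1 = inj₁ (dual-product z (- w) {signsOf z} (∈-signsOf z)
        (subst (_∈ˢ dual (signsOf z)) (sym (subtract {z} {w} eq)) (fits z z≢1)))
  where
  fits : ∀ z → z ≢ 1ℤ → z + - + 2 ∈ˢ dual (signsOf z)
  fits (+ zero) _ = tt
  fits -[1+ _ ] _ = tt
  fits +[1+ zero ] z≢1 = contradiction refl z≢1
  fits +[1+ suc zero ] _ = tt
  fits +[1+ suc (suc _) ] _ = tt

product≡1 : ∀ a b → a * b ≡ 1ℤ → a ≡ b × IsTrit a × a ≢ 0ℤ
product≡1 a b eq = units a b (ℕP.m*n≡1⇒m≡1 ∣ a ∣ ∣ b ∣ abs) (ℕP.m*n≡1⇒n≡1 ∣ a ∣ ∣ b ∣ abs) eq
  where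
  abs : ∣ a ∣ ℕ.* ∣ b ∣ ≡ 1
  abs = trans (sym (ℤP.abs-* a b)) (cong ∣_∣ eq)
  units : ∀ a b → ∣ a ∣ ≡ 1 → ∣ b ∣ ≡ 1 → a * b ≡ 1ℤ → a ≡ b × IsTrit a × a ≢ 0ℤ
  units +[1+ zero ] +[1+ zero ] _ _ _ = refl , inj₂ (inj₂ refl) , λ ()
  units -[1+ zero ] -[1+ zero ] _ _ _ = refl , inj₁ refl , λ ()
  units +[1+ zero ] -[1+ zero ] _ _ ()
  units -[1+ zero ] +[1+ zero ] _ _ ()

product-zero : ∀ z w → z * - w ≡ 0ℤ → z ≡ 0ℤ ⊎ w ≡ 0ℤ
product-zero z w eq = Sum.map₂ neg≡0 (ℤP.i*j≡0⇒i≡0∨j≡0 z eq)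

δ≡0⇒≡ : ∀ o₁ o₂ → δ o₁ o₂ ≡ 0ℤ → o₁ ≡ o₂
δ≡0⇒≡ plus plus _ = refl
δ≡0⇒≡ minus minus _ = refl
δ≡0⇒≡ plus minus ()
δ≡0⇒≡ minus plus ()

_≟ˢ_ : ∀ (o₁ o₂ : Sign) → Dec (o₁ ≡ o₂)
plus ≟ˢ plus = yes refl
plus ≟ˢ minus = no λ ()
minus ≟ˢ plus = no λ ()
minus ≟ˢ minus = yes refl

-- Here `z` is zero or twice `δ o₁ o₂`, so `- z` needs only the sign that is already permitted for
-- `- δ o₁ o₂`.
opposite-fits : ∀ b₁ b₂ o₁ o₂ s z → o₁ ≢ o₂ → z ≡ δ o₁ o₂ + - sgn s → - z ∈ˢ opposed b₁ b₂ o₁ o₂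
opposite-fits b₁ b₂ plus plus s z o₁≢o₂ _ = contradiction refl o₁≢o₂
opposite-fits b₁ b₂ minus minus s z o₁≢o₂ _ = contradiction refl o₁≢o₂
opposite-fits b₁ b₂ plus minus minus z _ refl = tt
opposite-fits b₁ b₂ minus plus plus z _ refl = tt
opposite-fits true true plus minus plus z _ refl = tt
opposite-fits true false plus minus plus z _ refl = tt
opposite-fits false true plus minus plus z _ refl = tt
opposite-fits false false plus minus plus z _ refl = tt
opposite-fits true true minus plus minus z _ refl = tt
opposite-fits true false minus plus minus z _ refl = tt
opposite-fits false true minus plus minus z _ refl = tt
opposite-fits false false minus plus minus z _ refl = tt

-- Because `hull` exempts `f`, the sign `s` is allowed there, so the dual colouring forbids the sign
-- of `- sgn s`, the value of `w` at `f`.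
hull-apart : ∀ b₁ b₂ s t → t ∈ˢ dual (hull true b₁ b₂ s (flipS s) (- sgn s)) → t + - - sgn s ≢ 0ℤ
hull-apart b₁ b₂ plus (+ _) _ = λ { eq → no-succ _ eq }
  where
  no-succ : ∀ m → + (m ℕ.+ 1) ≢ 0ℤ
  no-succ (suc m) ()
hull-apart true b₂ plus -[1+ _ ] ()
hull-apart false true plus -[1+ _ ] ()
hull-apart false false plus -[1+ _ ] ()
hull-apart b₁ b₂ minus (+ zero) _ ()
hull-apart true b₂ minus +[1+ _ ] ()
hull-apart false true minus +[1+ _ ] ()
hull-apart false false minus +[1+ _ ] ()
hull-apart b₁ b₂ minus -[1+ _ ] _ ()

module Analysis {n} {V W : Vect n → Set} (R : RegularPair V W)
  (b₁ b₂ : Fin n → Bool) (O₁ O₂ : Fin n → Sign) where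
  open RegularPair R
  open Exceptional R b₁ b₂ O₁ O₂

  module _ (freeV : Free V F) (freeW : Free W G) (f : Fin n) (s : Sign)
    {z w : Vect n} (Vz : V z) (Ww : W w)
    (difference : ∀ x → δ (O₁ x) (O₂ x) ≡ z x + w x + arc f s x)
    where

    Side : Set
    Side = (∀ x → z x ≡ 0ℤ) ⊎
      (Elementary V z × z f ≢ 0ℤ × (∀ e → b₁ e ≡ false → b₂ e ≡ false → e ≢ f → z e ≡ 0ℤ))

    private
      off-f : ∀ x → x ≢ f → z x + w x ≡ δ (O₁ x) (O₂ x)
      off-f x x≢f = trans (sym (ℤP.+-identityʳ (z x + w x)))
        (trans (cong (λ a → z x + w x + a) (sym (arc-off f s x x≢f))) (sym (difference x)))

      at-f : z f + w f ≡ δ (O₁ f) (O₂ f) + - sgn s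
      at-f = trans (cancel (z f + w f) (sgn s)) (cong (λ a → a + - sgn s)
        (trans (cong (λ a → z f + w f + a) (sym (arc-at f s))) (sym (difference f))))
        where
        cancel : ∀ a b → a ≡ a + b + - b
        cancel = solve-∀

      product : Fin n → ℤ
      product x = z x * - w x

      explain : ∀ x → x ≢ f → product x ≡ 0ℤ → Explained (does (x ≟ f)) (O₁ x) (O₂ x) (z x) (w x)
      explain x x≢f eq with product-zero (z x) (w x) eq
      ... | inj₁ z≡0 = inW , z≡0 , trans (trans (sym (ℤP.+-identityˡ (w x))) (cong (λ a → a + w x) (sym z≡0))) (off-f x x≢f) , tt
      ... | inj₂ w≡0 = inV , trans (+-zeroʳ (z x) w≡0) (off-f x x≢f) , w≡0 , tt

      sum-product : sumFin product ≡ 0ℤ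
      sum-product = orth Vz (W-neg Ww)

      -- `z` and `w` never overlap: either `z` vanishes, or `f` is the exceptional element and `w`
      -- vanishes.
      module Disjoint (products : ∀ x → product x ≡ 0ℤ) where
        explained : ∀ x → x ≢ f → Explained (does (x ≟ f)) (O₁ x) (O₂ x) (z x) (w x)
        explained x x≢f = explain x x≢f (products x)

        z-zero : - z f ∈ˢ F f → ∀ x → z x ≡ 0ℤ
        z-zero fit x = neg≡0 (freeV (λ x → - z x) (V-neg Vz) fits x)
          where
          fits : ∀ x → - z x ∈ˢ F x
          fits x with x ≟ f | explained x
          ... | yes refl | _ = fit
          ... | no x≢f | ex = explained-neg-z (b₁ x) (b₂ x) (ex x≢f)

        w-zero : w f ≡ 0ℤ → ∀ x → w x ≡ 0ℤ
        w-zero wf≡0 x = neg≡0 (freeW (λ x → - w x) (W-neg Ww) fits x)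
          where
          fits : ∀ x → - w x ∈ˢ G x
          fits x with x ≟ f | explained x
          ... | yes refl | _ = zero-∈ˢ (G f) (cong -_ wf≡0)
          ... | no x≢f | ex = explained-neg-w (b₁ x) (b₂ x) (ex x≢f)

        side : Side
        side with product-zero (z f) (w f) (products f)
        ... | inj₁ zf≡0 = inj₁ (z-zero (zero-∈ˢ (F f) (cong -_ zf≡0)))
        ... | inj₂ wf≡0 with O₁ f ≟ˢ O₂ f
        ...   | no O₁≢O₂ = inj₁ (z-zero (opposite-fits (b₁ f) (b₂ f) (O₁ f) (O₂ f) s (z f) O₁≢O₂ zf))
          where
          zf : z f ≡ δ (O₁ f) (O₂ f) + - sgn s
          zf = trans (+-zeroʳ (z f) wf≡0) at-f
        ...   | yes O₁≡O₂ = inj₂ (elementary freeV freeW Vz Ww f f explained O₁≡O₂ trit zf≢0 mode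
            , zf≢0 , vanish-outside freeV freeW Vz Ww f f explained O₁≡O₂ trit zf≢0 mode)
          where
          zf : z f ≡ - sgn s
          zf = trans (trans (+-zeroʳ (z f) wf≡0) at-f)
            (trans (cong (λ a → a + - sgn s) (trans (cong (λ o → δ (O₁ f) o) (sym O₁≡O₂)) (ℤP.+-inverseʳ (χ (O₁ f)))))
              (ℤP.+-identityˡ (- sgn s)))
          trit : IsTrit (z f)
          trit = subst IsTrit (sym zf) (trit-neg (sgn-trit s))
          zf≢0 : z f ≢ 0ℤ
          zf≢0 eq = sgn≢0 s (neg≡0 (trans (sym zf) eq))
          mode = inj₁ (refl , w-zero wf≡0)

      -- The overlap at `f` contributes -1 to the sum of the products, so the products elsewhere,
      -- all nonnegative, add up to one.
      module Crossing (zf : z f ≡ - sgn s) (wf : w f ≡ - sgn s) (O₁f : O₁ f ≡ s) (O₂f : O₂ f ≡ flipS s) where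
        product-f : product f ≡ -1ℤ
        product-f = trans (cong₂ (λ a b → a * - b) zf wf) (minus-one s)
          where
          minus-one : ∀ s → - sgn s * - - sgn s ≡ -1ℤ
          minus-one plus = refl
          minus-one minus = refl

        exceptional : ∃[ h ] (h ≢ f × product h ≢ 0ℤ)
        exceptional with any? (λ h → ¬? (h ≟ f) ×-dec ¬? (product h ℤP.≟ 0ℤ))
        ... | yes p = p
        ... | no none = contradiction
          (trans (sym product-f) (trans (sym (sum-single product f zeros)) sum-product)) λ ()
          where
          zeros : ∀ x → x ≢ f → product x ≡ 0ℤ
          zeros x x≢f with product x ℤP.≟ 0ℤ
          ... | yes eq = eq
          ... | no neq = contradiction (x , x≢f , neq) none

        nonneg : ∀ x → x ≢ f → 0ℤ ≤ product x
        nonneg x x≢f = product-near (z x) (w x) (δ-trit (O₁ x) (O₂ x)) (off-f x x≢f)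

        module _ (h : Fin n) (h≢f : h ≢ f) (ph≢0 : product h ≢ 0ℤ) where
          -- The products, raised by one at `f` and lowered by one at `h`: still nonnegative, since
          -- a nonzero nonnegative integer is at least one, and of total zero. So the product at `h`
          -- is one and all others off `f` vanish.
          balance : Fin n → ℤ
          balance x = product x + (arc f plus x + arc h minus x)

          balance-zero : ∀ x → balance x ≡ 0ℤ
          balance-zero = sum≡0⇒all≡0 balance positive (trans (sum-+ product (λ x → arc f plus x + arc h minus x))
            (cong₂ _+_ sum-product (trans (sum-+ (arc f plus) (arc h minus)) (cong₂ _+_ (sum-arc f plus) (sum-arc h minus)))))
            where
            positive : ∀ x → 0ℤ ≤ balance x
            positive x with x ≟ f | x ≟ h
            ... | yes refl | yes refl = contradiction refl h≢f
            ... | yes refl | no _ = subst (λ a → 0ℤ ≤ a + 1ℤ) (sym product-f) (+≤+ z≤n)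
            ... | no x≢f | no _ = subst (0ℤ ≤_) (sym (ℤP.+-identityʳ (product x))) (nonneg x x≢f)
            ... | no x≢f | yes refl = pred (product x) (nonneg x x≢f) ph≢0
              where
              pred : ∀ a → 0ℤ ≤ a → a ≢ 0ℤ → 0ℤ ≤ a + -1ℤ
              pred (+ zero) _ a≢0 = contradiction refl a≢0
              pred +[1+ _ ] _ _ = +≤+ z≤n

          product-h : product h ≡ 1ℤ
          product-h = ℤP.i-j≡0⇒i≡j (product h) 1ℤ
            (trans (cong (λ a → product h + a) (sym (cong₂ _+_ (arc-off f plus h h≢f) (arc-at h minus)))) (balance-zero h))

          product-other : ∀ x → x ≢ f → x ≢ h → product x ≡ 0ℤ
          product-other x x≢f x≢h = trans (sym (ℤP.+-identityʳ (product x)))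
            (trans (cong (λ a → product x + a) (sym (cong₂ _+_ (arc-off f plus x x≢f) (arc-off h minus x x≢h)))) (balance-zero x))

          explained : ∀ x → x ≢ h → Explained (does (x ≟ f)) (O₁ x) (O₂ x) (z x) (w x)
          explained x x≢h with x ≟ f | explain x
          ... | no x≢f | ex = ex x≢f (product-other x x≢f x≢h)
          ... | yes refl | _ = both , trans zf difference-f , trans wf difference-f , valid-f
            where
            arc-difference : ∀ s → - sgn s ≡ δ s (flipS s)
            arc-difference plus = refl
            arc-difference minus = refl
            difference-f : - sgn s ≡ δ (O₁ f) (O₂ f)
            difference-f = trans (arc-difference s) (sym (cong₂ δ O₁f O₂f))
            differ : ∀ s → T (not (s == flipS s))
            differ plus = tt
            differ minus = tt
            valid-f : T (not (O₁ f == O₂ f))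
            valid-f = subst₂ (λ a b → T (not (a == b))) (sym O₁f) (sym O₂f) (differ s)

          side-h : Side
          side-h with product≡1 (z h) (- w h) product-h
          ... | z≡-w , trit , zh≢0 = inj₂
              (elementary freeV freeW Vz Ww f h explained O₁≡O₂ trit zh≢0 mode
              , zf≢0 , vanish-outside freeV freeW Vz Ww f h explained O₁≡O₂ trit zh≢0 mode)
            where
            w≡-z : w h ≡ - z h
            w≡-z = trans (sym (ℤP.neg-involutive (w h))) (cong -_ (sym z≡-w))
            O₁≡O₂ : O₁ h ≡ O₂ h
            O₁≡O₂ = δ≡0⇒≡ (O₁ h) (O₂ h) (trans (sym (off-f h h≢f))
              (trans (cong (λ a → z h + a) w≡-z) (ℤP.+-inverseʳ (z h))))
            -sgn≢0 : - sgn s ≢ 0ℤ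
            -sgn≢0 = sgn≢0 s ∘ neg≡0
            zf≢0 : z f ≢ 0ℤ
            zf≢0 = -sgn≢0 ∘ trans (sym zf)
            apart : ∀ {o₁ o₂ a b} → o₁ ≡ s → o₂ ≡ flipS s → a ≡ - sgn s → b ≡ - sgn s →
              ∀ t → t ∈ˢ dual (hull true (b₁ f) (b₂ f) o₁ o₂ a) → t + - b ≢ 0ℤ
            apart refl refl refl refl = hull-apart (b₁ f) (b₂ f) s
            mode = inj₂ (w≡-z , h≢f , -sgn≢0 ∘ trans (sym wf) , apart O₁f O₂f zf wf)

        side : Side
        side with exceptional
        ... | h , h≢f , ph≢0 = side-h h h≢f ph≢0

    side : Side
    side with product-near-arc (O₁ f) (O₂ f) s (z f) (w f) at-f
    ... | inj₂ (zf , wf , O₁f , O₂f) = Crossing.side zf wf O₁f O₂f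
    ... | inj₁ pf = Disjoint.side (nonneg-orth R Vz (W-neg Ww) positive)
      where
      positive : ∀ x → 0ℤ ≤ product x
      positive x with x ≟ f
      ... | yes refl = pf
      ... | no x≢f = product-near (z x) (w x) (δ-trit (O₁ x) (O₂ x)) (off-f x x≢f)

-- Connectivity by circuits, and the case of equal orientations.

Common : ∀ {n} → (Vect n → Set) → Fin n → Fin n → Set
Common {n} U x y = Σ[ c ∈ Vect n ] Elementary U c × c x ≢ 0ℤ × c y ≢ 0ℤ

-- Keeps the part of a vector outside the support of another; the size of that part is the induction
-- measure for transitivity of connectivity.
only : (z a : ℤ) → ℤ
only z a = if nonzero? z then 0ℤ else a

only-zero : ∀ z {a} → z ≡ 0ℤ → only z a ≡ a
only-zero _ refl = refl

only-nonzero : ∀ z {a} → z ≢ 0ℤ → only z a ≡ 0ℤ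
only-nonzero (+ zero) z≢0 = contradiction refl z≢0
only-nonzero +[1+ _ ] _ = refl
only-nonzero -[1+ _ ] _ = refl

module _ {n} {V W : Vect n → Set} (R : RegularPair V W) where
  open RegularPair R

  elementary-neg : ∀ {c} → Elementary V c → Elementary V (λ x → - c x)
  elementary-neg {c} E = record
    { member = V-neg member
    ; simple = λ x → trit-neg (simple x)
    ; nonzero = proj₁ nonzero , proj₂ nonzero ∘ neg≡0
    ; minimal = λ Vv nz sub x vx≡0 → cong -_ (minimal Vv nz (λ y cy≡0 → sub y (cong -_ cy≡0)) x vx≡0)
    }
    where open Elementary E

  -- Paint at `x` with the support of `d` forbidden except at `y`. A resulting circuit meets `d` at
  -- most in `x` and `y`, so orthogonality puts `y` on it; a vector of `W` would lie inside `d` and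
  -- miss `y`, against minimality.
  cocircuit⇒circuit : ∀ {x y} → x ≢ y → Common W x y → Common V x y
  cocircuit⇒circuit {x} {y} x≢y (d , E , dx≢0 , dy≢0) = [ from-circuit , from-cocircuit ]′ (colour S x)
    where
    S : Fin n → Bool
    S t = does (t ≟ y) ∨ not (nonzero? (d t))
    S-y : T (S y)
    S-y rewrite dec-true (y ≟ y) refl = tt
    S-off : ∀ t → d t ≡ 0ℤ → T (S t)
    S-off t dt≡0 with t ≟ y | d t
    S-off t refl | yes _ | _ = tt
    S-off t refl | no _ | _ = tt
    S-on : ∀ t → t ≢ y → d t ≢ 0ℤ → T (not (S t))
    S-on t t≢y dt≢0 with t ≟ y | d t
    ... | yes t≡y | _ = contradiction t≡y t≢y
    ... | no _ | + zero = contradiction refl dt≢0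
    ... | no _ | +[1+ _ ] = tt
    ... | no _ | -[1+ _ ] = tt
    from-cocircuit : Solution W x (λ t → T (S t)) →
      Common V x y
    from-cocircuit (w , Ww , _ , wx , wz) = contradiction
      (Elementary.minimal E Ww (x , λ eq → 1≢0 (trans (sym wx) eq))
        (λ t dt≡0 → wz t (λ { refl → dx≢0 dt≡0 }) (S-off t dt≡0)) y (wz y (x≢y ∘ sym) S-y)) dy≢0
    from-circuit : Solution V x (λ t → T (not (S t))) →
      Common V x y
    from-circuit (v , Vv , _ , vx , vz)
      with elementary-through R {v} {x} Vv (λ eq → 1≢0 (trans (sym vx) eq))
    ... | c , C , cx≢0 , conf = c , C , cx≢0 , λ cy≡0 → dx≢0 (i*j≡0⇒j≡0 (c x) (d x) cx≢0
        (trans (sym (sum-single (λ t → c t * d t) x (zeros cy≡0)))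
               (orth (Elementary.member C) (Elementary.member E))))
      where
      zeros : c y ≡ 0ℤ → ∀ t → t ≢ x → c t * d t ≡ 0ℤ
      zeros cy≡0 t t≢x with d t ℤP.≟ 0ℤ | t ≟ y
      ... | yes dt≡0 | _ = trans (cong (c t *_) dt≡0) (ℤP.*-zeroʳ (c t))
      ... | no _ | yes refl = cong (_* d t) cy≡0
      ... | no dt≢0 | no t≢y = cong (_* d t)
        (∈-signsOf-zero (c t) (conf t) (vz t t≢x (S-on t t≢y dt≢0)))

  -- If u and v agree at x, a circuit c through e conformal to u − v either contains f, or is
  -- smaller than u off v, or differs from u − v by a vector supported in v and vanishing at x.
  private
    join : ∀ {e f u v} x k → size (λ y → only (v y) (u y)) ℕ.< k →
      Elementary V u → u e ≢ 0ℤ → u x ≢ 0ℤ → Elementary V v → v f ≢ 0ℤ → v x ≢ 0ℤ → Common V e f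

    join-aligned : ∀ {e f u v} x k → size (λ y → only (v y) (u y)) ℕ.< k →
      Elementary V u → u e ≢ 0ℤ → u x ≢ 0ℤ → Elementary V v → v f ≢ 0ℤ → v x ≢ 0ℤ →
      u f ≡ 0ℤ → v e ≡ 0ℤ → u x ≡ v x → Common V e f

    join {e} {f} {u} {v} x k lt U ue≢0 ux≢0 V′ vf≢0 vx≢0 with u f ℤP.≟ 0ℤ | v e ℤP.≟ 0ℤ
    ... | no uf≢0 | _ = u , U , ue≢0 , uf≢0
    ... | yes _ | no ve≢0 = v , V′ , ve≢0 , vf≢0
    ... | yes uf≡0 | yes ve≡0
      with trit-same-or-opposite (Elementary.simple U x) (Elementary.simple V′ x) ux≢0 vx≢0
    ...   | inj₁ eq = join-aligned x k lt U ue≢0 ux≢0 V′ vf≢0 vx≢0 uf≡0 ve≡0 eq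
    ...   | inj₂ eq = join-aligned {u = λ y → - u y} x k
              (subst (ℕ._< k) (sym (size-neg u v)) lt)
              (elementary-neg U) (ue≢0 ∘ neg≡0) (ux≢0 ∘ neg≡0) V′ vf≢0 vx≢0 (cong -_ uf≡0) ve≡0 eq
      where
      bit-neg : ∀ z a → bit (only z (- a)) ≡ bit (only z a)
      bit-neg (+ zero) (+ zero) = refl
      bit-neg (+ zero) +[1+ _ ] = refl
      bit-neg (+ zero) -[1+ _ ] = refl
      bit-neg +[1+ _ ] a = refl
      bit-neg -[1+ _ ] a = refl
      size-neg : ∀ {m} (u v : Vect m) →
        size (λ y → only (v y) (- u y)) ≡ size (λ y → only (v y) (u y))
      size-neg {zero} u v = refl
      size-neg {suc m} u v = cong₂ ℕ._+_ (bit-neg (v zero) (u zero)) (size-neg (u ∘ suc) (v ∘ suc))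

    join-aligned {e} {f} {u} {v} x (suc k) (s≤s le) U ue≢0 ux≢0 V′ vf≢0 vx≢0 uf≡0 ve≡0 ux≡vx
      with elementary-through R {λ y → u y + - v y} {e} Vd de≢0
      where
      Vd : V (λ y → u y + - v y)
      Vd = V-+ (Elementary.member U) (V-neg (Elementary.member V′))
      de≢0 : u e + - v e ≢ 0ℤ
      de≢0 eq = ue≢0 (trans (sym (ℤP.+-identityʳ (u e))) (trans (cong (λ a → u e + - a) (sym ve≡0)) eq))
    ... | c , C , ce≢0 , conf with c f ℤP.≟ 0ℤ
    ...   | no cf≢0 = c , C , ce≢0 , cf≢0
    ...   | yes cf≡0
      with any? (λ y → ¬? (v y ℤP.≟ 0ℤ) ×-dec ¬? (c y ℤP.≟ 0ℤ))
         | any? (λ y → ¬? (u y ℤP.≟ 0ℤ) ×-dec ((v y ℤP.≟ 0ℤ) ×-dec (c y ℤP.≟ 0ℤ)))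
    -- If `c` misses the support of `v`, it lies inside that of `u`, yet it vanishes at `x`, where
    -- `u` and `v` agree.
    ...     | no disjoint | _ = contradiction
      (Elementary.minimal U (Elementary.member C) (e , ce≢0) sub x cx≡0) ux≢0
      where
      cx≡0 : c x ≡ 0ℤ
      cx≡0 = ∈-signsOf-zero (c x) (conf x) (trans (cong (λ a → a + - v x) ux≡vx) (ℤP.+-inverseʳ (v x)))
      sub : ∀ y → u y ≡ 0ℤ → c y ≡ 0ℤ
      sub y uy≡0 with v y ℤP.≟ 0ℤ | c y ℤP.≟ 0ℤ
      ... | _ | yes cy≡0 = cy≡0
      ... | no vy≢0 | no cy≢0 = contradiction (y , vy≢0 , cy≢0) disjoint
      ... | yes vy≡0 | no cy≢0 = ∈-signsOf-zero (c y) (conf y) (cong₂ (λ a b → a + - b) uy≡0 vy≡0)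
    -- `y` is the new common element of `c` and `v`; the element `t` of `u` outside `v`, absent from
    -- `c`, lowers the measure.
    ...     | yes (y , vy≢0 , cy≢0) | yes (t , ut≢0 , vt≡0 , ct≡0) =
      join y k (ℕP.<-≤-trans (size-strict (λ k → only (v k) (c k)) (λ k → only (v k) (u k)) sub t
        (trans (only-zero (v t) vt≡0) ct≡0) (ut≢0 ∘ trans (sym (only-zero (v t) vt≡0)))) le)
        C ce≢0 cy≢0 V′ vf≢0 vy≢0
      where
      sub : ∀ k → only (v k) (u k) ≡ 0ℤ → only (v k) (c k) ≡ 0ℤ
      sub k eq with v k ℤP.≟ 0ℤ
      ... | no vk≢0 = only-nonzero (v k) vk≢0
      ... | yes vk≡0 = trans (only-zero (v k) vk≡0) (∈-signsOf-zero (c k) (conf k)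
        (cong₂ (λ a b → a + - b) (trans (sym (only-zero (v k) vk≡0)) eq) vk≡0))
    ...     | yes _ | no covered = contradiction
      (Elementary.minimal V′ {λ y → (u y + - v y) + - c y}
        (V-+ (V-+ (Elementary.member U) (V-neg (Elementary.member V′))) (V-neg (Elementary.member C)))
        (f , rf≢0) sub x rx≡0) vx≢0
      where
      dx≡0 : u x + - v x ≡ 0ℤ
      dx≡0 = trans (cong (λ a → a + - v x) ux≡vx) (ℤP.+-inverseʳ (v x))
      rx≡0 : (u x + - v x) + - c x ≡ 0ℤ
      rx≡0 = cong₂ (λ a b → a + - b) dx≡0 (∈-signsOf-zero (c x) (conf x) dx≡0)
      rf≢0 : (u f + - v f) + - c f ≢ 0ℤ
      rf≢0 eq = vf≢0 (neg≡0 (trans (identity (v f)) (trans (cong₂ (λ a b → (a + - v f) + - b) (sym uf≡0) (sym cf≡0)) eq)))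
        where
        identity : ∀ a → - a ≡ (0ℤ + - a) + - 0ℤ
        identity = solve-∀
      sub : ∀ y → v y ≡ 0ℤ → (u y + - v y) + - c y ≡ 0ℤ
      sub y vy≡0 with u y ℤP.≟ 0ℤ | c y ℤP.≟ 0ℤ
      ... | yes uy≡0 | _ = cong₂ (λ a b → a + - b) dy≡0 (∈-signsOf-zero (c y) (conf y) dy≡0)
        where
        dy≡0 : u y + - v y ≡ 0ℤ
        dy≡0 = cong₂ (λ a b → a + - b) uy≡0 vy≡0
      ... | no uy≢0 | yes cy≡0 = contradiction (y , uy≢0 , vy≡0 , cy≡0) covered
      ... | no _ | no cy≢0 = trans (cong (λ a → a + - c y) (trans dy≡uy (sym cy≡uy))) (ℤP.+-inverseʳ (c y))
        where
        dy≡uy : u y + - v y ≡ u y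
        dy≡uy = trans (cong (λ a → u y + - a) vy≡0) (ℤP.+-identityʳ (u y))
        cy≡uy : c y ≡ u y
        cy≡uy = trit-conformal-≡ (Elementary.simple U y) (Elementary.simple C y) cy≢0
          (subst (λ a → c y ∈ˢ signsOf a) dy≡uy (conf y))

  common-trans : ∀ {e x f} → Common V e x → Common V x f → Common V e f
  common-trans {x = x} (u , U , ue≢0 , ux≢0) (v , V′ , vx≢0 , vf≢0) =
    join x _ ℕP.≤-refl U ue≢0 ux≢0 V′ vf≢0 vx≢0

  -- Serves the case of equal bases. Here `z + w` is minus the arc, so every product `z x * - w x`
  -- is nonnegative, hence zero; off `f` the two vectors then vanish together.
  same-orientation : ∀ {O₁ O₂ : Fin n → Sign} (f : Fin n) (s : Sign) {z w : Vect n} → V z → W w →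
    (∀ x → δ (O₁ x) (O₂ x) ≡ z x + w x + arc f s x) → (∀ x → O₁ x ≡ O₂ x) →
    ∀ x → x ≢ f → z x ≡ 0ℤ × w x ≡ 0ℤ
  same-orientation {O₁} {O₂} f s {z} {w} Vz Ww difference same x x≢f =
    [ (λ z≡0 → z≡0 , trans (sym (ℤP.+-identityˡ (w x))) (trans (cong (λ a → a + w x) (sym z≡0)) sum-x))
    , (λ w≡0 → trans (sym (ℤP.+-identityʳ (z x))) (trans (cong (λ a → z x + a) (sym w≡0)) sum-x) , w≡0)
    ]′ (product-zero (z x) (w x) (nonneg-orth R Vz (W-neg Ww) positive x))
    where
    total : ∀ y → z y + w y ≡ 0ℤ + - arc f s y
    total y = trans (cancel (z y + w y) (arc f s y)) (cong (λ a → a + - arc f s y)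
      (trans (sym (difference y)) (trans (cong (δ (O₁ y)) (sym (same y))) (ℤP.+-inverseʳ (χ (O₁ y))))))
      where
      cancel : ∀ a b → a ≡ a + b + - b
      cancel = solve-∀
    off-f : ∀ y → y ≢ f → z y + w y ≡ 0ℤ
    off-f y y≢f = trans (total y) (cong (λ a → 0ℤ + - a) (arc-off f s y y≢f))
    sum-x : z x + w x ≡ 0ℤ
    sum-x = off-f x x≢f
    positive : ∀ y → 0ℤ ≤ z y * - w y
    positive y with y ≟ f
    ... | no y≢f = product-near (z y) (w y) (inj₂ (inj₁ refl)) (off-f y y≢f)
    ... | yes refl = product-near (z f) (w f) (subst IsTrit (sym value) (trit-neg (sgn-trit s))) refl
      where
      value : z f + w f ≡ - sgn s
      value = trans (total f) (trans (cong (λ a → 0ℤ + - a) (arc-at f s)) (ℤP.+-identityˡ (- sgn s)))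

-- Complementing the bases twice returns the first fourientation, so the analysis can be reused with
-- `V` and `W` exchanged.
Free-swap : ∀ {n} {U : Vect n → Set} (b₁ b₂ : Fin n → Bool) (O₁ O₂ : Fin n → Sign) →
  Free U (λ x → opposed (b₁ x) (b₂ x) (O₁ x) (O₂ x)) →
  Free U (λ x → opposed (not (not (b₁ x))) (not (not (b₂ x))) (O₁ x) (O₂ x))
Free-swap b₁ b₂ O₁ O₂ free u Uu fits = free u Uu λ x → subst₂
  (λ c₁ c₂ → u x ∈ˢ opposed c₁ c₂ (O₁ x) (O₂ x)) (𝔹.not-involutive (b₁ x)) (𝔹.not-involutive (b₂ x)) (fits x)

-- Conclusions for both vectors and for disconnected elements.

module Consistency {n} {V W : Vect n → Set} (R : RegularPair V W)
  (b₁ b₂ : Fin n → Bool) (O₁ O₂ : Fin n → Sign) where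
  open RegularPair R
  open Exceptional R b₁ b₂ O₁ O₂ using (F; G)

  module _ (freeV : Free V F) (freeW : Free W G) (f : Fin n) (s : Sign)
    {z w : Vect n} (Vz : V z) (Ww : W w)
    (difference : ∀ x → δ (O₁ x) (O₂ x) ≡ z x + w x + arc f s x)
    where

    private
      side-z = Analysis.side R b₁ b₂ O₁ O₂ freeV freeW f s Vz Ww difference
      side-w = Analysis.side (swap R) (not ∘ b₁) (not ∘ b₂) O₁ O₂ freeW (Free-swap b₁ b₂ O₁ O₂ freeV) f s Ww Vz
        (λ x → trans (difference x) (cong (λ a → a + arc f s x) (ℤP.+-comm (z x) (w x))))

    z-vanishes : ∀ e → b₁ e ≡ false → b₂ e ≡ false → e ≢ f → z e ≡ 0ℤ
    z-vanishes e b₁e b₂e e≢f = [ (λ z≡0 → z≡0 e) , (λ (_ , _ , vanish) → vanish e b₁e b₂e e≢f) ]′ side-z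

    w-vanishes : ∀ e → b₁ e ≡ true → b₂ e ≡ true → e ≢ f → w e ≡ 0ℤ
    w-vanishes e b₁e b₂e e≢f =
      [ (λ w≡0 → w≡0 e) , (λ (_ , _ , vanish) → vanish e (cong not b₁e) (cong not b₂e) e≢f) ]′ side-w

    -- A difference off `f` comes from `z` or `w`, and whichever is nonzero is a signed circuit or
    -- cocircuit through `f`.
    differ⇒common : ∀ x → x ≢ f → O₁ x ≢ O₂ x → Common V x f
    differ⇒common x x≢f O₁≢O₂ with z x ℤP.≟ 0ℤ | w x ℤP.≟ 0ℤ
    ... | no zx≢0 | _ = [ (λ z≡0 → contradiction (z≡0 x) zx≢0) , (λ (E , zf≢0 , _) → z , E , zx≢0 , zf≢0) ]′ side-z
    ... | yes _ | no wx≢0 = cocircuit⇒circuit R x≢f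
      ([ (λ w≡0 → contradiction (w≡0 x) wx≢0) , (λ (E , wf≢0 , _) → w , E , wx≢0 , wf≢0) ]′ side-w)
    ... | yes zx≡0 | yes wx≡0 = contradiction (δ≡0⇒≡ (O₁ x) (O₂ x) (trans (difference x)
      (cong₂ _+_ (cong₂ _+_ zx≡0 wx≡0) (arc-off f s x x≢f)))) O₁≢O₂

    disconnected⇒same : ∀ e → e ≢ f → ¬ Common V e f → b₁ e ≡ b₂ e
    disconnected⇒same e e≢f ¬common with b₁ e 𝔹.≟ b₂ e
    ... | yes eq = eq
    ... | no b₁≢b₂ = ⊥-elim (separate (allowed-sign (b₁ e) (b₂ e) (O₁ e) (O₂ e) b₁≢b₂))
      where
      allowed-sign : ∀ b₁ b₂ o₁ o₂ → b₁ ≢ b₂ → ∃[ t ] T (opposed b₁ b₂ o₁ o₂ t)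
      allowed-sign true true _ _ b≢b = contradiction refl b≢b
      allowed-sign false false _ _ b≢b = contradiction refl b≢b
      allowed-sign true false _ plus _ = minus , tt
      allowed-sign true false _ minus _ = plus , tt
      allowed-sign false true plus _ _ = plus , tt
      allowed-sign false true minus _ _ = minus , tt
      self-dual : ∀ b₁ b₂ o₁ o₂ t → b₁ ≢ b₂ → o₁ ≡ o₂ → T (opposed b₁ b₂ o₁ o₂ t) →
        sgn t ∈ˢ dual (opposed b₁ b₂ o₁ o₂)
      self-dual true true _ _ _ b≢b _ _ = contradiction refl b≢b
      self-dual false false _ _ _ b≢b _ _ = contradiction refl b≢b
      self-dual true false plus plus minus _ refl _ = tt
      self-dual true false minus minus plus _ refl _ = tt
      self-dual false true plus plus plus _ refl _ = tt
      self-dual false true minus minus minus _ refl _ = tt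
      reversed : ∀ b₁ b₂ o₁ o₂ a → o₁ ≡ o₂ → a ∈ˢ dual (opposed b₁ b₂ o₁ o₂) →
        - a ∈ˢ opposed (not b₁) (not b₂) o₁ o₂
      reversed _ _ _ _ (+ zero) _ _ = tt
      reversed true true _ _ +[1+ _ ] _ ()
      reversed true true _ _ -[1+ _ ] _ ()
      reversed false false _ _ +[1+ _ ] _ _ = tt
      reversed false false _ _ -[1+ _ ] _ _ = tt
      reversed true false plus .plus -[1+ _ ] refl _ = tt
      reversed true false minus .minus +[1+ _ ] refl _ = tt
      reversed false true plus .plus +[1+ _ ] refl _ = tt
      reversed false true minus .minus -[1+ _ ] refl _ = tt
      separate : ∃[ t ] T (F e t) → ⊥
      separate (t , Ft) with paint R F e t
      ... | inj₁ (v , Vv , _ , ve , ok) = sgn≢0 t (trans (sym ve) (freeV v Vv fits e))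
        where
        fits : ∀ x → v x ∈ˢ F x
        fits x with x ≟ e
        ... | yes refl = subst (_∈ˢ F e) (sym ve) (sgn-∈ t {F e} Ft)
        ... | no x≢e = ok x x≢e
      ... | inj₂ (d , Wd , _ , de , ok)
        -- Connectivity is read off support-minimal vectors, so `d` is replaced by a conformal
        -- cocircuit through `e`.
        with elementary-through (swap R) {d} {e} Wd (sgn≢0 t ∘ trans (sym de))
      ...   | c , C , ce≢0 , conf =
        ce≢0 (neg≡0 (freeW (λ x → - c x) (W-neg (Elementary.member C)) fits e))
        where
        agreed : ∀ x → c x ≢ 0ℤ → O₁ x ≡ O₂ x
        agreed x cx≢0 with O₁ x ≟ˢ O₂ x | x ≟ f | e ≟ x
        ... | yes eq | _ | _ = eq
        ... | no _ | yes refl | _ = contradiction (cocircuit⇒circuit R e≢f (c , C , ce≢0 , cx≢0)) ¬common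
        ... | no O₁≢O₂ | no x≢f | yes refl = contradiction (differ⇒common x x≢f O₁≢O₂) ¬common
        ... | no O₁≢O₂ | no x≢f | no e≢x = contradiction
          (common-trans R (cocircuit⇒circuit R e≢x (c , C , ce≢0 , cx≢0)) (differ⇒common x x≢f O₁≢O₂)) ¬common
        -- Painting leaves `e` itself unconstrained; there the chosen sign lies in the dual
        -- colouring because exactly one basis contains `e` and the orientations agree.
        in-dual : ∀ x → O₁ x ≡ O₂ x → d x ∈ˢ dual (F x)
        in-dual x O₁≡O₂ with x ≟ e
        ... | yes refl = subst (_∈ˢ dual (F e)) (sym de)
          (self-dual (b₁ e) (b₂ e) (O₁ e) (O₂ e) t b₁≢b₂ O₁≡O₂ Ft)
        ... | no x≢e = ok x x≢e
        fits : ∀ x → - c x ∈ˢ G x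
        fits x with c x ℤP.≟ 0ℤ
        ... | yes cx≡0 = zero-∈ˢ (G x) (cong -_ cx≡0)
        ... | no cx≢0 = reversed (b₁ x) (b₂ x) (O₁ x) (O₂ x) (c x) (agreed x cx≢0)
          (∈-signsOf-trans (c x) (d x) {dual (F x)} (conf x) (in-dual x (agreed x cx≢0)))

-- Deletion for pairs, and dually contraction.

clear : ∀ {n} → Fin n → Vect n → Vect n
clear e w x = if does (x ≟ e) then 0ℤ else w x

clear-off : ∀ {n} (e : Fin n) w x → x ≢ e → clear e w x ≡ w x
clear-off e w x x≢e rewrite dec-false (x ≟ e) x≢e = refl

clear-at : ∀ {n} (e : Fin n) w → clear e w e ≡ 0ℤ
clear-at e w rewrite dec-true (e ≟ e) refl = refl

module _ {n} {V W : Vect n → Set} (R : RegularPair V W) (e : Fin n) where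
  open RegularPair R

  data DeletionV (v : Vect n) : Set where
    at-zero : V v → v e ≡ 0ℤ → DeletionV v

  -- The value at `e` is left free, so the arc of `e` belongs here. With `swap R` for `R`, the two
  -- groups describe contraction.
  DeletionW : Vect n → Set
  DeletionW w = Σ[ u ∈ Vect n ] W u × (∀ x → x ≢ e → w x ≡ u x)

  -- The element e is kept as a coloop, so that vectors are still indexed by all of Fin n.
  deletion-pair : RegularPair DeletionV DeletionW
  deletion-pair = record
    { V-0 = at-zero V-0 refl
    ; V-ext = λ { eq (at-zero Vu ue) → at-zero (V-ext eq Vu) (trans (sym (eq e)) ue) }
    ; V-+ = λ { (at-zero Vu ue) (at-zero Vv ve) → at-zero (V-+ Vu Vv) (cong₂ _+_ ue ve) }
    ; V-neg = λ { (at-zero Vv ve) → at-zero (V-neg Vv) (cong -_ ve) }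
    ; W-0 = (λ _ → 0ℤ) , W-0 , λ _ _ → refl
    ; W-ext = λ eq (t , Wt , off) → t , Wt , λ x x≢e → trans (sym (eq x)) (off x x≢e)
    ; W-+ = λ (t , Wt , off) (t′ , Wt′ , off′) →
        (λ x → t x + t′ x) , W-+ Wt Wt′ , λ x x≢e → cong₂ _+_ (off x x≢e) (off′ x x≢e)
    ; W-neg = λ (t , Wt , off) → (λ x → - t x) , W-neg Wt , λ x x≢e → cong -_ (off x x≢e)
    ; orth = λ { {v} {w} (at-zero Vv ve) (t , Wt , off) →
        trans (sum-cong (replace {v} {w} {t} ve off)) (orth Vv Wt) }
    ; colour = colour′
    }
    where
    replace : ∀ {v w t : Vect n} → v e ≡ 0ℤ → (∀ x → x ≢ e → w x ≡ t x) → ∀ x → v x * w x ≡ v x * t x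
    replace {v} {w} {t} ve off x with x ≟ e
    ... | yes refl = trans (cong (_* w x) ve) (sym (cong (_* t x) ve))
    ... | no x≢e = cong (v x *_) (off x x≢e)
    colour′ : ∀ (S : Fin n → Bool) g →
      Solution DeletionV g (λ x → T (not (S x))) ⊎
      Solution DeletionW g (λ x → T (S x))
    colour′ S g with g ≟ e
    ... | yes refl = inj₂ (arc e plus , ((λ _ → 0ℤ) , W-0 , arc-off e plus) , simple , arc-at e plus
          , λ x x≢e _ → arc-off e plus x x≢e)
      where
      simple : Simple (arc e plus)
      simple x with x ≟ e
      ... | yes _ = inj₂ (inj₂ refl)
      ... | no _ = inj₂ (inj₁ refl)
    ... | no g≢e = Sum.map
        (λ (v , Vv , sv , vg , vz) → v , at-zero Vv (vz e (g≢e ∘ sym) excluded) , sv , vg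
          , λ x x≢g ¬S → vz x x≢g (narrower x ¬S))
        (λ (w , Ww , sw , wg , wz) → clear e w , (w , Ww , clear-off e w) , clear-simple sw
          , trans (clear-off e w g g≢e) wg , λ x x≢g Sx → clear-zero w x (λ x≢e → wz x x≢g (kept x x≢e Sx)))
        (colour S′ g)
      where
      -- Taking `e` out of the colour class forces a solution in `V` to vanish at `e`; a solution in
      -- `W` may be nonzero there and is cleared.
      S′ : Fin n → Bool
      S′ x = not (does (x ≟ e)) ∧ S x
      excluded : T (not (S′ e))
      excluded rewrite dec-true (e ≟ e) refl = tt
      narrower : ∀ x → T (not (S x)) → T (not (S′ x))
      narrower x ¬S with x ≟ e
      ... | yes _ = tt
      ... | no _ = ¬S
      kept : ∀ x → x ≢ e → T (S x) → T (S′ x)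
      kept x x≢e Sx rewrite dec-false (x ≟ e) x≢e = Sx
      clear-simple : ∀ {w} → Simple w → Simple (clear e w)
      clear-simple sw x with x ≟ e
      ... | yes _ = inj₂ (inj₁ refl)
      ... | no _ = sw x
      clear-zero : ∀ w x → (x ≢ e → w x ≡ 0ℤ) → clear e w x ≡ 0ℤ
      clear-zero w x wz with x ≟ e
      ... | yes _ = refl
      ... | no x≢e = wz x≢e

-- Circuit-cocircuit equivalence as congruence modulo `V + W`.

reversed-sign : ∀ {n} (c : Vect n) (o : Orientation n) x →
  lookup (rev (tabulate c) o) x ≡ (if isZero (c x) then lookup o x else flipS (lookup o x))
reversed-sign c o x = trans (lookup∘tabulate _ x)
  (cong (λ a → if isZero a then lookup o x else flipS (lookup o x)) (lookup∘tabulate c x))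

reversed-at-zero : ∀ {n} (c : Vect n) (o : Orientation n) x → c x ≡ 0ℤ → lookup (rev (tabulate c) o) x ≡ lookup o x
reversed-at-zero c o x cx≡0 = trans (reversed-sign c o x)
  (cong (λ a → if isZero a then lookup o x else flipS (lookup o x)) cx≡0)

reversed-at-nonzero : ∀ {n} (c : Vect n) (o : Orientation n) x → c x ≢ 0ℤ →
  lookup (rev (tabulate c) o) x ≡ flipS (lookup o x)
reversed-at-nonzero c o x cx≢0 with c x | reversed-sign c o x
... | + zero | _ = contradiction refl cx≢0
... | +[1+ _ ] | eq = eq
... | -[1+ _ ] | eq = eq

δ-nonzero⇒flip : ∀ o₁ o₂ {a} → a ∈ˢ signsOf (δ o₁ o₂) → a ≢ 0ℤ → flipS o₂ ≡ o₁
δ-nonzero⇒flip plus plus {a} a∈ a≢0 = contradiction (∈-signsOf-zero a a∈ refl) a≢0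
δ-nonzero⇒flip minus minus {a} a∈ a≢0 = contradiction (∈-signsOf-zero a a∈ refl) a≢0
δ-nonzero⇒flip plus minus _ _ = refl
δ-nonzero⇒flip minus plus _ _ = refl

δ-sign : ∀ o₁ o₂ {a} s → a ∈ˢ signsOf (δ o₁ o₂) → SignIs a s → o₂ ≡ s
δ-sign o₁ plus plus _ _ = refl
δ-sign o₁ minus minus _ _ = refl
δ-sign plus minus {+ zero} plus _ (+<+ ())
δ-sign plus minus {+[1+ _ ]} plus () _
δ-sign minus minus {+ zero} plus _ (+<+ ())
δ-sign minus minus {+[1+ _ ]} plus () _
δ-sign plus plus {+ zero} minus _ (+<+ ())
δ-sign minus plus {+ zero} minus _ (+<+ ())
δ-sign plus plus { -[1+ _ ]} minus () _
δ-sign minus plus { -[1+ _ ]} minus () _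

δ-self : ∀ o → δ o o ≡ 0ℤ
δ-self plus = refl
δ-self minus = refl

χ-rev1 : ∀ {n} (f : Fin n) s (o : Orientation n) → lookup o f ≡ flipS s → ∀ x →
  χ (lookup (rev1 f o) x) ≡ χ (lookup o x) + arc f s x
χ-rev1 f s o of x with x ≟ f
... | yes refl = trans (cong χ (lookup∘update f o (flipS (lookup o f))))
  (trans (cong (χ ∘ flipS) of) (trans (step s) (cong (λ a → χ a + sgn s) (sym of))))
  where
  step : ∀ s → χ (flipS (flipS s)) ≡ χ (flipS s) + sgn s
  step plus = refl
  step minus = refl
... | no x≢f = trans (cong χ (lookup∘update′ x≢f o (flipS (lookup o f))))
  (sym (ℤP.+-identityʳ (χ (lookup o x))))

-- `Dead` marks the elements outside the ground set, where a vector has to vanish before moves of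
-- the minor can realise it.
module Moves {n} (N : SMat n) (Dead : Fin n → Set) where

  Alive : Vect n → Set
  Alive v = ∀ x → Dead x → v x ≡ 0ℤ

  Reversible : (Vect n → Set) → Set
  Reversible U = ∀ c → Elementary U c → Alive c → SC N (tabulate c) ⊎ SCo N (tabulate c)

  -- Peel off an elementary vector conformal to `u`: it is compatible with `p`, and as `u` has
  -- entries -1, 0, 1, reversing it subtracts exactly this vector from `u` and shrinks the support.
  flips : ∀ {U U′ : Vect n → Set} → RegularPair U U′ → Reversible U →
    ∀ k (u : Vect n) (p q : Orientation n) → size u ℕ.< k → U u → Alive u →
    (∀ x → u x ≡ δ (lookup q x) (lookup p x)) → Equiv N p q
  flips R moves (suc k) u p q (s≤s le) Uu alive eq with zero-or-not u
  ... | inj₂ zeros = agree λ x _ → sym (δ≡0⇒≡ (lookup q x) (lookup p x) (trans (sym (eq x)) (zeros x)))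
  ... | inj₁ (g , ug≢0) with elementary-through R {u} {g} Uu ug≢0
  ...   | c , C , cg≢0 , conf = Equiv.trans
      (move (tabulate c) (moves c C (λ x dead → ∈-signsOf-zero (c x) (conf x) (alive x dead))) compatible)
      (flips R moves k (λ x → u x + - c x) (rev (tabulate c) p) q
        (ℕP.<-≤-trans (size-strict (λ x → u x + - c x) u sub g (rest-nonzero g cg≢0) ug≢0) le)
        (V-+ Uu (V-neg (Elementary.member C)))
        (λ x dead → sub x (alive x dead)) eq′)
    where
    open RegularPair R
    conf-δ : ∀ x → c x ∈ˢ signsOf (δ (lookup q x) (lookup p x))
    conf-δ x = subst (λ a → c x ∈ˢ signsOf a) (eq x) (conf x)
    compatible : Compat (tabulate c) p
    compatible x s is = δ-sign (lookup q x) (lookup p x) {c x} s (conf-δ x)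
      (subst (λ a → SignIs a s) (lookup∘tabulate c x) is)
    c≡u : ∀ x → c x ≢ 0ℤ → c x ≡ u x
    c≡u x cx≢0 = trit-conformal-≡ (subst IsTrit (sym (eq x)) (δ-trit (lookup q x) (lookup p x)))
      (Elementary.simple C x) cx≢0 (conf x)
    rest-nonzero : ∀ x → c x ≢ 0ℤ → u x + - c x ≡ 0ℤ
    rest-nonzero x cx≢0 = trans (cong (λ a → u x + - a) (c≡u x cx≢0)) (ℤP.+-inverseʳ (u x))
    sub : ∀ x → u x ≡ 0ℤ → u x + - c x ≡ 0ℤ
    sub x ux≡0 = cong₂ (λ a b → a + - b) ux≡0 (∈-signsOf-zero (c x) (conf x) ux≡0)
    eq′ : ∀ x → u x + - c x ≡ δ (lookup q x) (lookup (rev (tabulate c) p) x)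
    eq′ x with c x ℤP.≟ 0ℤ
    ... | yes cx≡0 = trans (trans (cong (λ a → u x + - a) cx≡0) (ℤP.+-identityʳ (u x)))
      (trans (eq x) (cong (δ (lookup q x)) (sym (reversed-at-zero c p x cx≡0))))
    ... | no cx≢0 = trans (rest-nonzero x cx≢0) (sym (trans (cong (δ (lookup q x))
      (trans (reversed-at-nonzero c p x cx≢0) (δ-nonzero⇒flip (lookup q x) (lookup p x) {c x} (conf-δ x) cx≢0)))
      (δ-self (lookup q x))))

  module _ {V W : Vect n → Set} (R : RegularPair V W) (movesV : Reversible V) (movesW : Reversible W) where
    open RegularPair R

    -- Orthogonality makes the supports of `z` and `w` disjoint, so the two reversals can be done
    -- one after the other, through the orientation equal to `q` on the support of `z` and to `p`
    -- elsewhere.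
    congruent⇒equiv : ∀ (p q : Orientation n) {z w : Vect n} → V z → W w → Alive z → Alive w →
      (∀ x → δ (lookup q x) (lookup p x) ≡ z x + w x) → Equiv N p q
    congruent⇒equiv p q {z} {w} Vz Ww alive-z alive-w eq = Equiv.trans
      (flips R movesV _ z p m ℕP.≤-refl Vz alive-z eq-z)
      (flips (swap R) movesW _ w m q ℕP.≤-refl Ww alive-w eq-w)
      where
      mid : Fin n → Sign
      mid x = if isZero (z x) then lookup p x else lookup q x
      m : Orientation n
      m = tabulate mid
      disjoint : ∀ x → z x ≡ 0ℤ ⊎ w x ≡ 0ℤ
      disjoint x = product-zero (z x) (w x) (nonneg-orth R Vz (W-neg Ww)
        (λ y → product-near (z y) (w y) (δ-trit (lookup q y) (lookup p y)) (sym (eq y))) x)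
      eqs : ∀ o₁ o₂ a b → a ≡ 0ℤ ⊎ b ≡ 0ℤ → δ o₁ o₂ ≡ a + b →
        a ≡ δ (if isZero a then o₂ else o₁) o₂ × b ≡ δ o₁ (if isZero a then o₂ else o₁)
      eqs o₁ o₂ (+ zero) b _ eq = sym (δ-self o₂) , trans (sym (ℤP.+-identityˡ b)) (sym eq)
      eqs o₁ o₂ a@(+[1+ _ ]) .0ℤ (inj₂ refl) eq = trans (sym (ℤP.+-identityʳ a)) (sym eq) , sym (δ-self o₁)
      eqs o₁ o₂ a@(-[1+ _ ]) .0ℤ (inj₂ refl) eq = trans (sym (ℤP.+-identityʳ a)) (sym eq) , sym (δ-self o₁)
      both-eqs : ∀ x → z x ≡ δ (mid x) (lookup p x) × w x ≡ δ (lookup q x) (mid x)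
      both-eqs x = eqs (lookup q x) (lookup p x) (z x) (w x) (disjoint x) (eq x)
      eq-z : ∀ x → z x ≡ δ (lookup m x) (lookup p x)
      eq-z x = trans (proj₁ (both-eqs x)) (cong (λ o → δ o (lookup p x)) (sym (lookup∘tabulate mid x)))
      eq-w : ∀ x → w x ≡ δ (lookup q x) (lookup m x)
      eq-w x = trans (proj₂ (both-eqs x)) (cong (δ (lookup q x)) (sym (lookup∘tabulate mid x)))

    module _ (f : Fin n) (s : Sign) (p q : Orientation n)
      {z w : Vect n} (Vz : V z) (Ww : W w) (alive-z : Alive z) (alive-w : Alive w)
      (difference : ∀ x → δ (lookup p x) (lookup q x) ≡ z x + w x + arc f s x) where

      arc-act-from : ∀ (o : Orientation n) → lookup o f ≡ flipS s → ∀ {z′ w′ : Vect n} → V z′ → W w′ →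
        Alive z′ → Alive w′ → (∀ x → δ (lookup p x) (lookup o x) ≡ z′ x + w′ x) → ArcAct N f s p q
      arc-act-from o of {z′} {w′} Vz′ Ww′ alive-z′ alive-w′ eq =
        o , congruent⇒equiv o p Vz′ Ww′ alive-z′ alive-w′ eq , of
        , congruent⇒equiv (rev1 f o) q (V-+ Vz′ (V-neg Vz)) (W-+ Ww′ (W-neg Ww))
            (λ x dead → cong₂ (λ a b → a + - b) (alive-z′ x dead) (alive-z x dead))
            (λ x dead → cong₂ (λ a b → a + - b) (alive-w′ x dead) (alive-w x dead)) eq′
        where
        eq′ : ∀ x → δ (lookup q x) (lookup (rev1 f o) x) ≡ (z′ x + - z x) + (w′ x + - w x)
        eq′ x = trans (cong (λ a → a + - χ (lookup q x)) (χ-rev1 f s o of x))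
          (combine (χ (lookup o x)) (χ (lookup p x)) (χ (lookup q x)) (arc f s x) (z x) (w x) (z′ x) (w′ x)
            (eq x) (difference x))
          where
          combine : ∀ o p q a z w z′ w′ → o + - p ≡ z′ + w′ → q + - p ≡ z + w + a →
            o + a + - q ≡ (z′ + - z) + (w′ + - w)
          combine o p q a z w z′ w′ e₁ e₂ = trans (split o p q a)
            (trans (cong₂ (λ x y → x + a + - y) e₁ e₂) (join z′ w′ a z w))
            where
            split : ∀ o p q a → o + a + - q ≡ (o + - p) + a + - (q + - p)
            split = solve-∀
            join : ∀ z′ w′ a z w → (z′ + w′) + a + - (z + w + a) ≡ (z′ + - z) + (w′ + - w)
            join = solve-∀

      -- If `p` opposes the arc at `f`, it is itself the representative. Otherwise a vector of `V`
      -- or `W` through `f` that fits `p` is reversed first; it need not be minimal, since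
      -- congruence already gives equivalence.
      arc-act : (∀ t → Σ[ v ∈ Vect n ] (V v ⊎ W v) × Simple v × Alive v × v f ≡ sgn t ×
          (∀ x → x ≢ f → v x ∈ˢ (lookup p x ==_))) →
        ArcAct N f s p q
      arc-act through with lookup p f ≟ˢ flipS s
      ... | yes pf = arc-act-from p pf V-0 W-0 (λ _ _ → refl) (λ _ _ → refl) λ x → δ-self (lookup p x)
      ... | no pf≢ with through s
      ...   | v , member , sv , alive-v , vf , fits = finish member
        where
        pf≡s : lookup p f ≡ s
        pf≡s = other (lookup p f) s pf≢
          where
          other : ∀ o s → o ≢ flipS s → o ≡ s
          other plus plus _ = refl
          other minus minus _ = refl
          other plus minus ne = contradiction refl ne
          other minus plus ne = contradiction refl ne
        o : Orientation n
        o = rev (tabulate v) p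
        of : lookup o f ≡ flipS s
        of = trans (reversed-at-nonzero v p f (sgn≢0 s ∘ trans (sym vf))) (cong flipS pf≡s)
        fits-p : ∀ x → v x ∈ˢ (lookup p x ==_)
        fits-p x with x ≟ f
        ... | yes refl = subst₂ (λ a b → a ∈ˢ (b ==_)) (sym vf) (sym pf≡s) (sgn-∈ s {s ==_} (==-refl s))
        ... | no x≢f = fits x x≢f
        flipped : ∀ o a → IsTrit a → a ∈ˢ (o ==_) → a ≢ 0ℤ → δ o (flipS o) ≡ - a
        flipped plus _ (inj₁ refl) () _
        flipped minus _ (inj₁ refl) _ _ = refl
        flipped _ _ (inj₂ (inj₁ refl)) _ a≢0 = contradiction refl a≢0
        flipped plus _ (inj₂ (inj₂ refl)) _ _ = refl
        flipped minus _ (inj₂ (inj₂ refl)) () _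
        change : ∀ x → δ (lookup p x) (lookup o x) ≡ - v x
        change x with v x ℤP.≟ 0ℤ
        ... | yes vx≡0 = trans (cong (δ (lookup p x)) (reversed-at-zero v p x vx≡0))
          (trans (δ-self (lookup p x)) (cong -_ (sym vx≡0)))
        ... | no vx≢0 = trans (cong (δ (lookup p x)) (reversed-at-nonzero v p x vx≢0))
          (flipped (lookup p x) (v x) (sv x) (fits-p x) vx≢0)
        finish : V v ⊎ W v → ArcAct N f s p q
        finish (inj₁ Vv) = arc-act-from o of (V-neg Vv) W-0 (λ x dead → cong -_ (alive-v x dead)) (λ _ _ → refl)
          λ x → trans (change x) (sym (ℤP.+-identityʳ (- v x)))
        finish (inj₂ Wv) = arc-act-from o of V-0 (W-neg Wv) (λ _ _ → refl) (λ x dead → cong -_ (alive-v x dead))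
          λ x → trans (change x) (sym (ℤP.+-identityˡ (- v x)))

module _ {n} {V W : Vect n → Set} (R : RegularPair V W) (N : SMat n)
  (cycle : ∀ c → SC N c → IsSimple c × V (lookup c)) (cocycle : ∀ c → SCo N c → IsSimple c × W (lookup c))
  (spanning : ∀ x → Gr N x) where
  open RegularPair R

  Congruent : (p q : Orientation n) → Set
  Congruent p q = Σ[ z ∈ Vect n ] Σ[ w ∈ Vect n ] V z × W w ×
    (∀ x → δ (lookup p x) (lookup q x) ≡ z x + w x)

  equiv⇒congruent : ∀ {p q} → Equiv N p q → Congruent p q
  equiv⇒congruent {p} {q} (agree eq) = (λ _ → 0ℤ) , (λ _ → 0ℤ) , V-0 , W-0 ,
    λ x → trans (cong (δ (lookup p x)) (sym (eq x (spanning x)))) (δ-self (lookup p x))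
  equiv⇒congruent {p} (move c cyc compat) = [ circuit , cocircuit ]′ cyc
    where
    flipped : ∀ o a → IsTrit a → (∀ s → SignIs a s → o ≡ s) →
      δ o (if isZero a then o else flipS o) ≡ - a
    flipped o _ (inj₂ (inj₁ refl)) _ = δ-self o
    flipped o _ (inj₁ refl) compat with refl ← compat minus -<+ = refl
    flipped o _ (inj₂ (inj₂ refl)) compat with refl ← compat plus (+<+ (s≤s z≤n)) = refl
    change : IsSimple c → ∀ x → δ (lookup p x) (lookup (rev c p) x) ≡ - lookup c x
    change simple x = trans (cong (δ (lookup p x)) (lookup∘tabulate _ x))
      (flipped (lookup p x) (lookup c x) (simple x) (compat x))
    circuit : SC N c → Congruent p (rev c p)
    circuit C with cycle c C
    ... | simple , Vc = (λ x → - lookup c x) , (λ _ → 0ℤ) , V-neg Vc , W-0 ,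
      λ x → trans (change simple x) (sym (ℤP.+-identityʳ (- lookup c x)))
    cocircuit : SCo N c → Congruent p (rev c p)
    cocircuit C with cocycle c C
    ... | simple , Wc = (λ _ → 0ℤ) , (λ x → - lookup c x) , V-0 , W-neg Wc ,
      λ x → trans (change simple x) (sym (ℤP.+-identityˡ (- lookup c x)))
  equiv⇒congruent {p} {q} (symm e) with equiv⇒congruent e
  ... | z , w , Vz , Ww , eq = (λ x → - z x) , (λ x → - w x) , V-neg Vz , W-neg Ww ,
    λ x → trans (turn (χ (lookup p x)) (χ (lookup q x))) (trans (cong -_ (eq x)) (ℤP.neg-distrib-+ (z x) (w x)))
    where
    turn : ∀ a b → b + - a ≡ - (a + - b)
    turn = solve-∀
  equiv⇒congruent (Equiv.trans {o} {p} {q} e₁ e₂) with equiv⇒congruent e₁ | equiv⇒congruent e₂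
  ... | z , w , Vz , Ww , eq | z′ , w′ , Vz′ , Ww′ , eq′ =
    (λ x → z x + z′ x) , (λ x → w x + w′ x) , V-+ Vz Vz′ , W-+ Ww Ww′ ,
    λ x → trans (chain (χ (lookup o x)) (χ (lookup p x)) (χ (lookup q x)))
      (trans (cong₂ _+_ (eq x) (eq′ x)) (regroup (z x) (w x) (z′ x) (w′ x)))
    where
    chain : ∀ a b c → c + - a ≡ (b + - a) + (c + - b)
    chain = solve-∀
    regroup : ∀ a b c d → (a + b) + (c + d) ≡ (a + c) + (b + d)
    regroup = solve-∀

  arc-act⇒difference : ∀ {f s p q} → ArcAct N f s p q → Σ[ z ∈ Vect n ] Σ[ w ∈ Vect n ] V z × W w ×
    (∀ x → δ (lookup p x) (lookup q x) ≡ z x + w x + arc f s x)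
  arc-act⇒difference {f} {s} {p} {q} (o , e₁ , of , e₂)
    with equiv⇒congruent e₁ | equiv⇒congruent e₂
  ... | z , w , Vz , Ww , eq | z′ , w′ , Vz′ , Ww′ , eq′ =
    (λ x → - z x + z′ x) , (λ x → - w x + w′ x) , V-+ (V-neg Vz) Vz′ , W-+ (W-neg Ww) Ww′ ,
    λ x → combine (χ (lookup o x)) (χ (lookup p x)) (χ (lookup q x)) (χ (lookup (rev1 f o) x))
      (arc f s x) (z x) (w x) (z′ x) (w′ x) (eq x) (eq′ x) (χ-rev1 f s o of x)
    where
    combine : ∀ o p q r a z w z′ w′ → p + - o ≡ z + w → q + - r ≡ z′ + w′ → r ≡ o + a →
      q + - p ≡ (- z + z′) + (- w + w′) + a
    combine o p q .(o + a) a z w z′ w′ e₁ e₂ refl = trans (split o p q a)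
      (trans (cong₂ (λ x y → y + a + - x) e₁ e₂) (gather a z w z′ w′))
      where
      split : ∀ o p q a → q + - p ≡ (q + - (o + a)) + a + - (p + - o)
      split = solve-∀
      gather : ∀ a z w z′ w′ → (z′ + w′) + a + - (z + w) ≡ (- z + z′) + (- w + w′) + a
      gather = solve-∀

-- Rational sums; vectors pushed forward along index maps.

sumFinℚ≡sum : ∀ {k} (g : Fin k → Q.ℚ) → sumFinℚ g ≡ sum g
sumFinℚ≡sum {zero} g = refl
sumFinℚ≡sum {suc k} g = cong (g zero Q.+_) (sumFinℚ≡sum (g ∘ suc))

toℚᵘ-toℚ : ∀ z → Q.toℚᵘ (toℚ z) Qᵘ.≃ Qᵘ.mkℚᵘ z 0
toℚᵘ-toℚ z = ℚP.toℚᵘ-fromℚᵘ (Qᵘ.mkℚᵘ z 0)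

toℚ-+ : ∀ a b → toℚ (a + b) ≡ toℚ a Q.+ toℚ b
toℚ-+ a b = ℚP.toℚᵘ-injective (ℚᵘP.≃-trans (toℚᵘ-toℚ (a + b))
  (ℚᵘP.≃-sym (ℚᵘP.≃-trans (ℚP.toℚᵘ-homo-+ (toℚ a) (toℚ b))
    (ℚᵘP.≃-trans (ℚᵘP.+-cong (toℚᵘ-toℚ a) (toℚᵘ-toℚ b)) (Qᵘ.*≡* (scale a b))))))
  where
  scale : ∀ a b → (a * + 1 + b * + 1) * + 1 ≡ (a + b) * + 1
  scale = solve-∀

toℚ-* : ∀ a b → toℚ (a * b) ≡ toℚ a Q.* toℚ b
toℚ-* a b = ℚP.toℚᵘ-injective (ℚᵘP.≃-trans (toℚᵘ-toℚ (a * b))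
  (ℚᵘP.≃-sym (ℚᵘP.≃-trans (ℚP.toℚᵘ-homo-* (toℚ a) (toℚ b))
    (ℚᵘP.*-cong (toℚᵘ-toℚ a) (toℚᵘ-toℚ b)))))

toℚ-neg : ∀ a → toℚ (- a) ≡ Q.- toℚ a
toℚ-neg a = ℚP.toℚᵘ-injective (ℚᵘP.≃-trans (toℚᵘ-toℚ (- a))
  (ℚᵘP.≃-sym (ℚᵘP.≃-trans (ℚP.toℚᵘ-homo‿- (toℚ a)) (ℚᵘP.-‿cong (toℚᵘ-toℚ a)))))

toℚ≡0⇒≡0 : ∀ a → toℚ a ≡ Q.0ℚ → a ≡ 0ℤ
toℚ≡0⇒≡0 a eq with ℚᵘP.≃-trans (ℚᵘP.≃-sym (toℚᵘ-toℚ a)) (ℚᵘP.≃-reflexive (cong Q.toℚᵘ eq))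
... | Qᵘ.*≡* e = trans (sym (ℤP.*-identityʳ a)) e

toℚ-sum : ∀ {k} (g : Fin k → ℤ) → toℚ (sumFin g) ≡ sum (toℚ ∘ g)
toℚ-sum {zero} g = refl
toℚ-sum {suc k} g = trans (toℚ-+ (g zero) (sumFin (g ∘ suc))) (cong (toℚ (g zero) Q.+_) (toℚ-sum (g ∘ suc)))

sum-neg : ∀ {k} (g : Fin k → Q.ℚ) → sum (λ i → Q.- g i) ≡ Q.- sum g
sum-neg {zero} g = refl
sum-neg {suc k} g = trans (cong (Q.- g zero Q.+_) (sum-neg (g ∘ suc))) (sym (ℚP.neg-distrib-+ (g zero) (sum (g ∘ suc))))

-- Written as a sum over all indices, so that it pairs correctly with other vectors even when `κ` is
-- not injective.
push : ∀ {k n} → (Fin k → Fin n) → (Fin k → ℤ) → Vect n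
push κ u x = sumFin (λ j → if does (κ j ≟ x) then u j else 0ℤ)

if-yes : ∀ {n} {x y : Fin n} {a b : ℤ} → x ≡ y → (if does (x ≟ y) then a else b) ≡ a
if-yes {x = x} {y} x≡y rewrite dec-true (x ≟ y) x≡y = refl

if-no : ∀ {n} {x y : Fin n} {a b : ℤ} → x ≢ y → (if does (x ≟ y) then a else b) ≡ b
if-no {x = x} {y} x≢y rewrite dec-false (x ≟ y) x≢y = refl

sum-push : ∀ {k n} (κ : Fin k → Fin n) u (B : Vect n) →
  sumFin (λ x → B x * push κ u x) ≡ sumFin (λ j → B (κ j) * u j)
sum-push κ u B = begin
  sumFin (λ x → B x * push κ u x)                    ≡⟨ sum-cong (λ x → sum-*ˡ (B x) (λ j → if does (κ j ≟ x) then u j else 0ℤ)) ⟩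
  sumFin (λ x → sumFin (λ j → B x * (if does (κ j ≟ x) then u j else 0ℤ)))
    ≡⟨ sum-swap (λ x j → B x * (if does (κ j ≟ x) then u j else 0ℤ)) ⟩
  sumFin (λ j → sumFin (λ x → B x * (if does (κ j ≟ x) then u j else 0ℤ)))
    ≡⟨ sum-cong (λ j → trans
         (sum-single (λ x → B x * (if does (κ j ≟ x) then u j else 0ℤ)) (κ j)
           (λ x x≢κj → trans (cong (B x *_) (if-no {a = u j} {0ℤ} (x≢κj ∘ sym))) (ℤP.*-zeroʳ (B x))))
         (cong (B (κ j) *_) (if-yes {x = κ j} {κ j} {u j} {0ℤ} refl))) ⟩
  sumFin (λ j → B (κ j) * u j) ∎
  where open ≡-Reasoning

push-at : ∀ {k n} (κ : Fin k → Fin n) u → (∀ i j → κ i ≡ κ j → i ≡ j) → ∀ j → push κ u (κ j) ≡ u j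
push-at κ u inj j = trans
  (sum-single (λ i → if does (κ i ≟ κ j) then u i else 0ℤ) j (λ i i≢j → if-no {a = u i} {0ℤ} (i≢j ∘ inj i j)))
  (if-yes {x = κ j} {κ j} {u j} {0ℤ} refl)

push-off : ∀ {k n} (κ : Fin k → Fin n) u x → (∀ j → κ j ≢ x) → push κ u x ≡ 0ℤ
push-off κ u x off = sum-zero λ j → if-no {a = u j} {0ℤ} (off j)

trit-altSign : ∀ {k} (j : Fin k) {z} → IsTrit z → IsTrit (altSign j * z)
trit-altSign j {z} tz with altSign j | altSign-unit j
... | _ | inj₁ refl = subst IsTrit (sym (ℤP.*-identityˡ z)) tz
... | _ | inj₂ refl = subst IsTrit (sym (ℤP.-1*i≡-i z)) (trit-neg tz)

-- Kernel and row space of a totally unimodular matrix.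

module _ {r n : ℕ} (A : Matrix r n) where

  Kernel RowSpace : Vect n → Set
  Kernel v = ∀ i → sumFin (λ j → entry A i j * v j) ≡ 0ℤ
  RowSpace w = ∃[ y ] (∀ j → rowComb A y j ≡ toℚ (w j))

  submatrix : ∀ {k} → (Fin k → Fin r) → (Fin k → Fin n) → Fin k → Fin k → ℤ
  submatrix ρ κ a b = entry A (ρ a) (κ b)

  -- As a function of `x` this is a cofactor combination of rows, hence in the row space. If it
  -- vanishes for every `i` and the inner minor does not, column `x` depends on the columns `κ`.
  bordered : ∀ {k} → (Fin k → Fin r) → (Fin k → Fin n) → Fin r → Fin n → ℤ
  bordered {k} ρ κ i x = det (suc k) (submatrix (i ◂ ρ) (x ◂ κ))

  Nonsingular : ∀ {k} → (Fin k → Fin r) → (Fin k → Fin n) → Set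
  Nonsingular {k} ρ κ = det k (submatrix ρ κ) ≢ 0ℤ

  columns-injective : ∀ {k} ρ (κ : Fin k → Fin n) → Nonsingular ρ κ → ∀ i j → κ i ≡ κ j → i ≡ j
  columns-injective {k} ρ κ ns i j eq with i ≟ j
  ... | yes i≡j = i≡j
  ... | no i≢j = contradiction (det-alternating k (submatrix ρ κ) i j i≢j λ a → cong (entry A (ρ a)) eq) ns

  rows-injective : ∀ {k} (ρ : Fin k → Fin r) κ → Nonsingular ρ κ → ∀ i j → ρ i ≡ ρ j → i ≡ j
  rows-injective {k} ρ κ ns i j eq with i ≟ j
  ... | yes i≡j = i≡j
  ... | no i≢j = contradiction (det-equal-rows k (submatrix ρ κ) i j i≢j λ b → cong (λ a → entry A a (κ b)) eq) ns

  ◂-injective : ∀ {k m} (x : Fin m) (κ : Fin k → Fin m) → (∀ j → κ j ≢ x) → (∀ i j → κ i ≡ κ j → i ≡ j) →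
    ∀ i j → (x ◂ κ) i ≡ (x ◂ κ) j → i ≡ j
  ◂-injective x κ x∉ inj zero zero eq = refl
  ◂-injective x κ x∉ inj zero (suc j) eq = contradiction (sym eq) (x∉ j)
  ◂-injective x κ x∉ inj (suc i) zero eq = contradiction eq (x∉ i)
  ◂-injective x κ x∉ inj (suc i) (suc j) eq = cong suc (inj i j eq)

  -- The cofactors of an absent top row: Cramer's relation among the columns `g` and `κ`, in which
  -- `g` has the minor of `κ` as coefficient.
  circuit-coefficients : ∀ {k} → (Fin k → Fin r) → (Fin k → Fin n) → Fin n → Fin (suc k) → ℤ
  circuit-coefficients ρ κ g = cofactor-row (λ a b → entry A (ρ a) ((g ◂ κ) b))

  circuit-vector : ∀ {k} → (Fin k → Fin r) → (Fin k → Fin n) → Fin n → Vect n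
  circuit-vector ρ κ g = push (g ◂ κ) (circuit-coefficients ρ κ g)

  circuit-vector-kernel : ∀ {k} (ρ : Fin k → Fin r) κ g → (∀ i → bordered ρ κ i g ≡ 0ℤ) →
    Kernel (circuit-vector ρ κ g)
  circuit-vector-kernel {k} ρ κ g border i = begin
    sumFin (λ x → entry A i x * circuit-vector ρ κ g x)
      ≡⟨ sum-push (g ◂ κ) (circuit-coefficients ρ κ g) (entry A i) ⟩
    sumFin (λ j → entry A i ((g ◂ κ) j) * circuit-coefficients ρ κ g j)
      ≡⟨ det-first-row (λ j → entry A i ((g ◂ κ) j)) (λ a b → entry A (ρ a) ((g ◂ κ) b)) ⟩
    det (suc k) ((λ j → entry A i ((g ◂ κ) j)) ◂ (λ a b → entry A (ρ a) ((g ◂ κ) b)))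
      ≡⟨ det-cong (suc k) ((λ j → entry A i ((g ◂ κ) j)) ◂ (λ a b → entry A (ρ a) ((g ◂ κ) b)))
           (submatrix (i ◂ ρ) (g ◂ κ)) (λ { zero b → refl ; (suc a) b → refl }) ⟩
    bordered ρ κ i g ≡⟨ border i ⟩
    0ℤ ∎
    where open ≡-Reasoning

  circuit-vector-at : ∀ {k} (ρ : Fin k → Fin r) κ g → Nonsingular ρ κ → (∀ j → κ j ≢ g) →
    circuit-vector ρ κ g g ≡ det k (submatrix ρ κ)
  circuit-vector-at {k} ρ κ g ns g∉ = trans
    (push-at (g ◂ κ) (circuit-coefficients ρ κ g) (◂-injective g κ g∉ (columns-injective ρ κ ns)) zero)
    (ℤP.*-identityˡ (det k (submatrix ρ κ)))

  circuit-vector-off : ∀ {k} (ρ : Fin k → Fin r) κ g x → x ≢ g → (∀ j → κ j ≢ x) →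
    circuit-vector ρ κ g x ≡ 0ℤ
  circuit-vector-off ρ κ g x x≢g x∉ = push-off (g ◂ κ) (circuit-coefficients ρ κ g) x
    λ { zero g≡x → x≢g (sym g≡x) ; (suc j) → x∉ j }

  row-coefficients : ∀ {k} → (Fin k → Fin r) → (Fin k → Fin n) → Fin r → Fin r → ℤ
  row-coefficients ρ κ i = push (i ◂ ρ) (cofactor-column (λ a b → entry A ((i ◂ ρ) a) (κ b)))

  row-combination : ∀ {k} (ρ : Fin k → Fin r) κ i x →
    sumFin (λ a → row-coefficients ρ κ i a * entry A a x) ≡ bordered ρ κ i x
  row-combination {k} ρ κ i x = begin
    sumFin (λ a → row-coefficients ρ κ i a * entry A a x)
      ≡⟨ sum-cong (λ a → ℤP.*-comm (row-coefficients ρ κ i a) (entry A a x)) ⟩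
    sumFin (λ a → entry A a x * row-coefficients ρ κ i a)
      ≡⟨ sum-push (i ◂ ρ) (cofactor-column (λ a b → entry A ((i ◂ ρ) a) (κ b))) (λ a → entry A a x) ⟩
    sumFin (λ j → entry A ((i ◂ ρ) j) x * cofactor-column (λ a b → entry A ((i ◂ ρ) a) (κ b)) j)
      ≡⟨ det-first-column (λ j → entry A ((i ◂ ρ) j) x) (λ a b → entry A ((i ◂ ρ) a) (κ b)) ⟩
    det (suc k) (λ a → entry A ((i ◂ ρ) a) x ◂ (λ b → entry A ((i ◂ ρ) a) (κ b)))
      ≡⟨ det-cong (suc k) (λ a → entry A ((i ◂ ρ) a) x ◂ (λ b → entry A ((i ◂ ρ) a) (κ b)))
           (submatrix (i ◂ ρ) (x ◂ κ)) (λ { a zero → refl ; a (suc b) → refl }) ⟩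
    bordered ρ κ i x ∎
    where open ≡-Reasoning

  row-coefficients-at : ∀ {k} (ρ : Fin k → Fin r) κ i → Nonsingular ρ κ → (∀ a → ρ a ≢ i) →
    row-coefficients ρ κ i i ≡ det k (submatrix ρ κ)
  row-coefficients-at {k} ρ κ i ns i∉ = trans
    (push-at (i ◂ ρ) (cofactor-column (λ a b → entry A ((i ◂ ρ) a) (κ b)))
      (◂-injective i ρ i∉ (rows-injective ρ κ ns)) zero)
    (ℤP.*-identityˡ (det k (submatrix ρ κ)))

  integral-combination : ∀ (y : Fin r → ℤ) (w : Vect n) →
    (∀ x → sumFin (λ a → y a * entry A a x) ≡ w x) → ∀ x → rowComb A (toℚ ∘ y) x ≡ toℚ (w x)
  integral-combination y w eq x = trans (sumFinℚ≡sum (λ i → toℚ (y i) Q.* toℚ (entry A i x)))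
    (trans (sum-cong-≗ (λ i → sym (toℚ-* (y i) (entry A i x))))
      (trans (sym (toℚ-sum (λ a → y a * entry A a x))) (cong toℚ (eq x))))

  bordered-row-space : ∀ {k} (ρ : Fin k → Fin r) κ i → RowSpace (bordered ρ κ i)
  bordered-row-space ρ κ i = toℚ ∘ row-coefficients ρ κ i ,
    integral-combination (row-coefficients ρ κ i) (bordered ρ κ i) (row-combination ρ κ i)

  record Maximal (S P : Fin n → Set) {k₀} (κ₀ : Fin k₀ → Fin n) : Set where
    field
      {rank}  : ℕ
      rows    : Fin rank → Fin r
      cols    : Fin rank → Fin n
      nonsing : Nonsingular rows cols
      border  : ∀ i x → S x → bordered rows cols i x ≡ 0ℤ
      within  : ∀ j → P (cols j)
      extends : ∀ j → ∃[ j′ ] cols j′ ≡ κ₀ j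

  maximal : ∀ {S P : Fin n → Set} → (∀ x → Dec (S x)) → (∀ x → S x → P x) →
    ∀ {k} (ρ : Fin k → Fin r) (κ : Fin k → Fin n) → Nonsingular ρ κ → (∀ j → P (κ j)) → Maximal S P κ
  -- Columns of a nonsingular submatrix are distinct, so `k` never exceeds `n` and the invariant
  -- `n < k + fuel` rules out `fuel = 0`.
  maximal {S} {P} S? S⊆P {k} ρ κ ns inP = grow (suc n) k ρ κ ns inP (ℕP.m≤n+m (suc n) k)
    where
    grow : ∀ fuel k (ρ : Fin k → Fin r) (κ : Fin k → Fin n) → Nonsingular ρ κ → (∀ j → P (κ j)) →
      n ℕ.< k ℕ.+ fuel → Maximal S P κ
    grow zero k ρ κ ns inP n<k = contradiction
      (injective⇒≤ {f = κ} (λ {i} {j} → columns-injective ρ κ ns i j))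
      (ℕP.<⇒≱ (subst (n ℕ.<_) (ℕP.+-identityʳ k) n<k))
    grow (suc fuel) k ρ κ ns inP n< with search₂ {A = λ i x → S x × bordered ρ κ i x ≢ 0ℤ}
      {B = λ i x → S x → bordered ρ κ i x ≡ 0ℤ} decide
      where
      decide : ∀ i x → (S x × bordered ρ κ i x ≢ 0ℤ) ⊎ (S x → bordered ρ κ i x ≡ 0ℤ)
      decide i x with S? x | bordered ρ κ i x ℤP.≟ 0ℤ
      ... | no ¬Sx | _ = inj₂ λ Sx → contradiction Sx ¬Sx
      ... | yes _ | yes eq = inj₂ λ _ → eq
      ... | yes Sx | no neq = inj₁ (Sx , neq)
    ... | inj₂ none = record
      { rows = ρ ; cols = κ ; nonsing = ns ; border = none ; within = inP ; extends = λ j → j , refl }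
    ... | inj₁ (i , x , Sx , neq)
      with grow fuel (suc k) (i ◂ ρ) (x ◂ κ) neq (λ { zero → S⊆P x Sx ; (suc j) → inP j })
             (subst (n ℕ.<_) (ℕP.+-suc k fuel) n<)
    ...   | m = record
      { rows = Maximal.rows m ; cols = Maximal.cols m ; nonsing = Maximal.nonsing m
      ; border = Maximal.border m ; within = Maximal.within m ; extends = λ j → Maximal.extends m (suc j) }

  from-empty : ∀ {S : Fin n → Set} → (∀ x → Dec (S x)) → Maximal S S {0} λ ()
  from-empty S? = maximal S? (λ _ → id) (λ ()) (λ ()) (λ ()) λ ()

  kernel-⊥-row-space : ∀ {v w} → Kernel v → RowSpace w → sumFin (λ x → v x * w x) ≡ 0ℤ
  kernel-⊥-row-space {v} {w} Vv (y , Wy) = toℚ≡0⇒≡0 _ (begin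
    toℚ (sumFin (λ x → v x * w x))                    ≡⟨ toℚ-sum (λ x → v x * w x) ⟩
    sum (λ x → toℚ (v x * w x))                       ≡⟨ sum-cong-≗ (λ x → trans (toℚ-* (v x) (w x)) (cong (toℚ (v x) Q.*_) (expand x))) ⟩
    sum (λ x → toℚ (v x) Q.* sum (λ i → y i Q.* toℚ (entry A i x)))
      ≡⟨ sum-cong-≗ (λ x → *-distribˡ-sum (toℚ (v x)) (λ i → y i Q.* toℚ (entry A i x))) ⟩
    sum (λ x → sum (λ i → toℚ (v x) Q.* (y i Q.* toℚ (entry A i x))))
      ≡⟨ ∑-comm (λ x i → toℚ (v x) Q.* (y i Q.* toℚ (entry A i x))) ⟩
    sum (λ i → sum (λ x → toℚ (v x) Q.* (y i Q.* toℚ (entry A i x))))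
      ≡⟨ sum-cong-≗ (λ i → trans (sum-cong-≗ (λ x → rearrange i x))
           (sym (*-distribˡ-sum (y i) (λ x → toℚ (entry A i x * v x))))) ⟩
    sum (λ i → y i Q.* sum (λ x → toℚ (entry A i x * v x)))
      ≡⟨ sum-cong-≗ (λ i → trans (cong (y i Q.*_) (trans (sym (toℚ-sum (λ x → entry A i x * v x))) (cong toℚ (Vv i))))
           (ℚP.*-zeroʳ (y i))) ⟩
    sum {r} (λ _ → Q.0ℚ)                              ≡⟨ sum-replicate-zero r ⟩
    Q.0ℚ ∎)
    where
    open ≡-Reasoning
    expand : ∀ x → toℚ (w x) ≡ sum (λ i → y i Q.* toℚ (entry A i x))
    expand x = trans (sym (Wy x)) (sumFinℚ≡sum (λ i → y i Q.* toℚ (entry A i x)))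
    rearrange : ∀ i x → toℚ (v x) Q.* (y i Q.* toℚ (entry A i x)) ≡ y i Q.* toℚ (entry A i x * v x)
    rearrange i x = begin
      toℚ (v x) Q.* (y i Q.* toℚ (entry A i x)) ≡⟨ ℚP.*-comm (toℚ (v x)) _ ⟩
      y i Q.* toℚ (entry A i x) Q.* toℚ (v x)   ≡⟨ ℚP.*-assoc (y i) (toℚ (entry A i x)) (toℚ (v x)) ⟩
      y i Q.* (toℚ (entry A i x) Q.* toℚ (v x)) ≡⟨ cong (y i Q.*_) (toℚ-* (entry A i x) (v x)) ⟨
      y i Q.* toℚ (entry A i x * v x)           ∎

  row-space-+ : ∀ {u w} → RowSpace u → RowSpace w → RowSpace (λ x → u x + w x)
  row-space-+ {u} {w} (y , eq) (y′ , eq′) = (λ i → y i Q.+ y′ i) , λ x →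
    trans (sumFinℚ≡sum (λ i → (y i Q.+ y′ i) Q.* a x i))
    (trans (sum-cong-≗ (λ i → ℚP.*-distribʳ-+ (a x i) (y i) (y′ i)))
    (trans (∑-distrib-+ (λ i → y i Q.* a x i) (λ i → y′ i Q.* a x i))
    (trans (sym (cong₂ Q._+_ (sumFinℚ≡sum (λ i → y i Q.* a x i)) (sumFinℚ≡sum (λ i → y′ i Q.* a x i))))
    (trans (cong₂ Q._+_ (eq x) (eq′ x)) (sym (toℚ-+ (u x) (w x)))))))
    where
    a : Fin n → Fin r → Q.ℚ
    a x i = toℚ (entry A i x)

  row-space-neg : ∀ {w} → RowSpace w → RowSpace (λ x → - w x)
  row-space-neg {w} (y , eq) = (λ i → Q.- y i) , λ x →
    trans (sumFinℚ≡sum (λ i → Q.- y i Q.* a x i))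
    (trans (sum-cong-≗ (λ i → sym (ℚP.neg-distribˡ-* (y i) (a x i))))
    (trans (sum-neg (λ i → y i Q.* a x i))
    (trans (cong Q.-_ (trans (sym (sumFinℚ≡sum (λ i → y i Q.* a x i))) (eq x))) (sym (toℚ-neg (w x))))))
    where
    a : Fin n → Fin r → Q.ℚ
    a x i = toℚ (entry A i x)

  kernel-+ : ∀ {u v} → Kernel u → Kernel v → Kernel (λ x → u x + v x)
  kernel-+ {u} {v} Vu Vv i = trans (sum-cong λ j → ℤP.*-distribˡ-+ (entry A i j) (u j) (v j))
    (trans (sum-+ (λ j → entry A i j * u j) (λ j → entry A i j * v j)) (cong₂ _+_ (Vu i) (Vv i)))

  kernel-neg : ∀ {v} → Kernel v → Kernel (λ x → - v x)
  kernel-neg {v} Vv i = trans (sum-cong λ j → rearrange (entry A i j) (v j))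
    (trans (sym (sum-*ˡ -1ℤ (λ j → entry A i j * v j))) (cong (-1ℤ *_) (Vv i)))
    where
    rearrange : ∀ a b → a * - b ≡ -1ℤ * (a * b)
    rearrange = solve-∀

  module _ (unimodular : TotallyUnimodular A) where

    circuit-vector-simple : ∀ {k} (ρ : Fin k → Fin r) κ g → Nonsingular ρ κ → (∀ j → κ j ≢ g) →
      Simple (circuit-vector ρ κ g)
    circuit-vector-simple {k} ρ κ g ns g∉ x with any? (λ j → (g ◂ κ) j ≟ x)
    ... | yes (j , refl) = subst IsTrit
      (sym (push-at (g ◂ κ) (circuit-coefficients ρ κ g) (◂-injective g κ g∉ (columns-injective ρ κ ns)) j))
      (trit-altSign j (unimodular k ρ (λ b → (g ◂ κ) (punchIn j b))))
    ... | no none = inj₂ (inj₁ (push-off (g ◂ κ) (circuit-coefficients ρ κ g) x λ j eq → none (j , eq)))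

    normalise : ∀ {U : Vect n → Set} {Z : Fin n → Set} g → (∀ {u} → U u → U (λ x → - u x)) →
      ∀ u → U u → Simple u → u g ≢ 0ℤ → (∀ x → Z x → u x ≡ 0ℤ) →
      Σ[ v ∈ Vect n ] U v × Simple v × v g ≡ 1ℤ × (∀ x → Z x → v x ≡ 0ℤ)
    normalise g negate u Uu su ug≢0 z with su g
    ... | inj₁ eq = (λ x → - u x) , negate Uu , (λ x → trit-neg (su x)) , cong -_ eq , λ x Zx → cong -_ (z x Zx)
    ... | inj₂ (inj₁ eq) = contradiction eq ug≢0
    ... | inj₂ (inj₂ eq) = u , Uu , su , eq , z

    -- Take a maximal nonsingular submatrix with columns in `S` other than `g`. If bordering by `g`
    -- gives a nonzero minor, that bordered row solves the second alternative, being zero on the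
    -- rest of `S`; otherwise Cramer's relation solves the first. Entries are minors up to sign,
    -- hence -1, 0 or 1.
    two-colour : ∀ (S : Fin n → Bool) g →
      Solution Kernel g (λ x → T (not (S x))) ⊎
      Solution RowSpace g (λ x → T (S x))
    two-colour S g with from-empty (λ x → ¬? (x ≟ g) ×-dec 𝔹.T? (S x))
    ... | m = choose (zero-or-not λ i → bordered rows cols i g)
      where
      open Maximal m
      curried : ∀ {U : Vect n → Set} {Z : Fin n → Set} →
        (Σ[ v ∈ Vect n ] U v × Simple v × v g ≡ 1ℤ × (∀ x → x ≢ g × Z x → v x ≡ 0ℤ)) →
        Solution U g Z
      curried (v , Uv , sv , vg , z) = v , Uv , sv , vg , λ x x≢g Zx → z x (x≢g , Zx)
      choose : (∃[ i ] bordered rows cols i g ≢ 0ℤ) ⊎ (∀ i → bordered rows cols i g ≡ 0ℤ) →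
        Solution Kernel g (λ x → T (not (S x))) ⊎
        Solution RowSpace g (λ x → T (S x))
      choose (inj₁ (i , neq)) = inj₂ (curried (normalise {RowSpace} {λ x → x ≢ g × T (S x)} g
        (λ {u} → row-space-neg {u}) (bordered rows cols i) (bordered-row-space rows cols i)
        (λ x → unimodular (suc rank) (i ◂ rows) (x ◂ cols)) neq (border i)))
      choose (inj₂ zero-border) = inj₁ (curried (normalise {Kernel} {λ x → x ≢ g × T (not (S x))} g
        (λ {u} → kernel-neg {u}) (circuit-vector rows cols g)
        (circuit-vector-kernel rows cols g zero-border)
        (circuit-vector-simple rows cols g nonsing g∉)
        (nonsing ∘ trans (sym (circuit-vector-at rows cols g nonsing g∉)))
        (λ x (x≢g , ¬Sx) → circuit-vector-off rows cols g x x≢g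
          (λ j colj≡x → T-not-contra (proj₂ (within j)) (subst (T ∘ not ∘ S) (sym colj≡x) ¬Sx)))))
        where
        g∉ : ∀ j → cols j ≢ g
        g∉ j = proj₁ (within j)

    matrix-pair : RegularPair Kernel RowSpace
    matrix-pair = record
      { V-0 = λ i → sum-zero λ j → ℤP.*-zeroʳ (entry A i j)
      ; V-ext = λ eq Vu i → trans (sum-cong λ j → cong (entry A i j *_) (sym (eq j))) (Vu i)
      ; V-+ = λ {u} {v} → kernel-+ {u} {v}
      ; V-neg = λ {v} → kernel-neg {v}
      ; W-0 = (λ _ → Q.0ℚ) , λ x → trans (sumFinℚ≡sum (λ i → Q.0ℚ Q.* toℚ (entry A i x)))
          (trans (sum-cong-≗ (λ i → ℚP.*-zeroˡ (toℚ (entry A i x)))) (sum-replicate-zero r))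
      ; W-ext = λ eq (y , Wy) → y , λ x → trans (Wy x) (cong toℚ (eq x))
      ; W-+ = λ {u} {v} → row-space-+ {u} {v}
      ; W-neg = λ {v} → row-space-neg {v}
      ; orth = λ {v} {w} → kernel-⊥-row-space {v} {w}
      ; colour = two-colour
      }

-- Bases versus kernel and row space.

module _ {r n : ℕ} (A : Matrix r n) where

  basis-columns : ∀ {B} (basis : IsBasisA A B) → ∀ x → x ∈ B → ∃[ j ] proj₁ basis j ≡ x
  basis-columns (κ , image , _) x = Equivalence.to (image x)

  column∈basis : ∀ {B} (basis : IsBasisA A B) j → proj₁ basis j ∈ B
  column∈basis (κ , image , _) j = Equivalence.from (image (κ j)) (j , refl)

  basis-independent : ∀ {B v} → IsBasisA A B → Kernel A v → (∀ x → v x ≢ 0ℤ → x ∈ B) → ∀ x → v x ≡ 0ℤ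
  basis-independent {B} {v} basis@(κ , image , inj , det≢0) Vv sub x with v x ℤP.≟ 0ℤ
  ... | yes vx≡0 = vx≡0
  ... | no vx≢0 with basis-columns basis x (sub x vx≢0)
  ...   | j , refl = contradiction (kernel⇒det≡0 r (submatrix A id κ) (v ∘ κ) kernel j vx≢0) det≢0
    where
    pushed : ∀ y → v y ≡ push κ (v ∘ κ) y
    pushed y with any? (λ i → κ i ≟ y)
    ... | yes (i , refl) = sym (push-at κ (v ∘ κ) inj i)
    ... | no none with v y ℤP.≟ 0ℤ
    ...   | yes vy≡0 = trans vy≡0 (sym (push-off κ (v ∘ κ) y λ i eq → none (i , eq)))
    ...   | no vy≢0 = contradiction (basis-columns basis y (sub y vy≢0)) none
    kernel : ∀ a → sumFin (λ b → entry A a (κ b) * v (κ b)) ≡ 0ℤ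
    kernel a = trans (sym (sum-push κ (v ∘ κ) (entry A a)))
      (trans (sum-cong λ y → cong (entry A a y *_) (sym (pushed y))) (Vv a))

  -- Cramer's relation expresses column `x` through the basis; paired with `w` it leaves only a
  -- nonzero multiple of `w x`, which orthogonality makes zero.
  basis-spanning : ∀ {B w} → IsBasisA A B → RowSpace A w → (∀ x → w x ≢ 0ℤ → x ∉ B) → ∀ x → w x ≡ 0ℤ
  basis-spanning {B} {w} basis@(κ , image , inj , det≢0) Ww avoid x with w x ℤP.≟ 0ℤ
  ... | yes wx≡0 = wx≡0
  ... | no wx≢0 = i*j≡0⇒j≡0 (v x) (w x) vx≢0
    (trans (sym (sum-single (λ y → v y * w y) x zeros)) (kernel-⊥-row-space A {v} {w} kernel Ww))
    where
    v : Vect n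
    v = circuit-vector A id κ x
    x∉κ : ∀ j → κ j ≢ x
    x∉κ j refl = avoid x wx≢0 (column∈basis basis j)
    kernel : Kernel A v
    kernel = circuit-vector-kernel A id κ x λ i →
      det-equal-rows (suc r) (submatrix A (i ◂ id) (x ◂ κ)) zero (suc i) (λ ()) λ _ → refl
    vx≢0 : v x ≢ 0ℤ
    vx≢0 = det≢0 ∘ trans (sym (circuit-vector-at A id κ x det≢0 x∉κ))
    zeros : ∀ y → y ≢ x → v y * w y ≡ 0ℤ
    zeros y y≢x with w y ℤP.≟ 0ℤ
    ... | yes wy≡0 = trans (cong (v y *_) wy≡0) (ℤP.*-zeroʳ (v y))
    ... | no wy≢0 = cong (_* w y) (circuit-vector-off A id κ x y y≢x
      λ { j refl → avoid y wy≢0 (column∈basis basis j) })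

  image : ∀ {k} → (Fin k → Fin n) → Subset n
  image κ = tabulate λ x → does (any? λ j → κ j ≟ x)

  ∈-image : ∀ {k} (κ : Fin k → Fin n) x → (x ∈ image κ) ⇔ (∃[ j ] κ j ≡ x)
  ∈-image κ x = mk⇔ to from
    where
    to : x ∈ image κ → ∃[ j ] κ j ≡ x
    to x∈ with any? (λ j → κ j ≟ x) | trans (sym (lookup∘tabulate (λ x → does (any? λ j → κ j ≟ x)) x)) ([]=⇒lookup x∈)
    ... | yes p | _ = p
    ... | no _ | ()
    from : ∃[ j ] κ j ≡ x → x ∈ image κ
    from p = lookup⇒[]= x (image κ) (trans (lookup∘tabulate (λ x → does (any? λ j → κ j ≟ x)) x)
      (dec-true (any? λ j → κ j ≟ x) p))

  module _ (full-rank : FullRowRank A) where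

    -- Permuting rows does not affect whether columns are independent.
    spanning-rows⇒basis : ∀ {k} (ρ : Fin k → Fin r) (κ : Fin k → Fin n) → Nonsingular A ρ κ →
      (∀ i → ∃[ a ] ρ a ≡ i) → IsBasisA A (image κ)
    spanning-rows⇒basis {k} ρ κ ns onto = go k≡r ρ κ ns
      where
      section-injective : ∀ i j → proj₁ (onto i) ≡ proj₁ (onto j) → i ≡ j
      section-injective i j eq = trans (sym (proj₂ (onto i))) (trans (cong ρ eq) (proj₂ (onto j)))
      k≡r : k ≡ r
      k≡r = ℕP.≤-antisym (injective⇒≤ {f = ρ} λ {i} {j} → rows-injective A ρ κ ns i j)
        (injective⇒≤ {f = proj₁ ∘ onto} λ {i} {j} → section-injective i j)
      go : ∀ {k} → k ≡ r → (ρ : Fin k → Fin r) (κ : Fin k → Fin n) → Nonsingular A ρ κ → IsBasisA A (image κ)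
      go refl ρ κ ns = κ , ∈-image κ , columns-injective A ρ κ ns , det≢0
        where
        det≢0 : det r (submatrix A id κ) ≢ 0ℤ
        det≢0 eq with det≡0⇒kernel r (submatrix A id κ) eq
        ... | v , ker , j , vj≢0 = ns (kernel⇒det≡0 r (submatrix A ρ κ) v (ker ∘ ρ) j vj≢0)

    -- Were the bordered row identically zero, its cofactors would be a relation among the rows
    -- whose coefficient at `i` is the nonzero minor, against full rank.
    missing-row⇒cocircuit : ∀ {k} (ρ : Fin k → Fin r) (κ : Fin k → Fin n) → Nonsingular A ρ κ →
      ∀ i → (∀ a → ρ a ≢ i) → ∃[ x ] bordered A ρ κ i x ≢ 0ℤ
    missing-row⇒cocircuit ρ κ ns i i∉ with zero-or-not (bordered A ρ κ i)
    ... | inj₁ p = p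
    ... | inj₂ zeros = contradiction
      (trans (sym (row-coefficients-at A ρ κ i ns i∉)) (toℚ≡0⇒≡0 (row-coefficients A ρ κ i i)
        (full-rank (toℚ ∘ row-coefficients A ρ κ i) zero-combination i))) ns
      where
      zero-combination : ∀ x → rowComb A (toℚ ∘ row-coefficients A ρ κ i) x ≡ Q.0ℚ
      zero-combination = integral-combination A (row-coefficients A ρ κ i) (λ _ → 0ℤ)
        λ x → trans (row-combination A ρ κ i x) (zeros x)

    -- Take a maximal nonsingular submatrix with columns off `D`. If it uses every row, its columns
    -- are a basis avoiding `D`; if it misses row `i`, the bordered row through `i` vanishes off
    -- `D`.
    codependent-or-basis : ∀ (D : Subset n) →
      (Σ[ w ∈ Vect n ] RowSpace A w × (∃[ x ] w x ≢ 0ℤ) × (∀ x → x ∉ D → w x ≡ 0ℤ)) ⊎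
      (∃[ B ] (IsBasisA A B × (∀ x → x ∈ B → x ∉ D)))
    codependent-or-basis D with from-empty A (λ x → ¬? (x ∈? D))
    ... | m = choose (search λ i → present i (any? λ a → rows a ≟ i))
      where
      open Maximal m
      present : ∀ i → Dec (∃[ a ] rows a ≡ i) → (∀ a → rows a ≢ i) ⊎ (∃[ a ] rows a ≡ i)
      present i (yes p) = inj₂ p
      present i (no none) = inj₁ λ a eq → none (a , eq)
      choose : ∃[ i ] (∀ a → rows a ≢ i) ⊎ (∀ i → ∃[ a ] rows a ≡ i) →
        (Σ[ w ∈ Vect n ] RowSpace A w × (∃[ x ] w x ≢ 0ℤ) × (∀ x → x ∉ D → w x ≡ 0ℤ)) ⊎
        (∃[ B ] (IsBasisA A B × (∀ x → x ∈ B → x ∉ D)))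
      choose (inj₁ (i , i∉)) = inj₁ (bordered A rows cols i , bordered-row-space A rows cols i
        , missing-row⇒cocircuit rows cols nonsing i i∉ , border i)
      choose (inj₂ onto) = inj₂ (image cols , spanning-rows⇒basis rows cols nonsing onto , avoid)
        where
        avoid : ∀ x → x ∈ image cols → x ∉ D
        avoid x x∈ with Equivalence.to (∈-image cols x) x∈
        ... | j , refl = within j

    extend-to-basis : ∀ {k} (ρ : Fin k → Fin r) (κ : Fin k → Fin n) → Nonsingular A ρ κ →
      ∃[ B ] (IsBasisA A B × (∀ j → κ j ∈ B))
    extend-to-basis ρ κ ns with maximal A {λ _ → ⊤} {λ _ → ⊤} (λ _ → yes tt) (λ _ _ → tt) ρ κ ns (λ _ → tt)
    ... | m = image cols , spanning-rows⇒basis rows cols nonsing onto ,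
      λ j → Equivalence.from (∈-image cols (κ j)) (extends j)
      where
      open Maximal m
      onto : ∀ i → ∃[ a ] rows a ≡ i
      onto i with any? (λ a → rows a ≟ i)
      ... | yes p = p
      ... | no none with missing-row⇒cocircuit rows cols nonsing i (λ a eq → none (a , eq))
      ...   | x , neq = contradiction (border i x tt) neq

    dependent-or-basis : ∀ (D : Subset n) →
      (Σ[ v ∈ Vect n ] Kernel A v × (∃[ x ] v x ≢ 0ℤ) × (∀ x → x ∉ D → v x ≡ 0ℤ)) ⊎
      (∃[ B ] (IsBasisA A B × (∀ x → x ∈ D → x ∈ B)))
    dependent-or-basis D with from-empty A (λ x → x ∈? D)
    ... | m = choose (search λ g → used g (g ∈? D) (any? λ j → cols j ≟ g))
      where
      open Maximal m
      Unused Used : Fin n → Set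
      Unused g = g ∈ D × (∀ j → cols j ≢ g)
      Used g = g ∈ D → ∃[ j ] cols j ≡ g
      used : ∀ g → Dec (g ∈ D) → Dec (∃[ j ] cols j ≡ g) → Unused g ⊎ Used g
      used g (no g∉D) _ = inj₂ λ g∈D → contradiction g∈D g∉D
      used g (yes _) (yes p) = inj₂ λ _ → p
      used g (yes g∈D) (no none) = inj₁ (g∈D , λ j eq → none (j , eq))
      choose : ∃ Unused ⊎ (∀ g → Used g) →
        (Σ[ v ∈ Vect n ] Kernel A v × (∃[ x ] v x ≢ 0ℤ) × (∀ x → x ∉ D → v x ≡ 0ℤ)) ⊎
        (∃[ B ] (IsBasisA A B × (∀ x → x ∈ D → x ∈ B)))
      choose (inj₁ (g , g∈D , g∉)) = inj₁ (circuit-vector A rows cols g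
        , circuit-vector-kernel A rows cols g (λ i → border i g g∈D)
        , (g , nonsing ∘ trans (sym (circuit-vector-at A rows cols g nonsing g∉)))
        , λ x x∉D → circuit-vector-off A rows cols g x (λ { refl → x∉D g∈D }) λ { j refl → x∉D (within j) })
      choose (inj₂ all-used) with extend-to-basis rows cols nonsing
      ... | B , basis , sub = inj₂ (B , basis , λ x x∈D → contained x (all-used x x∈D))
        where
        contained : ∀ x → ∃[ j ] cols j ≡ x → x ∈ B
        contained x (j , refl) = sub j

-- Supports; signed circuits and cocircuits as elementary vectors.

supp-∈ : ∀ {n} (c : Chain n) x → x ∈ supp c → lookup c x ≢ 0ℤ
supp-∈ c x x∈ eq with lookup c x | trans (sym (lookup-map x (λ z → not (isZero z)) c)) ([]=⇒lookup x∈)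
supp-∈ c x x∈ refl | .0ℤ | ()

∈-supp : ∀ {n} (c : Chain n) x → lookup c x ≢ 0ℤ → x ∈ supp c
∈-supp c x cx≢0 = lookup⇒[]= x (supp c) (trans (lookup-map x (λ z → not (isZero z)) c) (nonzero (lookup c x) cx≢0))
  where
  nonzero : ∀ z → z ≢ 0ℤ → not (isZero z) ≡ true
  nonzero (+ zero) z≢0 = contradiction refl z≢0
  nonzero +[1+ _ ] _ = refl
  nonzero -[1+ _ ] _ = refl

∉-supp : ∀ {n} (c : Chain n) x → x ∉ supp c → lookup c x ≡ 0ℤ
∉-supp c x x∉ with lookup c x ℤP.≟ 0ℤ
... | yes eq = eq
... | no neq = contradiction (∈-supp c x neq) x∉

∈-supp-tabulate : ∀ {n} (v : Vect n) x → v x ≢ 0ℤ → x ∈ supp (tabulate v)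
∈-supp-tabulate v x vx≢0 = ∈-supp (tabulate v) x (vx≢0 ∘ trans (sym (lookup∘tabulate v x)))

supp-tabulate-∈ : ∀ {n} (v : Vect n) x → x ∈ supp (tabulate v) → v x ≢ 0ℤ
supp-tabulate-∈ v x x∈ = supp-∈ (tabulate v) x x∈ ∘ trans (lookup∘tabulate v x)

module SignedCircuits {r n : ℕ} (A : Matrix r n) (unimodular : TotallyUnimodular A) (full-rank : FullRowRank A) where

  private
    R : RegularPair (Kernel A) (RowSpace A)
    R = matrix-pair A unimodular
  open RegularPair R

  kernel⇒dependent : ∀ {v : Vect n} → Kernel A v → ∃[ x ] v x ≢ 0ℤ → InNoBasis A (supp (tabulate v))
  kernel⇒dependent {v} Vv (x , vx≢0) B basis sub = vx≢0 (basis-independent A {v = v} basis Vv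
    (λ y vy≢0 → sub (∈-supp-tabulate v y vy≢0)) x)

  row-space⇒codependent : ∀ {w : Vect n} → RowSpace A w → ∃[ x ] w x ≢ 0ℤ → MeetsEveryBasis A (supp (tabulate w))
  row-space⇒codependent {w} Ww (x , wx≢0) B basis with any? (λ y → ¬? (w y ℤP.≟ 0ℤ) ×-dec (y ∈? B))
  ... | yes (y , wy≢0 , y∈B) = y , ∈-supp-tabulate w y wy≢0 , y∈B
  ... | no none = contradiction
    (basis-spanning A {w = w} basis Ww (λ y wy≢0 y∈B → none (y , wy≢0 , y∈B)) x) wx≢0

  -- A set contained in no basis carries a nonzero kernel vector, so minimality among supports
  -- yields minimality among dependent sets.
  elementary⇒circuit : ∀ {c} → Elementary (Kernel A) c → IsCircuitA A (supp (tabulate c))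
  elementary⇒circuit {c} E = kernel⇒dependent member nonzero , smallest
    where
    open Elementary E
    smallest : ∀ D → D ⊆ supp (tabulate c) → InNoBasis A D → supp (tabulate c) ⊆ D
    smallest D D⊆c dependent with dependent-or-basis A full-rank D
    ... | inj₂ (B , basis , D⊆B) = contradiction (λ {x} → D⊆B x) (dependent B basis)
    ... | inj₁ (v , Vv , nz , outside) = λ x∈c → inside _ x∈c (_ ∈? D)
      where
      sub : ∀ x → c x ≡ 0ℤ → v x ≡ 0ℤ
      sub x cx≡0 = outside x λ x∈D → supp-tabulate-∈ c x (D⊆c x∈D) cx≡0
      inside : ∀ x → x ∈ supp (tabulate c) → Dec (x ∈ D) → x ∈ D
      inside x _ (yes x∈D) = x∈D
      inside x x∈c (no x∉D) = contradiction (minimal Vv nz sub x (outside x x∉D)) (supp-tabulate-∈ c x x∈c)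

  elementary⇒cocircuit : ∀ {c} → Elementary (RowSpace A) c → IsCocircuitA A (supp (tabulate c))
  elementary⇒cocircuit {c} E = row-space⇒codependent member nonzero , smallest
    where
    open Elementary E
    smallest : ∀ D → D ⊆ supp (tabulate c) → MeetsEveryBasis A D → supp (tabulate c) ⊆ D
    smallest D D⊆c meets with codependent-or-basis A full-rank D
    ... | inj₂ (B , basis , disjoint) with meets B basis
    ...   | x , x∈D , x∈B = contradiction x∈D (disjoint x x∈B)
    smallest D D⊆c meets | inj₁ (w , Ww , nz , outside) = λ x∈c → inside _ x∈c (_ ∈? D)
      where
      sub : ∀ x → c x ≡ 0ℤ → w x ≡ 0ℤ
      sub x cx≡0 = outside x λ x∈D → supp-tabulate-∈ c x (D⊆c x∈D) cx≡0
      inside : ∀ x → x ∈ supp (tabulate c) → Dec (x ∈ D) → x ∈ D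
      inside x _ (yes x∈D) = x∈D
      inside x x∈c (no x∉D) = contradiction (minimal Ww nz sub x (outside x x∉D)) (supp-tabulate-∈ c x x∈c)

  elementary⇒SC : ∀ {c} → Elementary (Kernel A) c → SC (MA A) (tabulate c)
  elementary⇒SC {c} E = (λ x → subst IsTrit (sym (lookup∘tabulate c x)) (Elementary.simple E x))
    , V-ext (λ x → sym (lookup∘tabulate c x)) (Elementary.member E) , elementary⇒circuit E

  elementary⇒SCo : ∀ {c} → Elementary (RowSpace A) c → SCo (MA A) (tabulate c)
  elementary⇒SCo {c} E = (λ x → subst IsTrit (sym (lookup∘tabulate c x)) (Elementary.simple E x))
    , W-ext (λ x → sym (lookup∘tabulate c x)) (Elementary.member E) , elementary⇒cocircuit E

  -- The basis excludes the zero chain: its empty support lies in that basis, hence is not a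
  -- circuit.
  SC⇒elementary : ∀ {B} → IsBasisA A B → ∀ {c} → SC (MA A) c → Elementary (Kernel A) (lookup c)
  SC⇒elementary {B} basis {c} (simple , Vc , dependent , smallest) = record
    { member = Vc ; simple = simple ; nonzero = nonzero ; minimal = minimal }
    where
    nonzero : ∃[ x ] lookup c x ≢ 0ℤ
    nonzero with zero-or-not (lookup c)
    ... | inj₁ p = p
    ... | inj₂ zeros = contradiction (λ {x} x∈c → contradiction (zeros x) (supp-∈ c x x∈c)) (dependent B basis)
    minimal : ∀ {v} → Kernel A v → (∃[ x ] v x ≢ 0ℤ) → (∀ x → lookup c x ≡ 0ℤ → v x ≡ 0ℤ) →
      ∀ x → v x ≡ 0ℤ → lookup c x ≡ 0ℤ
    minimal {v} Vv nz sub x vx≡0 = ∉-supp c x λ x∈c → supp-tabulate-∈ v x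
      (smallest (supp (tabulate v)) (λ {y} y∈v → ∈-supp c y (supp-tabulate-∈ v y y∈v ∘ sub y))
        (kernel⇒dependent Vv nz) x∈c) vx≡0

  SCo⇒elementary : ∀ {B} → IsBasisA A B → ∀ {c} → SCo (MA A) c → Elementary (RowSpace A) (lookup c)
  SCo⇒elementary {B} basis {c} (simple , Wc , meets , smallest) = record
    { member = Wc ; simple = simple ; nonzero = nonzero ; minimal = minimal }
    where
    nonzero : ∃[ x ] lookup c x ≢ 0ℤ
    nonzero with meets B basis
    ... | x , x∈c , _ = x , supp-∈ c x x∈c
    minimal : ∀ {w} → RowSpace A w → (∃[ x ] w x ≢ 0ℤ) → (∀ x → lookup c x ≡ 0ℤ → w x ≡ 0ℤ) →
      ∀ x → w x ≡ 0ℤ → lookup c x ≡ 0ℤ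
    minimal {w} Ww nz sub x wx≡0 = ∉-supp c x λ x∈c → supp-tabulate-∈ w x
      (smallest (supp (tabulate w)) (λ {y} y∈w → ∈-supp c y (supp-tabulate-∈ w y y∈w ∘ sub y))
        (row-space⇒codependent Ww nz) x∈c) wx≡0

-- Translation between sign sets, sign predicates, chains and subsets.

==-sound : ∀ o s → T (o == s) → o ≡ s
==-sound plus plus _ = refl
==-sound minus minus _ = refl

∨-elim : ∀ {a b} → T (a ∨ b) → T a ⊎ T b
∨-elim {true} _ = inj₁ tt
∨-elim {false} t = inj₂ t

signIs-∈ : ∀ z s {F} → SignIs z s → z ∈ˢ F → T (F s)
signIs-∈ (+ zero) plus (+<+ ()) _
signIs-∈ (+ zero) minus (+<+ ()) _
signIs-∈ +[1+ _ ] plus _ t = t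
signIs-∈ +[1+ _ ] minus (+<+ ()) _
signIs-∈ -[1+ _ ] plus () _
signIs-∈ -[1+ _ ] minus _ t = t

nonzero⇒signIs : ∀ z → z ≢ 0ℤ → ∃[ s ] SignIs z s
nonzero⇒signIs (+ zero) z≢0 = contradiction refl z≢0
nonzero⇒signIs +[1+ _ ] _ = plus , +<+ (s≤s z≤n)
nonzero⇒signIs -[1+ _ ] _ = minus , -<+

opposite-signs : ∀ {a b s t} → IsTrit a → IsTrit b → SignIs a s → SignIs b t → s ≢ t → a + b ≡ 0ℤ
opposite-signs {s = plus} {plus} _ _ _ _ s≢t = contradiction refl s≢t
opposite-signs {s = minus} {minus} _ _ _ _ s≢t = contradiction refl s≢t
opposite-signs {s = plus} {minus} (inj₂ (inj₂ refl)) (inj₁ refl) _ _ _ = refl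
opposite-signs {s = minus} {plus} (inj₁ refl) (inj₂ (inj₂ refl)) _ _ _ = refl
opposite-signs {s = plus} {minus} (inj₁ refl) _ () _ _
opposite-signs {s = plus} {minus} (inj₂ (inj₁ refl)) _ (+<+ ()) _ _
opposite-signs {s = plus} {minus} (inj₂ (inj₂ refl)) (inj₂ (inj₁ refl)) _ (+<+ ()) _
opposite-signs {s = plus} {minus} (inj₂ (inj₂ refl)) (inj₂ (inj₂ refl)) _ (+<+ ()) _
opposite-signs {s = minus} {plus} (inj₂ (inj₁ refl)) _ (+<+ ()) _ _
opposite-signs {s = minus} {plus} (inj₂ (inj₂ refl)) _ (+<+ ()) _ _
opposite-signs {s = minus} {plus} (inj₁ refl) (inj₁ refl) _ () _
opposite-signs {s = minus} {plus} (inj₁ refl) (inj₂ (inj₁ refl)) _ (+<+ ()) _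

chain-ext : ∀ {n} {c d : Chain n} → (∀ x → lookup c x ≡ lookup d x) → c ≡ d
chain-ext {c = c} {d} eq = trans (sym (tabulate∘lookup c)) (trans (tabulate-cong eq) (tabulate∘lookup d))

restr-off : ∀ {n} (e : Fin n) c x → x ≢ e → lookup (restr e c) x ≡ lookup c x
restr-off e c x x≢e = lookup∘update′ x≢e c 0ℤ

restr-at : ∀ {n} (e : Fin n) c → lookup (restr e c) e ≡ 0ℤ
restr-at e c = lookup∘update e c 0ℤ

Within : ∀ {n} → Chain n → (Fin n → Set) → Fin n → Set
Within c P x = ∀ y → lookup c y ≢ 0ℤ → P y ⊎ y ≡ x

⊆⇒within : ∀ {n} (c : Chain n) p x → supp c ⊆ (p ∪ ⁅ x ⁆) → Within c (_∈ p) x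
⊆⇒within c p x sub y cy≢0 = Sum.map₂ (x∈⁅y⁆⇒x≡y x) (x∈p∪q⁻ p ⁅ x ⁆ (sub (∈-supp c y cy≢0)))

within⇒⊆ : ∀ {n} (c : Chain n) p x → Within c (_∈ p) x → supp c ⊆ (p ∪ ⁅ x ⁆)
within⇒⊆ c p x within {y} y∈c = x∈p∪q⁺ (Sum.map₂ (λ { refl → x∈⁅x⁆ x }) (within y (supp-∈ c y y∈c)))

∈⇒T : ∀ {n} {B : Subset n} {x} → x ∈ B → T (lookup B x)
∈⇒T x∈B = subst T (sym ([]=⇒lookup x∈B)) tt

∉⇒T-not : ∀ {n} {B : Subset n} {x} → x ∉ B → T (not (lookup B x))
∉⇒T-not {B = B} {x} x∉B with lookup B x in eq
... | true = contradiction (lookup⇒[]= x B eq) x∉B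
... | false = tt

T⇒∈ : ∀ {n} {B : Subset n} {x} → T (lookup B x) → x ∈ B
T⇒∈ {B = B} {x} t with lookup B x in eq
... | true = lookup⇒[]= x B eq

T-not⇒∉ : ∀ {n} {B : Subset n} {x} → T (not (lookup B x)) → x ∉ B
T-not⇒∉ t x∈B = T-not-contra (∈⇒T x∈B) t

-- Signed circuits of minors and the action there.

module _ {n} {V W : Vect n → Set} (R : RegularPair V W) (e : Fin n) where
  open RegularPair R

  deletionV-elementary : ∀ {c} → Elementary (DeletionV R e) c → Elementary V c × c e ≡ 0ℤ
  deletionV-elementary E with Elementary.member E
  ... | at-zero Vc ce≡0 = record
    { member = Vc ; simple = simple ; nonzero = nonzero
    ; minimal = λ Vv nz sub → minimal (at-zero Vv (sub e ce≡0)) nz sub } , ce≡0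
    where open Elementary E

  module _ {P : Chain n → Set} (elementary⇒P : ∀ {c} → Elementary V c → P (tabulate c)) where

    deletionV⇒restriction : ∀ {c} → Elementary (DeletionV R e) c → RestrOfZero e P (tabulate c)
    deletionV⇒restriction {c} E with deletionV-elementary E
    ... | E′ , ce≡0 = tabulate c , elementary⇒P E′ , trans (lookup∘tabulate c e) ce≡0 , chain-ext same
      where
      same : ∀ x → lookup (tabulate c) x ≡ lookup (restr e (tabulate c)) x
      same x with x ≟ e
      ... | yes refl = trans (lookup∘tabulate c e) (trans ce≡0 (sym (restr-at e (tabulate c))))
      ... | no x≢e = sym (restr-off e (tabulate c) x x≢e)

  module _ {P : Chain n → Set} (elementary⇒P : ∀ {c} → Elementary W c → P (tabulate c))
    (P⇒W : ∀ {c} → P c → W (lookup c)) where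

    -- Lift `c` to `W` and take an elementary `d` conformal to the lift: its restriction lies inside
    -- `c`, so it has the same support by minimality and the same entries by conformality.
    deletionW⇒minimal-restriction : ∀ {c} → Elementary (DeletionW R e) c → c e ≡ 0ℤ → MinRestrOf e P (tabulate c)
    deletionW⇒minimal-restriction {c} E ce≡0 with Elementary.member E | Elementary.nonzero E
    ... | u , Wu , off | g , cg≢0 with elementary-through (swap R) {u} {g} Wu ug≢0
      where
      ug≢0 : u g ≢ 0ℤ
      ug≢0 ug≡0 = cg≢0 (trans (off g (λ { refl → cg≢0 ce≡0 })) ug≡0)
    ...   | d , D , dg≢0 , conf = (tabulate d , elementary⇒P D , chain-ext same)
      , (g , cg≢0 ∘ trans (sym (lookup∘tabulate c g))) , smallest
      where
      open Elementary E
      d′ : Vect n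
      d′ = lookup (restr e (tabulate d))
      d′-off : ∀ x → x ≢ e → d′ x ≡ d x
      d′-off x x≢e = trans (restr-off e (tabulate d) x x≢e) (lookup∘tabulate d x)
      sub : ∀ x → c x ≡ 0ℤ → d′ x ≡ 0ℤ
      sub x cx≡0 with x ≟ e
      ... | yes refl = restr-at e (tabulate d)
      ... | no x≢e = trans (d′-off x x≢e) (∈-signsOf-zero (d x) (conf x) (trans (sym (off x x≢e)) cx≡0))
      d′g≢0 : d′ g ≢ 0ℤ
      d′g≢0 = dg≢0 ∘ trans (sym (d′-off g λ { refl → cg≢0 ce≡0 }))
      super : ∀ x → d′ x ≡ 0ℤ → c x ≡ 0ℤ
      super = minimal (d , Elementary.member D , d′-off) (g , d′g≢0) sub
      same : ∀ x → lookup (tabulate c) x ≡ d′ x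
      same x with c x ℤP.≟ 0ℤ
      ... | yes cx≡0 = trans (lookup∘tabulate c x) (trans cx≡0 (sym (sub x cx≡0)))
      ... | no cx≢0 = trans (lookup∘tabulate c x) (trans (sym dx≡cx) (sym (d′-off x x≢e)))
        where
        x≢e : x ≢ e
        x≢e refl = cx≢0 ce≡0
        dx≡cx : d x ≡ c x
        dx≡cx = trit-conformal-≡ (simple x) (Elementary.simple D x)
          (λ dx≡0 → cx≢0 (super x (trans (d′-off x x≢e) dx≡0)))
          (subst (λ a → d x ∈ˢ signsOf a) (sym (off x x≢e)) (conf x))
      smallest : ∀ k → RestrOf e P k → NonZeroChain k → supp k ⊆ supp (tabulate c) → supp (tabulate c) ⊆ supp k
      smallest k (k₀ , Pk₀ , refl) nz k⊆c {x} x∈c = ∈-supp k x λ kx≡0 → supp-tabulate-∈ c x x∈c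
        (minimal (lookup k₀ , P⇒W Pk₀ , restr-off e k₀) nz
          (λ y cy≡0 → ∉-supp k y λ y∈k → supp-tabulate-∈ c y (k⊆c y∈k) cy≡0) x kx≡0)

  -- The equation is first made valid at `e` as well, by giving `q` the sign of `p` there and
  -- clearing `w`; orientations that differ only at `e` are the same in the minor.
  minor-act : (N : SMat n) → (∀ x → Gr N x → x ≢ e) →
    Moves.Reversible N (_≡ e) (DeletionV R e) → Moves.Reversible N (_≡ e) (DeletionW R e) →
    ∀ f s (p q : Orientation n) → e ≢ f → ∀ {z w} → V z → W w → z e ≡ 0ℤ →
    (∀ x → x ≢ e → δ (lookup p x) (lookup q x) ≡ z x + w x + arc f s x) → ArcAct N f s p q
  minor-act N ground movesV movesW f s p q e≢f {z} {w} Vz Ww ze≡0 difference = adjust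
    (Moves.arc-act N (_≡ e) D movesV movesW f s p q′ (at-zero Vz ze≡0) (w , Ww , clear-off e w)
      (λ { x refl → ze≡0 }) (λ { x refl → clear-at e w }) difference′ through)
    where
    D = deletion-pair R e
    q′ : Orientation n
    q′ = q [ e ]≔ lookup p e
    adjust : ArcAct N f s p q′ → ArcAct N f s p q
    adjust (o , e₁ , of , e₂) = o , e₁ , of ,
      Equiv.trans e₂ (agree λ x gr → lookup∘update′ (ground x gr) q (lookup p e))
    difference′ : ∀ x → δ (lookup p x) (lookup q′ x) ≡ z x + clear e w x + arc f s x
    difference′ x = by (x ≟ e)
      where
      by : Dec (x ≡ e) → δ (lookup p x) (lookup q′ x) ≡ z x + clear e w x + arc f s x
      by (yes refl) = trans (cong (δ (lookup p e)) (lookup∘update e q (lookup p e)))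
        (trans (δ-self (lookup p e)) (sym (cong₂ _+_ (cong₂ _+_ ze≡0 (clear-at e w)) (arc-off f s e e≢f))))
      by (no x≢e) = trans (cong (δ (lookup p x)) (lookup∘update′ x≢e q (lookup p e)))
        (trans (difference x x≢e) (cong (λ a → z x + a + arc f s x) (sym (clear-off e w x x≢e))))
    colouring : Fin n → Sign → Bool
    -- With both signs allowed at `e` the dual colouring is empty there, so a painted vector of
    -- `DeletionW` vanishes at `e`; one of `DeletionV` does so anyway.
    colouring = recolour (λ x → lookup p x ==_) e true
    self-dual : ∀ o a → a ∈ˢ dual (o ==_) → a ∈ˢ (o ==_)
    self-dual _ (+ zero) _ = tt
    self-dual plus +[1+ _ ] t = t
    self-dual minus +[1+ _ ] t = t
    self-dual plus -[1+ _ ] t = t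
    self-dual minus -[1+ _ ] t = t
    none-zero : ∀ {a} → a ∈ˢ (λ _ → false) → a ≡ 0ℤ
    none-zero {+ zero} _ = refl
    through : ∀ t → Σ[ v ∈ Vect n ] (DeletionV R e v ⊎ DeletionW R e v) × Simple v ×
      (∀ x → x ≡ e → v x ≡ 0ℤ) × v f ≡ sgn t × (∀ x → x ≢ f → v x ∈ˢ (lookup p x ==_))
    through t with paint D colouring f t
    ... | inj₁ (v , at-zero Vv ve≡0 , sv , vf , ok) =
      v , inj₁ (at-zero Vv ve≡0) , sv , (λ { x refl → ve≡0 }) , vf , fits
      where
      fits : ∀ x → x ≢ f → v x ∈ˢ (lookup p x ==_)
      fits x x≢f with x ≟ e
      ... | yes refl = zero-∈ˢ (lookup p e ==_) ve≡0
      ... | no x≢e = subst (v x ∈ˢ_) (recolour-other (λ x → lookup p x ==_) e true x x≢e) (ok x x≢f)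
    ... | inj₂ (v , Wv , sv , vf , ok) = v , inj₂ Wv , sv , (λ { x refl → ve≡0 }) , vf , fits
      where
      ve≡0 : v e ≡ 0ℤ
      ve≡0 = none-zero (∈ˢ-mono (v e)
        (λ s → subst (T ∘ not) (recolour-same (λ x → lookup p x ==_) e true (flipS s))) (ok e e≢f))
      fits : ∀ x → x ≢ f → v x ∈ˢ (lookup p x ==_)
      fits x x≢f with x ≟ e
      ... | yes refl = zero-∈ˢ (lookup p e ==_) ve≡0
      ... | no x≢e = self-dual (lookup p x) (v x)
        (subst (λ G → v x ∈ˢ dual G) (recolour-other (λ x → lookup p x ==_) e true x x≢e) (ok x x≢f))

-- A chosen signed circuit whose restriction is a restriction of a circuit avoiding e avoids e itself.
avoids : ∀ {n} {U : Vect n → Set} {e : Fin n} {c c′ d : Chain n} → Elementary U (lookup c) →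
  Elementary U (lookup c′) → lookup c′ e ≡ 0ℤ → d ≡ restr e c → d ≡ restr e c′ → lookup c e ≡ 0ℤ
avoids {e = e} {c} {c′} E E′ c′e≡0 d≡c d≡c′ =
  Elementary.minimal E (Elementary.member E′) (Elementary.nonzero E′) sub e c′e≡0
  where
  sub : ∀ y → lookup c y ≡ 0ℤ → lookup c′ y ≡ 0ℤ
  sub y cy≡0 with y ≟ e
  ... | yes refl = c′e≡0
  ... | no y≢e = trans (sym (restr-off e c′ y y≢e)) (trans (cong (λ k → lookup k y) (trans (sym d≡c′) d≡c))
    (trans (restr-off e c y y≢e) cy≡0))

-- The orientations `β(B)`, their lifts from minors, and the three claims.

module Theorem {r n : ℕ} (A : Matrix r n) (unimodular : TotallyUnimodular A) (full-rank : FullRowRank A)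
  (σ σ* : Chain n → Set) (signature : CircuitSignature (MA A) σ) (cosignature : CocircuitSignature (MA A) σ*)
  (triangulating : Triangulating (MA A) σ σ*) where

  R : RegularPair (Kernel A) (RowSpace A)
  R = matrix-pair A unimodular
  open RegularPair R
  open SignedCircuits A unimodular full-rank

  BBYAt : Subset n → Fin n → Sign → Set
  BBYAt B x s =
      (x ∈ B → ∃[ c ] (σ* c × supp c ⊆ (∁ B ∪ ⁅ x ⁆) × SignIs (lookup c x) s))
    × (x ∉ B → ∃[ c ] (σ c × supp c ⊆ (B ∪ ⁅ x ⁆) × SignIs (lookup c x) s))

  MinorBBY : Fin n → SMat n → Subset n → Orientation n → Set
  MinorBBY e N = IsBBY N (minorSig e σ (SC N)) (minorSig e σ* (SCo N))

  BBY : Subset n → Orientation n → Set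
  BBY = IsBBY (MA A) σ σ*

  choose-signed : ∀ {S τ : Chain n → Set} → IsSignature (MA A) S τ → ∀ {P : Fin n → Set} {x} {c : Vect n} →
    S (tabulate c) → c x ≢ 0ℤ → (∀ y → c y ≢ 0ℤ → P y ⊎ y ≡ x) →
    ∃[ s ] ∃[ d ] (τ d × Within d P x × SignIs (lookup d x) s)
  choose-signed (_ , total , _) {x = x} {c} Sc cx≢0 within with total (tabulate c) Sc
  ... | inj₁ τc with nonzero⇒signIs (lookup (tabulate c) x) (cx≢0 ∘ trans (sym (lookup∘tabulate c x)))
  ...   | s , is = s , tabulate c , τc , (λ y cy≢0 → within y (cy≢0 ∘ trans (lookup∘tabulate c y))) , is
  choose-signed (_ , total , _) {x = x} {c} Sc cx≢0 within | inj₂ τc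
    with nonzero⇒signIs (lookup (negC (tabulate c)) x) (cx≢0 ∘ neg≡0 ∘ trans (sym (value x)))
    where
    value : ∀ y → lookup (negC (tabulate c)) y ≡ - c y
    value y = trans (lookup-map y (λ z → - z) (tabulate c)) (cong -_ (lookup∘tabulate c y))
  ... | s , is = s , negC (tabulate c) , τc , (λ y cy≢0 → within y λ cy≡0 → cy≢0 (trans (value y) (cong -_ cy≡0))) , is
    where
    value : ∀ y → lookup (negC (tabulate c)) y ≡ - c y
    value y = trans (lookup-map y (λ z → - z) (tabulate c)) (cong -_ (lookup∘tabulate c y))

  -- Painting at `x` with `B` as the colour class gives the fundamental circuit or cocircuit: the
  -- other outcome would be a nonzero kernel vector inside `B` or a nonzero row-space vector
  -- avoiding it. The signature then fixes the sign.
  bby-sign : ∀ {B} → IsBasisA A B → ∀ x → ∃[ s ] BBYAt B x s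
  bby-sign {B} basis x = by (x ∈? B)
    where
    by : Dec (x ∈ B) → ∃[ s ] BBYAt B x s
    by (no x∉B) with two-colour A unimodular (lookup B) x
    ... | inj₂ (w , Ww , _ , wx , wz) = contradiction
      (trans (sym wx) (basis-spanning A {w = w} basis Ww
        (λ y wy≢0 y∈B → wy≢0 (wz y (λ { refl → x∉B y∈B }) (∈⇒T y∈B))) x)) 1≢0
    ... | inj₁ (v , Vv , _ , vx , vz)
      with elementary-through R {v} {x} Vv (1≢0 ∘ trans (sym vx))
    ...   | c , C , cx≢0 , conf
      with choose-signed signature {_∈ B} {x} {c} (elementary⇒SC C) cx≢0 within
      where
      within : ∀ y → c y ≢ 0ℤ → y ∈ B ⊎ y ≡ x
      within y cy≢0 with y ∈? B | y ≟ x
      ... | yes y∈B | _ = inj₁ y∈B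
      ... | no _ | yes y≡x = inj₂ y≡x
      ... | no y∉B | no y≢x = contradiction (∈-signsOf-zero (c y) (conf y) (vz y y≢x (∉⇒T-not y∉B))) cy≢0
    ...     | s , d , σd , sub , is =
      s , (λ x∈B → contradiction x∈B x∉B) , λ _ → d , σd , within⇒⊆ d B x sub , is
    by (yes x∈B) with two-colour A unimodular (lookup B) x
    ... | inj₁ (v , Vv , _ , vx , vz) = contradiction
      (trans (sym vx) (basis-independent A {v = v} basis Vv inside x)) 1≢0
      where
      inside : ∀ y → v y ≢ 0ℤ → y ∈ B
      inside y vy≢0 with y ∈? B
      ... | yes y∈B = y∈B
      ... | no y∉B = contradiction (vz y (λ { refl → y∉B x∈B }) (∉⇒T-not y∉B)) vy≢0
    ... | inj₂ (w , Ww , _ , wx , wz)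
      with elementary-through (swap R) {w} {x} Ww (1≢0 ∘ trans (sym wx))
    ...   | c , C , cx≢0 , conf
      with choose-signed cosignature {_∈ ∁ B} {x} {c} (elementary⇒SCo C) cx≢0 within
      where
      within : ∀ y → c y ≢ 0ℤ → y ∈ ∁ B ⊎ y ≡ x
      within y cy≢0 with y ∈? B | y ≟ x
      ... | no y∉B | _ = inj₁ (x∉p⇒x∈∁p y∉B)
      ... | yes _ | yes y≡x = inj₂ y≡x
      ... | yes y∈B | no y≢x = contradiction (∈-signsOf-zero (c y) (conf y) (wz y y≢x (∈⇒T y∈B))) cy≢0
    ...     | s , d , σd , sub , is =
      s , (λ _ → d , σd , within⇒⊆ d (∁ B) x sub , is) , λ x∉B → contradiction x∈B x∉B

  -- The action hypothesis speaks of all orientations representing `β(B)`; this supplies one to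
  -- apply it to.
  bby : ∀ {B} → IsBasisA A B → ∃[ o ] BBY B o
  bby {B} basis = tabulate (proj₁ ∘ bby-sign basis) , λ x _ →
    subst (BBYAt B x) (sym (lookup∘tabulate (proj₁ ∘ bby-sign basis) x)) (proj₂ (bby-sign basis x))

  -- A minor leaves the sign at `e` open; filling in the one dictated by the whole matroid makes the
  -- action hypothesis applicable.
  extend-bby : ∀ {B} (e : Fin n) → IsBasisA A B → (p : Orientation n) → (∀ x → x ≢ e → BBYAt B x (lookup p x)) →
    ∃[ o ] (BBY B o × (∀ x → x ≢ e → lookup o x ≡ lookup p x))
  extend-bby {B} e basis p at = p [ e ]≔ s , (λ x _ → by x (x ≟ e)) , λ x x≢e → lookup∘update′ x≢e p s
    where
    s = proj₁ (bby-sign basis e)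
    by : ∀ x → Dec (x ≡ e) → BBYAt B x (lookup (p [ e ]≔ s) x)
    by x (yes refl) = subst (BBYAt B e) (sym (lookup∘update e p s)) (proj₂ (bby-sign basis e))
    by x (no x≢e) = subst (BBYAt B x) (sym (lookup∘update′ x≢e p s)) (at x x≢e)

  -- With opposite signs at `x` the sum `c + d` vanishes there, so it is supported in `P` and zero;
  -- then `d` is the negative of `c`, which a signature cannot choose as well.
  sign-unique : ∀ {S τ : Chain n → Set} {U : Vect n → Set} → IsSignature (MA A) S τ →
    (∀ {c} → S c → IsSimple c × U (lookup c)) → (∀ {u v} → U u → U v → U (λ y → u y + v y)) →
    ∀ {P : Fin n → Set} {x} → (∀ u → U u → (∀ y → u y ≢ 0ℤ → P y) → ∀ y → u y ≡ 0ℤ) →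
    ∀ {c d s t} → τ c → τ d → Within c P x → Within d P x → SignIs (lookup c x) s → SignIs (lookup d x) t → s ≡ t
  sign-unique (τ⊆S , _ , asym) vector add {x = x} trivial {c} {d} {s} {t} τc τd wc wd is it with s ≟ˢ t
  ... | yes eq = eq
  ... | no s≢t = contradiction (subst _ d≡-c τd) (asym c τc)
    where
    C = vector (τ⊆S c τc)
    D = vector (τ⊆S d τd)
    cancel : lookup c x + lookup d x ≡ 0ℤ
    cancel = opposite-signs (proj₁ C x) (proj₁ D x) is it s≢t
    inside : ∀ y → lookup c y + lookup d y ≢ 0ℤ → _
    inside y sum≢0 with lookup c y ℤP.≟ 0ℤ | lookup d y ℤP.≟ 0ℤ
    ... | yes cy≡0 | yes dy≡0 = contradiction (cong₂ _+_ cy≡0 dy≡0) sum≢0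
    ... | no cy≢0 | _ = [ id , (λ { refl → contradiction cancel sum≢0 }) ]′ (wc y cy≢0)
    ... | yes _ | no dy≢0 = [ id , (λ { refl → contradiction cancel sum≢0 }) ]′ (wd y dy≢0)
    sum≡0 : ∀ y → lookup c y + lookup d y ≡ 0ℤ
    sum≡0 = trivial (λ y → lookup c y + lookup d y) (add (proj₂ C) (proj₂ D)) inside
    negation : ∀ a b → a + b ≡ 0ℤ → b ≡ - a
    negation a b eq = +-cancelˡ a b (- a) (trans eq (sym (ℤP.+-inverseʳ a)))
    d≡-c : d ≡ negC c
    d≡-c = chain-ext λ y → trans (negation (lookup c y) (lookup d y) (sum≡0 y))
      (sym (lookup-map y (λ z → - z) c))

  bby-unique : ∀ {B} → IsBasisA A B → ∀ {x s t} → BBYAt B x s → BBYAt B x t → s ≡ t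
  bby-unique {B} basis {x} {s} {t} b b′ = by (x ∈? B)
    where
    by : Dec (x ∈ B) → s ≡ t
    by (yes x∈B) with proj₁ b x∈B | proj₁ b′ x∈B
    ... | c , σc , subc , is | d , σd , subd , it = sign-unique cosignature
      (λ (simple , Wc , _) → simple , Wc) (λ {u} {v} → row-space-+ A {u} {v}) {_∈ ∁ B} {x}
      (λ u Wu inside → basis-spanning A {w = u} basis Wu λ y uy≢0 → x∈∁p⇒x∉p (inside y uy≢0))
      σc σd (⊆⇒within c (∁ B) x subc) (⊆⇒within d (∁ B) x subd) is it
    by (no x∉B) with proj₂ b x∉B | proj₂ b′ x∉B
    ... | c , σc , subc , is | d , σd , subd , it = sign-unique signature
      (λ (simple , Vc , _) → simple , Vc) (λ {u} {v} → kernel-+ A {u} {v}) {_∈ B} {x}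
      (λ u Vu inside → basis-independent A {v = u} basis Vu inside)
      σc σd (⊆⇒within c B x subc) (⊆⇒within d B x subd) is it

  in-Fσ : ∀ {B o} → BBY B o → ∀ x s → T (lookup B x ∨ (lookup o x == s)) → InFσ (MA A) σ B x s
  in-Fσ {B} {o} β x s t = by (x ∈? B)
    where
    by : Dec (x ∈ B) → InFσ (MA A) σ B x s
    by (yes x∈B) = inj₁ x∈B
    by (no x∉B) with proj₂ (β x tt) x∉B | ∨-elim {lookup B x} t
    ... | _ | inj₁ t′ = contradiction (T⇒∈ t′) x∉B
    ... | c , σc , sub , is | inj₂ t′ =
      inj₂ (x∉B , c , σc , sub , subst (SignIs (lookup c x)) (==-sound (lookup o x) s t′) is)

  in-Fσ* : ∀ {B o} → BBY B o → ∀ x s → T (not (lookup B x) ∨ (lookup o x == s)) → InFσ* (MA A) σ* B x s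
  in-Fσ* {B} {o} β x s t = by (x ∈? B)
    where
    by : Dec (x ∈ B) → InFσ* (MA A) σ* B x s
    by (no x∉B) = inj₁ x∉B
    by (yes x∈B) with proj₁ (β x tt) x∈B | ∨-elim {not (lookup B x)} t
    ... | _ | inj₁ t′ = contradiction x∈B (T-not⇒∉ t′)
    ... | c , σc , sub , is | inj₂ t′ =
      inj₂ (x∈B , c , σc , sub , subst (SignIs (lookup c x)) (==-sound (lookup o x) s t′) is)

  module _ {B₁ B₂ : Subset n} (basis₁ : IsBasisA A B₁) (basis₂ : IsBasisA A B₂) where

    b₁ b₂ : Fin n → Bool
    b₁ = lookup B₁
    b₂ = lookup B₂

    module _ {o₁ o₂ : Orientation n} (β₁ : BBY B₁ o₁) (β₂ : BBY B₂ o₂)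
      (distinct : ¬ SameSubset (MA A) B₁ B₂) where

      open Exceptional R b₁ b₂ (lookup o₁) (lookup o₂) using (F; G)

      -- A signed circuit conformal to a nonzero `u` would still fit `F`, which the triangulating
      -- property forbids.
      circuit-free : Free (Kernel A) F
      circuit-free u Vu fits x with u x ℤP.≟ 0ℤ
      ... | yes ux≡0 = ux≡0
      ... | no ux≢0 with elementary-through R {u} {x} Vu ux≢0
      ...   | c , C , _ , conf = contradiction
        (λ y s is → located y s (signIs-∈ (c y) s {F y} (subst (λ a → SignIs a s) (lookup∘tabulate c y) is)
            (∈-signsOf-trans (c y) (u y) {F y} (conf y) (fits y))))
        (proj₁ triangulating B₁ B₂ basis₁ basis₂ distinct (tabulate c) (elementary⇒SC C))
        where
        located : ∀ y s → T (F y s) → InFσ (MA A) σ B₁ y s × InFσ (MA A) σ B₂ y (flipS s)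
        located y s t = in-Fσ {B₁} {o₁} β₁ y s (T-∧ˡ t) , in-Fσ {B₂} {o₂} β₂ y (flipS s) (T-∧ʳ {b₁ y ∨ (lookup o₁ y == s)} t)

      cocircuit-free : Free (RowSpace A) G
      cocircuit-free u Wu fits x with u x ℤP.≟ 0ℤ
      ... | yes ux≡0 = ux≡0
      ... | no ux≢0 with elementary-through (swap R) {u} {x} Wu ux≢0
      ...   | c , C , _ , conf = contradiction
        (λ y s is → located y s (signIs-∈ (c y) s {G y} (subst (λ a → SignIs a s) (lookup∘tabulate c y) is)
            (∈-signsOf-trans (c y) (u y) {G y} (conf y) (fits y))))
        (proj₂ triangulating B₁ B₂ basis₁ basis₂ distinct (tabulate c) (elementary⇒SCo C))
        where
        located : ∀ y s → T (G y s) → InFσ* (MA A) σ* B₁ y s × InFσ* (MA A) σ* B₂ y (flipS s)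
        located y s t = in-Fσ* {B₁} {o₁} β₁ y s (T-∧ˡ t) , in-Fσ* {B₂} {o₂} β₂ y (flipS s) (T-∧ʳ {not (b₁ y) ∨ (lookup o₁ y == s)} t)

    same-or-distinct : (∀ x → b₁ x ≡ b₂ x) ⊎ ¬ SameSubset (MA A) B₁ B₂
    same-or-distinct with all? (λ x → b₁ x 𝔹.≟ b₂ x)
    ... | yes same = inj₁ same
    ... | no differ = inj₂ λ iff → differ λ x → agree-at x (iff x tt)
      where
      agree-at : ∀ x → (x ∈ B₁) ⇔ (x ∈ B₂) → b₁ x ≡ b₂ x
      agree-at x iff with x ∈? B₁
      ... | yes x∈B₁ = trans ([]=⇒lookup x∈B₁) (sym ([]=⇒lookup (Equivalence.to iff x∈B₁)))
      ... | no x∉B₁ with lookup B₁ x in eq₁ | lookup B₂ x in eq₂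
      ...   | false | false = refl
      ...   | true | _ = contradiction (lookup⇒[]= x B₁ eq₁) x∉B₁
      ...   | false | true = contradiction (Equivalence.from iff (lookup⇒[]= x B₂ eq₂)) x∉B₁

    module _ (f : Fin n) (s : Sign)
      (acts : ∀ o₁ o₂ → BBY B₁ o₁ → BBY B₂ o₂ → ArcAct (MA A) f s o₁ o₂) where

      Difference : (o₁ o₂ : Orientation n) → Vect n → Vect n → Set
      Difference o₁ o₂ z w = Kernel A z × RowSpace A w ×
        (∀ x → δ (lookup o₁ x) (lookup o₂ x) ≡ z x + w x + arc f s x) ×
        (∀ e → e ∉ B₁ → e ∉ B₂ → e ≢ f → z e ≡ 0ℤ) ×
        (∀ e → e ∈ B₁ → e ∈ B₂ → e ≢ f → w e ≡ 0ℤ)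

      difference : ∀ {o₁ o₂} → BBY B₁ o₁ → BBY B₂ o₂ → Σ[ z ∈ Vect n ] Σ[ w ∈ Vect n ] Difference o₁ o₂ z w
      difference {o₁} {o₂} β₁ β₂
        with arc-act⇒difference R (MA A) (λ c (simple , Vc , _) → simple , Vc) (λ c (simple , Wc , _) → simple , Wc)
               (λ _ → tt) (acts o₁ o₂ β₁ β₂)
           | same-or-distinct
      ... | z , w , Vz , Ww , eq | inj₁ same = z , w , Vz , Ww , eq
        , (λ e _ _ e≢f → proj₁ (vanish e e≢f)) , (λ e _ _ e≢f → proj₂ (vanish e e≢f))
        where
        B₁≡B₂ : B₁ ≡ B₂
        B₁≡B₂ = trans (sym (tabulate∘lookup B₁)) (trans (tabulate-cong same) (tabulate∘lookup B₂))
        vanish : ∀ x → x ≢ f → z x ≡ 0ℤ × w x ≡ 0ℤ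
        vanish = same-orientation R {lookup o₁} {lookup o₂} f s {z} {w} Vz Ww eq
          λ x → bby-unique basis₁ (β₁ x tt) (subst (λ B → BBYAt B x (lookup o₂ x)) (sym B₁≡B₂) (β₂ x tt))
      ... | z , w , Vz , Ww , eq | inj₂ distinct = z , w , Vz , Ww , eq
        , (λ e e∉B₁ e∉B₂ → z-vanishes free cofree f s {z} {w} Vz Ww eq e (outside e∉B₁) (outside e∉B₂))
        , (λ e e∈B₁ e∈B₂ → w-vanishes free cofree f s {z} {w} Vz Ww eq e ([]=⇒lookup e∈B₁) ([]=⇒lookup e∈B₂))
        where
        open Consistency R b₁ b₂ (lookup o₁) (lookup o₂)
        free = circuit-free {o₁} {o₂} β₁ β₂ distinct
        cofree = cocircuit-free {o₁} {o₂} β₁ β₂ distinct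
        outside : ∀ {B : Subset n} {x} → x ∉ B → lookup B x ≡ false
        outside {B} {x} x∉B with lookup B x in eq
        ... | true = contradiction (lookup⇒[]= x B eq) x∉B
        ... | false = refl

      component : ∀ e → ¬ SameComponent A e f → (e ∈ B₁) ⇔ (e ∈ B₂)
      component e ¬same with bby basis₁ | bby basis₂ | same-or-distinct
      ... | _ | _ | inj₁ same = mk⇔ (λ e∈ → lookup⇒[]= e B₂ (trans (sym (same e)) ([]=⇒lookup e∈)))
                                    (λ e∈ → lookup⇒[]= e B₁ (trans (same e) ([]=⇒lookup e∈)))
      ... | o₁ , β₁ | o₂ , β₂ | inj₂ distinct with difference {o₁} {o₂} β₁ β₂
      ...   | z , w , Vz , Ww , eq , _ =
        mk⇔ (λ e∈ → lookup⇒[]= e B₂ (trans (sym same-at-e) ([]=⇒lookup e∈)))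
            (λ e∈ → lookup⇒[]= e B₁ (trans same-at-e ([]=⇒lookup e∈)))
        where
        ¬common : ¬ Common (Kernel A) e f
        ¬common (c , C , ce≢0 , cf≢0) = ¬same (inj₂ (supp (tabulate c) , elementary⇒circuit C
          , ∈-supp-tabulate c e ce≢0 , ∈-supp-tabulate c f cf≢0))
        same-at-e : b₁ e ≡ b₂ e
        same-at-e = Consistency.disconnected⇒same R b₁ b₂ (lookup o₁) (lookup o₂)
          (circuit-free {o₁} {o₂} β₁ β₂ distinct) (cocircuit-free {o₁} {o₂} β₁ β₂ distinct) f s {z} {w} Vz Ww eq
          e (¬same ∘ inj₁) ¬common

      private
        MD MC : Fin n → SMat n
        MD = deletion (MA A)
        MC = contraction (MA A)

      lift-within : ∀ {P : Fin n → Set} {e x} (c : Chain n) → P e ⊎ lookup c e ≡ 0ℤ →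
        Within (restr e c) P x → Within c P x
      lift-within {e = e} c at-e within y cy≢0 with y ≟ e
      ... | yes refl = inj₁ ([ id , (λ ce≡0 → contradiction ce≡0 cy≢0) ]′ at-e)
      ... | no y≢e = within y (cy≢0 ∘ trans (sym (restr-off e c y y≢e)))

      lift-sign : ∀ {e x s} (c : Chain n) → x ≢ e → SignIs (lookup (restr e c) x) s → SignIs (lookup c x) s
      lift-sign {e} {x} {s} c x≢e = subst (λ a → SignIs a s) (restr-off e c x x≢e)

      signed-elementary : ∀ {c} → σ c → Elementary (Kernel A) (lookup c)
      signed-elementary {c} σc = SC⇒elementary basis₁ (proj₁ signature c σc)

      cosigned-elementary : ∀ {c} → σ* c → Elementary (RowSpace A) (lookup c)
      cosigned-elementary {c} σc = SCo⇒elementary basis₁ (proj₁ cosignature c σc)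

      -- Lifted to the whole matroid, a fundamental cocircuit may gain `e`, which lies off `B`. A
      -- fundamental circuit may not, and does not, because its restriction is also that of a
      -- circuit avoiding `e`.
      deletion-bby : ∀ {B e p} → e ∉ B →
        MinorBBY e (MD e) B p →
        ∀ x → x ≢ e → BBYAt B x (lookup p x)
      deletion-bby {B} {e} {p} e∉B β x x≢e = cocircuit , circuit
        where
        cocircuit : x ∈ B → ∃[ c ] (σ* c × supp c ⊆ (∁ B ∪ ⁅ x ⁆) × SignIs (lookup c x) (lookup p x))
        cocircuit x∈B with proj₁ (β x x≢e) x∈B
        ... | _ , ((c , σc , refl) , _) , sub , is = c , σc
          , within⇒⊆ c (∁ B) x (lift-within c (inj₁ (x∉p⇒x∈∁p e∉B)) (⊆⇒within (restr e c) (∁ B) x sub))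
          , lift-sign c x≢e is
        circuit : x ∉ B → ∃[ c ] (σ c × supp c ⊆ (B ∪ ⁅ x ⁆) × SignIs (lookup c x) (lookup p x))
        circuit x∉B with proj₂ (β x x≢e) x∉B
        ... | _ , ((c , σc , refl) , c′ , SCc′ , c′e≡0 , eq) , sub , is = c , σc
          , within⇒⊆ c B x (lift-within c (inj₂ (avoids (signed-elementary σc)
              (SC⇒elementary basis₁ SCc′) c′e≡0 refl eq)) (⊆⇒within (restr e c) B x sub))
          , lift-sign c x≢e is

      -- With `e` in `B` the roles are exchanged: the circuit may gain `e`, while the cocircuit has
      -- to avoid it.
      contraction-bby : ∀ {B e p} → e ∈ B →
        MinorBBY e (MC e) (B - e) p →
        ∀ x → x ≢ e → BBYAt B x (lookup p x)
      contraction-bby {B} {e} {p} e∈B β x x≢e = cocircuit , circuit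
        where
        B-e⊆B : ∀ {y} → y ∈ B - e → y ∈ B
        B-e⊆B = p─q⊆p B ⁅ e ⁆
        cocircuit : x ∈ B → ∃[ c ] (σ* c × supp c ⊆ (∁ B ∪ ⁅ x ⁆) × SignIs (lookup c x) (lookup p x))
        cocircuit x∈B with proj₁ (β x x≢e) (x∈p∧x≢y⇒x∈p-y x∈B x≢e)
        ... | _ , ((c , σc , refl) , c′ , SCc′ , c′e≡0 , eq) , sub , is = c , σc
          , within⇒⊆ c (∁ B) x outside , lift-sign c x≢e is
          where
          ce≡0 : lookup c e ≡ 0ℤ
          ce≡0 = avoids (cosigned-elementary σc) (SCo⇒elementary basis₁ SCc′) c′e≡0 refl eq
          outside : Within c (_∈ ∁ B) x
          outside y cy≢0 = Sum.map₁ (λ y∈ → x∉p⇒x∈∁p λ y∈B → x∈∁p⇒x∉p y∈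
              (x∈p∧x≢y⇒x∈p-y y∈B λ { refl → cy≢0 ce≡0 }))
            (lift-within {_∈ ∁ (B - e)} c (inj₂ ce≡0) (⊆⇒within (restr e c) (∁ (B - e)) x sub) y cy≢0)
        circuit : x ∉ B → ∃[ c ] (σ c × supp c ⊆ (B ∪ ⁅ x ⁆) × SignIs (lookup c x) (lookup p x))
        circuit x∉B with proj₂ (β x x≢e) (x∉B ∘ B-e⊆B)
        ... | _ , ((c , σc , refl) , _) , sub , is = c , σc
          , within⇒⊆ c B x (lift-within c (inj₁ e∈B)
              (λ y cy≢0 → Sum.map₁ B-e⊆B (⊆⇒within (restr e c) (B - e) x sub y cy≢0)))
          , lift-sign c x≢e is

      deletion-acts : ∀ e → e ∉ B₁ → e ∉ B₂ → e ≢ f → ∀ p₁ p₂ →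
        MinorBBY e (MD e) B₁ p₁ →
        MinorBBY e (MD e) B₂ p₂ →
        ArcAct (MD e) f s p₁ p₂
      deletion-acts e e∉B₁ e∉B₂ e≢f p₁ p₂ β₁ β₂
        with extend-bby e basis₁ p₁ (deletion-bby {p = p₁} e∉B₁ β₁) | extend-bby e basis₂ p₂ (deletion-bby {p = p₂} e∉B₂ β₂)
      ... | o₁ , γ₁ , same₁ | o₂ , γ₂ , same₂ with difference {o₁} {o₂} γ₁ γ₂
      ...   | z , w , Vz , Ww , eq , z-vanish , _ = minor-act R e (MD e) (λ _ → id)
        (λ c E _ → inj₁ (deletionV⇒restriction R e (elementary⇒SC) E))
        (λ c E alive → inj₂ (deletionW⇒minimal-restriction R e (elementary⇒SCo)
          (λ (_ , Wc , _) → Wc) E (alive e refl)))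
        f s p₁ p₂ e≢f {z} {w} Vz Ww (z-vanish e e∉B₁ e∉B₂ e≢f)
        λ x x≢e → trans (cong₂ δ (sym (same₁ x x≢e)) (sym (same₂ x x≢e))) (eq x)

      contraction-acts : ∀ e → e ∈ B₁ → e ∈ B₂ → e ≢ f → ∀ p₁ p₂ →
        MinorBBY e (MC e) (B₁ - e) p₁ →
        MinorBBY e (MC e) (B₂ - e) p₂ →
        ArcAct (MC e) f s p₁ p₂
      contraction-acts e e∈B₁ e∈B₂ e≢f p₁ p₂ β₁ β₂
        with extend-bby e basis₁ p₁ (contraction-bby {p = p₁} e∈B₁ β₁) | extend-bby e basis₂ p₂ (contraction-bby {p = p₂} e∈B₂ β₂)
      ... | o₁ , γ₁ , same₁ | o₂ , γ₂ , same₂ with difference {o₁} {o₂} γ₁ γ₂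
      -- Contraction is deletion for the exchanged pair, with `w` in the role of `z`.
      ...   | z , w , Vz , Ww , eq , _ , w-vanish = minor-act (swap R) e (MC e) (λ _ → id)
        (λ c E _ → inj₂ (deletionV⇒restriction (swap R) e (elementary⇒SCo) E))
        (λ c E alive → inj₁ (deletionW⇒minimal-restriction (swap R) e (elementary⇒SC)
          (λ (_ , Vc , _) → Vc) E (alive e refl)))
        f s p₁ p₂ e≢f {w} {z} Ww Vz (w-vanish e e∈B₁ e∈B₂ e≢f)
        λ x x≢e → trans (cong₂ δ (sym (same₁ x x≢e)) (sym (same₂ x x≢e)))
          (trans (eq x) (cong (λ a → a + arc f s x) (ℤP.+-comm (z x) (w x))))

theorem1p1 : ∀ {r n : ℕ} (A : Matrix r n) → TotallyUnimodular A → FullRowRank A →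
    (σ σ* : Chain n → Set) →
    CircuitSignature (MA A) σ → CocircuitSignature (MA A) σ* →
    Triangulating (MA A) σ σ* →
    (f : Fin n) (s : Sign) (B₁ B₂ : Subset n) →
    Basis (MA A) B₁ → Basis (MA A) B₂ →
    (∀ o₁ o₂ → IsBBY (MA A) σ σ* B₁ o₁ → IsBBY (MA A) σ σ* B₂ o₂ →
    ArcAct (MA A) f s o₁ o₂) →
    (∀ (e : Fin n) → e ∉ B₁ → e ∉ B₂ → e ≢ f → ∀ p₁ p₂ →
    IsBBY (deletion (MA A) e) (minorSig e σ (SC (deletion (MA A) e)))
    (minorSig e σ* (SCo (deletion (MA A) e))) B₁ p₁ →
    IsBBY (deletion (MA A) e) (minorSig e σ (SC (deletion (MA A) e)))
    (minorSig e σ* (SCo (deletion (MA A) e))) B₂ p₂ →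
    ArcAct (deletion (MA A) e) f s p₁ p₂)
    × (∀ (e : Fin n) → e ∈ B₁ → e ∈ B₂ → e ≢ f → ∀ p₁ p₂ →
    IsBBY (contraction (MA A) e) (minorSig e σ (SC (contraction (MA A) e)))
    (minorSig e σ* (SCo (contraction (MA A) e))) (B₁ - e) p₁ →
    IsBBY (contraction (MA A) e) (minorSig e σ (SC (contraction (MA A) e)))
    (minorSig e σ* (SCo (contraction (MA A) e))) (B₂ - e) p₂ →
    ArcAct (contraction (MA A) e) f s p₁ p₂)
    × (∀ (e : Fin n) → ¬ SameComponent A e f → (e ∈ B₁) ⇔ (e ∈ B₂))
theorem1p1 A unimodular full-rank σ σ* signature cosignature triangulating f s B₁ B₂ basis₁ basis₂ acts =
    deletion-acts basis₁ basis₂ f s acts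
  , contraction-acts basis₁ basis₂ f s acts
  , component basis₁ basis₂ f s acts
  where open Theorem A unimodular full-rank σ σ* signature cosignature triangulating
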